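{- Let $G$ be a graph, let $z\in V(G)$, and let $k$ be a positive integer. If $G$ is $(3k-3)$-edge-connected or $(2k-2)$-tree-connected, then $G$ can be edge-decomposed into $k$ factors $G_1,\ldots,G_k$ satisfying $\big||E(G_i)|-|E(G)|/k\big|<1$ for all $i$, such that for each $i$ and each vertex $v$, $$|d_{G_i}(v)-d_G(v)/k|<\begin{cases}2 & \text{if } v=z,\\ 1 & \text{otherwise.}\end{cases}$$ Furthermore, the decomposition can be chosen so that in addition $|d_{G_i}(z)-d_{G_j}(z)|\le 2$ for all $1\le i,j\le k$.
   Context: Graphs are finite and may have loops and multiple edges; a loop contributes $2$ to the degree $d_G(v)$. A factor is a spanning subgraph; "edge-decomposed into factors $G_1,\ldots,G_k$" means $E(G)$ is partitioned into $E(G_1),\ldots,E(G_k)$ with each $G_i$ spanning. A graph is $m$-tree-connected if it contains $m$ edge-disjoint spanning trees. -}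

module Defs where

open import Data.Nat using (ℕ; zero; suc; _+_; _*_; _∸_; _≤_; _<_)
open import Data.Fin using (Fin)
open import Data.Fin.Properties using (_≟_)
open import Data.Bool using (Bool; true; false; if_then_else_)
open import Data.Maybe using (Maybe; just; nothing)
open import Data.Product using (_×_; _,_; proj₁; proj₂; Σ; ∃-syntax)
open import Data.List using (List; map; allFin)
open import Data.Nat.ListAction using (sum)
open import Relation.Nullary using (¬_; Dec; yes; no)
open import Relation.Nullary.Decidable using (⌊_⌋)
open import Relation.Binary.PropositionalEquality using (_≡_)

-- A finite multigraph with loops: vertices Fin n, edges Fin m,
-- each edge has an (unordered) pair of endpoints.
record Graph : Set where
  field
    n    : ℕ
    m    : ℕ
    ends : Fin m → Fin n × Fin n
open Graph public

EdgeSet : Graph → Set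
EdgeSet G = Fin (m G) → Bool

size : (G : Graph) → EdgeSet G → ℕ
size G S = sum (map (λ e → if S e then 1 else 0) (allFin (m G)))

-- multiplicity of v as an endpoint of e (a loop counts 2)
incid : (G : Graph) → Fin (m G) → Fin (n G) → ℕ
incid G e v = (if ⌊ proj₁ (ends G e) ≟ v ⌋ then 1 else 0)
            + (if ⌊ proj₂ (ends G e) ≟ v ⌋ then 1 else 0)

deg : (G : Graph) → EdgeSet G → Fin (n G) → ℕ
deg G S v = sum (map (λ e → if S e then incid G e v else 0) (allFin (m G)))

allEdges : (G : Graph) → EdgeSet G
allEdges G e = true

data Reach (G : Graph) (S : EdgeSet G) : Fin (n G) → Fin (n G) → Set where
  here : ∀ {u} → Reach G S u u
  fwd  : ∀ {u w} e → S e ≡ true → proj₁ (ends G e) ≡ u →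
         Reach G S (proj₂ (ends G e)) w → Reach G S u w
  bwd  : ∀ {u w} e → S e ≡ true → proj₂ (ends G e) ≡ u →
         Reach G S (proj₁ (ends G e)) w → Reach G S u w

Connected : (G : Graph) → EdgeSet G → Set
Connected G S = ∀ u v → Reach G S u v

without : (G : Graph) → EdgeSet G → Fin (m G) → EdgeSet G
without G S f e = if ⌊ e ≟ f ⌋ then false else S e

-- S is a spanning tree: connected, and acyclic (every edge of S is a
-- bridge of (V,S), i.e. its endpoints are disconnected after deleting it;
-- in particular S has no loops)
SpanningTree : (G : Graph) → EdgeSet G → Set
SpanningTree G S =
  Connected G S ×
  (∀ e → S e ≡ true →
     ¬ Reach G (without G S e) (proj₁ (ends G e)) (proj₂ (ends G e)))

-- G contains t edge-disjoint spanning trees: each edge is assigned to at most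
-- one tree, and the edges assigned to tree i form a spanning tree.
treeClass : (G : Graph) {t : ℕ} → (Fin (m G) → Maybe (Fin t)) → Fin t → EdgeSet G
treeClass G a i e with a e
... | just j  = ⌊ j ≟ i ⌋
... | nothing = false

TreeConnected : ℕ → Graph → Set
TreeConnected t G = Σ (Fin (m G) → Maybe (Fin t)) λ a →
  ∀ i → SpanningTree G (treeClass G a i)

EdgeConnected : ℕ → Graph → Set
EdgeConnected l G = ∀ (F : EdgeSet G) → size G F < l →
  Connected G (λ e → if F e then false else true)

factor : (G : Graph) {k : ℕ} → (Fin (m G) → Fin k) → Fin k → EdgeSet G
factor G c i e = ⌊ c e ≟ i ⌋

{-# OPTIONS --safe #-}
-- It suffices to orient G so that k divides the outdegree of every vertex v ≠ z. Splitting every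
-- vertex into an out-side and an in-side makes the oriented graph bipartite, and it has a k-edge-
-- colouring that is equitable at all sides: two colours are equalised by a balanced orientation of
-- their union, and this lowers the sum of the squared degrees. At v ≠ z all colours have the same
-- outdegree, so only the in-sides can differ, by at most 1.
--
-- For k = 2 such an orientation is obtained by reversing paths that end at z. For k ≥ 3 both
-- hypotheses imply that a partition into p ≥ 2 blocks is crossed by more than k (p - 1) edges.
-- Therefore G has conductances c for which every edge e satisfies k c(e) R(e) < 1, where R(e) is the
-- effective resistance between the ends of e: as long as this fails for an edge, lower its
-- conductance. The determinant of the Laplacian, which is at least the product of c over a maximum
-- spanning tree up to a constant factor, would become too small if this did not stop.
-- Among the integer demands b ≡ - deg (mod 2k), take one whose energy cannot be lowered by adding
-- ± 2k (u - v) for an edge uv. Then the potential difference between u and v is at most k R(uv), so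
-- that the current in every edge is at most 1. Rounding this flow gives an orientation with
-- outdegree - indegree = b, that is, with outdegree (deg + b) / 2 ≡ 0 (mod k).
-- To keep the Laplacian invertible, every vertex is joined to the ground z by two auxiliary edges,
-- one of conductance 1 and one whose conductance is adjusted; their currents are too small to
-- affect the rounding.
module Submission where

open import Algebra.Bundles using (CommutativeRing)
open import Data.Bool.Base using (Bool; true; false; if_then_else_; not; _xor_; _∨_)
open import Data.Empty using (⊥-elim)
open import Data.Fin.Base using (Fin; zero; suc; toℕ; splitAt; join; punchIn; punchOut; _↑ˡ_; _↑ʳ_)
import Data.Fin.Properties as Fin
open import Data.List.Base using (List; []; _∷_; _++_; [_]; _ʳ++_; map; length; allFin; tabulate)
open import Data.List.Membership.Propositional using (_∈_)
open import Data.List.Membership.Propositional.Properties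
  using (∈-∃++; ∈-++⁺ˡ; ∈-++⁺ʳ; ∈-map⁺; ∈-map⁻; ∈-allFin)
open import Data.List.Properties using (map-++; map-tabulate; map-∘; length-map; length-tabulate; map-cong-local)
open import Data.List.Relation.Binary.Permutation.Propositional as Perm using (_↭_; ↭-sym; ↭-trans; ↭-refl)
open import Data.List.Relation.Binary.Permutation.Propositional.Properties
  using (map⁺; ++⁺; ++-comm; shift; ∷↭∷ʳ; ↭-length; All-resp-↭)
open import Data.List.Relation.Unary.All as All using (All; []; _∷_)
open import Data.List.Relation.Unary.All.Properties using (++⁻ʳ)
open import Data.List.Relation.Unary.AllPairs using (AllPairs; []; _∷_)
open import Data.List.Relation.Unary.Any using (here; there)
open import Data.List.Relation.Unary.Linked.Properties using (Linked⇒AllPairs)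
open import Data.List.Relation.Unary.Unique.Propositional using (Unique)
import Data.List.Relation.Unary.Unique.Propositional.Properties as Unique
import Data.List.Sort as Sort
open import Data.Maybe.Base using (just; nothing)
open import Data.Nat.Base as ℕ using (ℕ; zero; suc)
open import Data.Nat.ListAction using () renaming (sum to sumˡ)
open import Data.Nat.ListAction.Properties using (sum-↭)
import Data.Nat.Properties as ℕₚ
open import Data.Product.Base using (_×_; _,_; proj₁; proj₂; ∃)
open import Data.Sum.Base using (_⊎_; inj₁; inj₂)
import Data.Sum.Properties as Sum
open import Data.Vec.Functional using (removeAt)
open import Function.Base using (_∘_; _$_; case_of_)
import Relation.Binary.Construct.Flip.Ord as Flip
import Relation.Binary.Construct.On as On
open import Relation.Binary.Definitions using (DecidableEquality)
open import Relation.Binary.PropositionalEquality hiding ([_])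
open import Relation.Nullary using (¬_; Dec; yes; no; does)
open import Relation.Nullary.Decidable
  using (_⊎-dec_; _×-dec_; ¬?; dec-true; dec-false; dec⇒maybe; isYes≗does; ⌊_⌋)

-- Why the lowering of conductances must stop: conductances are powers `s ^ h`, all heights h start
-- at H, and a step lowers one height by 1. It multiplies the determinant by 1 - u c R, which is at
-- most 1 - u / k for an overloaded edge. On the other hand, density applied to the suffixes of the
-- sorted edge list shows that the heights in a maximum spanning tree fall in total by at most d /
-- (k d + 1) times the total fall in the graph, where d = n - 1. So per step the determinant loses
-- about u / k to first order, the tree bound only about u d / (k d + 1), which is less. The surplus
-- 1 in the density condition is this gap. It pays for the terms of second order in u and for the
-- steps at auxiliary edges, and it allows edges with k c R = 1 to be lowered as well, so that the
-- final inequality is strict. Strictness is what the demands need: every move that repairs an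
-- overfull edge then lowers the energy by at least a fixed positive amount, which bounds the number
-- of moves. Integer heights and explicit step bounds take the place of a compactness argument, and
-- all numbers stay rational.

module Balancing where
  open import Data.Integer.Base hiding (suc)
  open import Data.Integer.Properties
  open import Data.Integer.Tactic.RingSolver using (solve-∀)
  open import Algebra.Properties.AbelianGroup +-0-abelianGroup using (∙-cancelˡ; ∙-cancelʳ)
  open import Algebra.Properties.Semiring.Sum +-*-semiring
    using (sum; sum-cong-≗; ∑-distrib-+; ∑-comm)

  -- Balanced orientations, equalisation of classes, and rounding of fractional orientations.

  sum-change : ∀ {n} (f g : Fin n → ℤ) i → (∀ j → j ≢ i → f j ≡ g j) →
               sum f + g i ≡ sum g + f i
  sum-change f g zero    eq =
    trans (cong (λ s → f zero + s + g zero) (sum-cong-≗ λ j → eq (suc j) λ ()))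
          (swap (f zero) _ (g zero))
    where
    swap : ∀ a b c → a + b + c ≡ c + b + a
    swap = solve-∀
  sum-change f g (suc i) eq =
    trans (+-assoc (f zero) _ _)
    (trans (cong₂ _+_ (eq zero λ ())
              (sum-change (f ∘ suc) (g ∘ suc) i λ j j≢i → eq (suc j) (j≢i ∘ Fin.suc-injective)))
           (sym (+-assoc (g zero) _ _)))

  sum-change₂ : ∀ {n} (f g : Fin n → ℤ) i j → i ≢ j → (∀ l → l ≢ i → l ≢ j → f l ≡ g l) →
                sum f + (g i + g j) ≡ sum g + (f i + f j)
  sum-change₂ {n} f g i j i≢j eq = begin
    sum f + (g i + g j)            ≡⟨ +-assoc (sum f) _ _ ⟨
    sum f + g i + g j              ≡⟨ cong (λ x → sum f + x + g j) hi ⟨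
    sum f + h i + g j              ≡⟨ cong (_+ g j) (sum-change f h i λ l l≢i → sym (h≢i l l≢i)) ⟩
    sum h + f i + g j              ≡⟨ shuffle (sum h) (f i) (g j) ⟩
    sum h + g j + f i              ≡⟨ cong (_+ f i) (sum-change h g j h≢j) ⟩
    sum g + h j + f i              ≡⟨ cong (λ x → sum g + x + f i) (h≢i j (i≢j ∘ sym)) ⟩
    sum g + f j + f i              ≡⟨ swap (sum g) (f j) (f i) ⟩
    sum g + (f i + f j)            ∎
    where
    open ≡-Reasoning
    h : Fin n → ℤ
    h l = if does (l Fin.≟ i) then g i else f l
    hi : h i ≡ g i
    hi with i Fin.≟ i
    ... | yes _ = refl
    ... | no i≢i = ⊥-elim (i≢i refl)
    h≢i : ∀ l → l ≢ i → h l ≡ f l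
    h≢i l l≢i with l Fin.≟ i
    ... | yes l≡i = ⊥-elim (l≢i l≡i)
    ... | no  _   = refl
    h≢j : ∀ l → l ≢ j → h l ≡ g l
    h≢j l l≢j with l Fin.≟ i
    ... | yes refl = refl
    ... | no  l≢i  = eq l l≢i l≢j
    shuffle : ∀ a b c → a + b + c ≡ a + c + b
    shuffle = solve-∀
    swap : ∀ a b c → a + b + c ≡ a + (c + b)
    swap = solve-∀

  sum-mono : ∀ {n} (f g : Fin n → ℤ) → (∀ i → f i ≤ g i) → sum f ≤ sum g
  sum-mono {zero}  f g le = ≤-refl
  sum-mono {suc n} f g le = +-mono-≤ (le zero) (sum-mono _ _ (le ∘ suc))

  sum-mono-< : ∀ {n} (f g : Fin n → ℤ) → (∀ i → f i ≤ g i) → ∀ i → f i < g i → sum f < sum g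
  sum-mono-< f g le zero    lt = +-mono-<-≤ lt (sum-mono _ _ (le ∘ suc))
  sum-mono-< f g le (suc i) lt = +-mono-≤-< (le zero) (sum-mono-< _ _ (le ∘ suc) i lt)

  sum-zero : ∀ {n} (f : Fin n → ℤ) → (∀ i → f i ≡ 0ℤ) → sum f ≡ 0ℤ
  sum-zero {zero}  f eq = refl
  sum-zero {suc n} f eq = cong₂ _+_ (eq zero) (sum-zero (f ∘ suc) (eq ∘ suc))

  sum-neg : ∀ {n} (f : Fin n → ℤ) → sum (λ i → - f i) ≡ - sum f
  sum-neg {zero}  f = refl
  sum-neg {suc n} f = trans (cong (_+_ (- f zero)) (sum-neg (f ∘ suc))) (sym (neg-distrib-+ (f zero) _))

  sum-- : ∀ {n} (f g : Fin n → ℤ) → sum (λ i → f i - g i) ≡ sum f - sum g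
  sum-- f g = trans (∑-distrib-+ f (λ i → - g i)) (cong (_+_ (sum f)) (sum-neg g))

  sum-const : ∀ n (x : ℤ) → sum {n} (λ _ → x) ≡ + n * x
  sum-const zero    x = sym (*-zeroˡ x)
  sum-const (suc n) x = trans (cong (_+_ x) (sum-const n x)) (sym (suc-* (+ n) x))

  sgn : Bool → ℤ → ℤ
  sgn true  x = x
  sgn false x = - x

  module Incidence {W : Set} (_≟_ : DecidableEquality W) where

    δ : W → W → ℤ
    δ u w = if does (u ≟ w) then 1ℤ else 0ℤ

    δ-diag : ∀ u → δ u u ≡ 1ℤ
    δ-diag u with u ≟ u
    ... | yes _  = refl
    ... | no u≢u = ⊥-elim (u≢u refl)

    δ-off : ∀ {u w} → u ≢ w → δ u w ≡ 0ℤ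
    δ-off {u} {w} u≢w with u ≟ w
    ... | yes u≡w = ⊥-elim (u≢w u≡w)
    ... | no  _   = refl

    boundary : W × W → W → ℤ
    boundary (u , v) w = δ u w - δ v w

    boundary-loop : ∀ b u w → sgn b (boundary (u , u) w) ≡ 0ℤ
    boundary-loop true  u w = +-inverseʳ (δ u w)
    boundary-loop false u w = cong -_ (+-inverseʳ (δ u w))

    ∣δ-δ∣≤1 : ∀ u v w → ∣ boundary (u , v) w ∣ ℕ.≤ 1
    ∣δ-δ∣≤1 u v w with does (u ≟ w) | does (v ≟ w)
    ... | true  | true  = ℕ.z≤n
    ... | true  | false = ℕ.s≤s ℕ.z≤n
    ... | false | true  = ℕ.s≤s ℕ.z≤n
    ... | false | false = ℕ.z≤n

    net : ∀ {m} → (Fin m → W × W) → (Fin m → Bool) → W → ℤ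
    net g σ w = sum λ e → sgn (σ e) (boundary (g e) w)

    private
      Touches : W → W × W → Set
      Touches v p = proj₁ p ≡ v ⊎ proj₂ p ≡ v

      touches? : ∀ v p → Dec (Touches v p)
      touches? v p = (proj₁ p ≟ v) ⊎-dec (proj₂ p ≟ v)

      untouched : ∀ {v p} b → ¬ Touches v p → sgn b (boundary p v) ≡ 0ℤ
      untouched {v} {u , w} b ¬t =
        trans (cong (sgn b) (cong₂ _-_ (δ-off (¬t ∘ inj₁)) (δ-off (¬t ∘ inj₂)))) (sgn-0 b)
        where
        sgn-0 : ∀ b → sgn b 0ℤ ≡ 0ℤ
        sgn-0 true  = refl
        sgn-0 false = refl

      cons : ∀ {m} → Bool → (Fin m → Bool) → Fin (suc m) → Bool
      cons b σ zero    = b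
      cons b σ (suc e) = σ e

    -- Two edges uv and vw at a vertex v are replaced by the single edge uw, whose
    -- orientation is passed on to the path u v w.
    balanced-orientation : ∀ {m} (g : Fin m → W × W) →
      ∃ λ σ → ∀ w → ∣ net g σ w ∣ ℕ.≤ 1
    balanced-orientation {zero}  g = (λ ()) , λ w → ℕ.z≤n
    balanced-orientation {suc m} g = start (u ≟ v)
      where
      u = proj₁ (g zero)
      v = proj₂ (g zero)
      rest = g ∘ suc

      Goal = ∃ λ σ → ∀ w → ∣ net g σ w ∣ ℕ.≤ 1

      absorb : ∀ e p (b₀ : Bool → Bool) →
        (∀ b w → sgn b (boundary p w) ≡
                 sgn (b₀ b) (boundary (u , v) w) + sgn b (boundary (rest e) w)) →
        Goal
      absorb e p b₀ split with balanced-orientation g′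
        where
        g′ : Fin m → W × W
        g′ j = if does (j Fin.≟ e) then p else rest j
      ... | σ , bal = cons (b₀ (σ e)) σ , λ w → subst (λ x → ∣ x ∣ ℕ.≤ 1) (sym (eq w)) (bal w)
        where
        g′ : Fin m → W × W
        g′ j = if does (j Fin.≟ e) then p else rest j
        g′e : g′ e ≡ p
        g′e rewrite dec-true (e Fin.≟ e) refl = refl
        cancel : ∀ a b c d → a + c ≡ b + (d + c) → a ≡ d + b
        cancel a b c d h = ∙-cancelʳ c a (d + b) (trans h (lem b c d))
          where
          lem : ∀ b c d → b + (d + c) ≡ d + b + c
          lem = solve-∀
        eq : ∀ w → net g (cons (b₀ (σ e)) σ) w ≡ net g′ σ w
        eq w = sym $ cancel (net g′ σ w) (net rest σ w) (sgn (σ e) (boundary (rest e) w)) (sgn (b₀ (σ e)) (boundary (u , v) w)) $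
          trans (sum-change (λ j → sgn (σ j) (boundary (g′ j) w)) (λ j → sgn (σ j) (boundary (rest j) w)) e
                   λ j j≢e → cong (λ b → sgn (σ j) (boundary (if b then p else rest j) w))
                                  (dec-false (j Fin.≟ e) j≢e))
                (cong (_+_ (net rest σ w))
                   (trans (cong (λ q → sgn (σ e) (boundary q w)) g′e) (split (σ e) w)))

      -- Neither end meets another edge, so the net at `u` and at `v` is that of this edge alone.
      none : ¬ (∃ λ e → Touches v (rest e)) → ¬ (∃ λ e → Touches u (rest e)) → Goal
      none ¬v ¬u with balanced-orientation rest
      ... | σ , bal = cons true σ , bound
        where
        isolated : ∀ w → ¬ (∃ λ e → Touches w (rest e)) → ∣ net g (cons true σ) w ∣ ℕ.≤ 1
        isolated w ¬w = subst (λ x → ∣ x ∣ ℕ.≤ 1)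
          (sym (trans (cong (_+_ (boundary (u , v) w)) (sum-zero _ λ e → untouched (σ e) λ t → ¬w (e , t)))
                      (+-identityʳ (boundary (u , v) w))))
          (∣δ-δ∣≤1 u v w)
        bound : ∀ w → ∣ net g (cons true σ) w ∣ ℕ.≤ 1
        bound w with u ≟ w | v ≟ w in v≟w
        ... | yes refl | _        = subst (λ x → ∣ 1ℤ - (if x then 1ℤ else 0ℤ) + net rest σ w ∣ ℕ.≤ 1) (cong does v≟w)
                                      (subst (λ x → ∣ x - δ v w + net rest σ w ∣ ℕ.≤ 1) (δ-diag w) (isolated w ¬u))
        ... | no u≢w   | yes refl = subst (λ y → ∣ 0ℤ - y + net rest σ w ∣ ℕ.≤ 1) (δ-diag w)
                                      (subst (λ x → ∣ x - δ w w + net rest σ w ∣ ℕ.≤ 1) (δ-off u≢w) (isolated w ¬v))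
        ... | no _     | no _     = subst (λ x → ∣ x ∣ ℕ.≤ 1) (sym (+-identityˡ (net rest σ w))) (bal w)

      to-u : ¬ (∃ λ e → Touches v (rest e)) → Dec (∃ λ e → Touches u (rest e)) → Goal
      to-u ¬v (no ¬u) = none ¬v ¬u
      to-u ¬v (yes (e , inj₁ eq)) = absorb e (v , proj₂ (rest e)) not λ
        { true  w → trans (lem₁ (δ v w) (δ u w) (δ (proj₂ (rest e)) w)) (cong (λ x → - (δ u w - δ v w) + (δ x w - δ (proj₂ (rest e)) w)) (sym eq))
        ; false w → trans (lem₂ (δ v w) (δ u w) (δ (proj₂ (rest e)) w)) (cong (λ x → δ u w - δ v w + - (δ x w - δ (proj₂ (rest e)) w)) (sym eq)) }
        where
        lem₁ : ∀ a b c → a - c ≡ - (b - a) + (b - c)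
        lem₁ = solve-∀
        lem₂ : ∀ a b c → - (a - c) ≡ b - a + - (b - c)
        lem₂ = solve-∀
      to-u ¬v (yes (e , inj₂ eq)) = absorb e (proj₁ (rest e) , v) (λ b → b) λ
        { true  w → trans (lem₁ (δ v w) (δ u w) (δ (proj₁ (rest e)) w)) (cong (λ x → (δ u w - δ v w) + (δ (proj₁ (rest e)) w - δ x w)) (sym eq))
        ; false w → trans (lem₂ (δ v w) (δ u w) (δ (proj₁ (rest e)) w)) (cong (λ x → - (δ u w - δ v w) + - (δ (proj₁ (rest e)) w - δ x w)) (sym eq)) }
        where
        lem₁ : ∀ a b c → c - a ≡ (b - a) + (c - b)
        lem₁ = solve-∀
        lem₂ : ∀ a b c → - (c - a) ≡ - (b - a) + - (c - b)
        lem₂ = solve-∀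

      to-v : Dec (∃ λ e → Touches v (rest e)) → Goal
      to-v (no ¬v) = to-u ¬v (Fin.any? λ e → touches? u (rest e))
      to-v (yes (e , inj₁ eq)) = absorb e (u , proj₂ (rest e)) (λ b → b) λ
        { true  w → trans (lem₁ (δ v w) (δ u w) (δ (proj₂ (rest e)) w)) (cong (λ x → (δ u w - δ v w) + (δ x w - δ (proj₂ (rest e)) w)) (sym eq))
        ; false w → trans (lem₂ (δ v w) (δ u w) (δ (proj₂ (rest e)) w)) (cong (λ x → - (δ u w - δ v w) + - (δ x w - δ (proj₂ (rest e)) w)) (sym eq)) }
        where
        lem₁ : ∀ a b c → b - c ≡ (b - a) + (a - c)
        lem₁ = solve-∀
        lem₂ : ∀ a b c → - (b - c) ≡ - (b - a) + - (a - c)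
        lem₂ = solve-∀
      to-v (yes (e , inj₂ eq)) = absorb e (proj₁ (rest e) , u) not λ
        { true  w → trans (lem₁ (δ v w) (δ u w) (δ (proj₁ (rest e)) w)) (cong (λ x → - (δ u w - δ v w) + (δ (proj₁ (rest e)) w - δ x w)) (sym eq))
        ; false w → trans (lem₂ (δ v w) (δ u w) (δ (proj₁ (rest e)) w)) (cong (λ x → δ u w - δ v w + - (δ (proj₁ (rest e)) w - δ x w)) (sym eq)) }
        where
        lem₁ : ∀ a b c → c - b ≡ - (b - a) + (c - a)
        lem₁ = solve-∀
        lem₂ : ∀ a b c → - (c - b) ≡ b - a + - (c - a)
        lem₂ = solve-∀

      start : Dec (u ≡ v) → Goal
      start (yes u≡v) with balanced-orientation rest
      ... | σ , bal = cons true σ , λ w → subst (λ x → ∣ x ∣ ℕ.≤ 1)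
        (sym (trans (cong (_+ net rest σ w)
                       (trans (cong (λ x → δ x w - δ v w) u≡v) (+-inverseʳ (δ v w))))
                    (+-identityˡ (net rest σ w))))
        (bal w)
      start (no _) = to-v (Fin.any? λ e → touches? v (rest e))

  private
    i+j-j≡i : ∀ i j → i + j + - j ≡ i
    i+j-j≡i = solve-∀

  +-cancelʳ-≤ : ∀ k i j → i + k ≤ j + k → i ≤ j
  +-cancelʳ-≤ k i j le = subst₂ _≤_ (i+j-j≡i i k) (i+j-j≡i j k) (+-monoˡ-≤ (- k) le)

  +-cancelʳ-< : ∀ k i j → i + k < j + k → i < j
  +-cancelʳ-< k i j lt = subst₂ _<_ (i+j-j≡i i k) (i+j-j≡i j k) (+-monoˡ-< (- k) lt)

  0≤i*j : ∀ {i j} → 0ℤ ≤ i → 0ℤ ≤ j → 0ℤ ≤ i * j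
  0≤i*j {+ m} {+ n} _ _ = subst (0ℤ ≤_) (pos-* m n) (+≤+ ℕ.z≤n)

  0≤i*i : ∀ i → 0ℤ ≤ i * i
  0≤i*i (+ n)    = 0≤i*j {+ n} {+ n} (+≤+ ℕ.z≤n) (+≤+ ℕ.z≤n)
  0≤i*i -[1+ n ] = +≤+ ℕ.z≤n

  0≤i*[i+1] : ∀ i → 0ℤ ≤ i * (i + 1ℤ)
  0≤i*[i+1] (+ n)          = 0≤i*j {+ n} (+≤+ ℕ.z≤n) (+≤+ ℕ.z≤n)
  0≤i*[i+1] -[1+ zero ]  = +≤+ ℕ.z≤n
  0≤i*[i+1] -[1+ suc n ] = +≤+ ℕ.z≤n

  0≤i*[i+d] : ∀ i d → ∣ d ∣ ℕ.≤ 1 → 0ℤ ≤ i * (i + d)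
  0≤i*[i+d] i (+ 0)           _ = subst (λ j → 0ℤ ≤ i * j) (sym (+-identityʳ i)) (0≤i*i i)
  0≤i*[i+d] i (+ 1)           _ = 0≤i*[i+1] i
  0≤i*[i+d] i (+ suc (suc n)) (ℕ.s≤s ())
  0≤i*[i+d] i -[1+ 0 ]        _ = subst (0ℤ ≤_) (lem i) (0≤i*[i+1] (i - 1ℤ))
    where
    lem : ∀ i → (i - 1ℤ) * (i - 1ℤ + 1ℤ) ≡ i * (i + - 1ℤ)
    lem = solve-∀
  0≤i*[i+d] i -[1+ suc n ]    (ℕ.s≤s ())

  ∣i-j∣≤1⇒i-j≤1 : ∀ i j → ∣ i - j ∣ ℕ.≤ 1 → i - j ≤ 1ℤ
  ∣i-j∣≤1⇒i-j≤1 i j le = ≤-trans (i≤∣i∣ (i - j)) (+≤+ le)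
    where
    i≤∣i∣ : ∀ i → i ≤ + ∣ i ∣
    i≤∣i∣ (+ n)    = ≤-refl
    i≤∣i∣ -[1+ n ] = -≤+

  module _ (a b a′ b′ : ℤ) (eq : a′ + b′ ≡ a + b) (bal : ∣ a′ - b′ ∣ ℕ.≤ 1) where

    private
      -- Half of the drop in the sum of squares. It equals (a - a′)(a - b′), which is nonnegative
      -- because no integer lies strictly between a′ and b′.
      gap : ℤ
      gap = (a - a′) * (a - a′ + (a′ - b′))

      identity : a * a + b * b ≡ a′ * a′ + b′ * b′ + (gap + gap)
      identity = trans (cong (λ b → a * a + b * b) b≡) (lem a a′ b′)
        where
        lem₀ : ∀ a b → b ≡ a + b - a
        lem₀ = solve-∀
        b≡ : b ≡ a′ + b′ - a
        b≡ = trans (lem₀ a b) (cong (_- a) (sym eq))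
        lem : ∀ a a′ b′ → a * a + (a′ + b′ - a) * (a′ + b′ - a) ≡
          a′ * a′ + b′ * b′ + ((a - a′) * (a - a′ + (a′ - b′)) + (a - a′) * (a - a′ + (a′ - b′)))
        lem = solve-∀

      0≤gap : 0ℤ ≤ gap
      0≤gap = 0≤i*[i+d] (a - a′) (a′ - b′) bal

    balanced-squares-≤ : a′ * a′ + b′ * b′ ≤ a * a + b * b
    balanced-squares-≤ = subst₂ _≤_ (+-identityʳ _) (sym identity)
      (+-monoʳ-≤ (a′ * a′ + b′ * b′) (+-mono-≤ 0≤gap 0≤gap))

    balanced-squares-< : ¬ (∣ a - b ∣ ℕ.≤ 1) → a′ * a′ + b′ * b′ < a * a + b * b
    balanced-squares-< unbal = subst₂ _<_ (+-identityʳ _) (sym identity)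
      (+-monoʳ-< (a′ * a′ + b′ * b′) (+-mono-< 0<gap 0<gap))
      where
      -- A vanishing gap means a = a′ or a = b′. Then {a, b} = {a′, b′}, and the old pair would
      -- already be balanced.
      gap≢0 : 0ℤ ≢ gap
      gap≢0 0≡gap with i*j≡0⇒i≡0∨j≡0 (a - a′) (sym 0≡gap)
      ... | inj₁ e = unbal (subst₂ (λ x y → ∣ x - y ∣ ℕ.≤ 1) (sym a≡a′) b′≡b bal)
        where
        a≡a′ : a ≡ a′
        a≡a′ = i-j≡0⇒i≡j a a′ e
        b′≡b : b′ ≡ b
        b′≡b = ∙-cancelˡ a b′ b (trans (cong (_+ b′) a≡a′) eq)
      ... | inj₂ e = unbal (subst₂ (λ x y → ∣ x - y ∣ ℕ.≤ 1) (sym a≡b′) a′≡b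
                              (subst (ℕ._≤ 1) (∣i-j∣≡∣j-i∣ a′ b′) bal))
        where
        telescope : ∀ a a′ b′ → a - a′ + (a′ - b′) ≡ a - b′
        telescope = solve-∀
        a≡b′ : a ≡ b′
        a≡b′ = i-j≡0⇒i≡j a b′ (trans (sym (telescope a a′ b′)) e)
        a′≡b : a′ ≡ b
        a′≡b = ∙-cancelˡ a a′ b (trans (cong (_+ a′) a≡b′) (trans (+-comm b′ a′) eq))
      0<gap : 0ℤ < gap
      0<gap = ≤∧≢⇒< 0≤gap gap≢0

  module _ {State : Set} {K a : ℕ} (load : State → Fin K → Fin a → ℤ) where

    -- Abstract in the state because it serves twice: for edge colourings, where the places `w` are
    -- the two sides of every vertex, and for families of orientations, where they are chosen
    -- vertices.
    Rebalanced : State → Fin K → Fin K → State → Set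
    Rebalanced s i j s′ =
      (∀ w → load s′ i w + load s′ j w ≡ load s i w + load s j w) ×
      (∀ w → ∣ load s′ i w - load s′ j w ∣ ℕ.≤ 1) ×
      (∀ c → c ≢ i → c ≢ j → ∀ w → load s′ c w ≡ load s c w)

    Equitable : State → Set
    Equitable s = ∀ i j w → ∣ load s i w - load s j w ∣ ℕ.≤ 1

    private
      squares : State → Fin a → ℤ
      squares s w = sum λ c → load s c w * load s c w

      energy : State → ℤ
      energy s = sum (squares s)

      0≤energy : ∀ s → 0ℤ ≤ energy s
      0≤energy s = subst (_≤ energy s) (sum-zero {a} (λ _ → 0ℤ) λ _ → refl)
        (sum-mono (λ _ → 0ℤ) (squares s) λ w →
          subst (_≤ squares s w) (sum-zero {K} (λ _ → 0ℤ) λ _ → refl)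
            (sum-mono (λ _ → 0ℤ) _ λ c → 0≤i*i (load s c w)))

      ∣-∣-mono-< : ∀ {i j} → 0ℤ ≤ i → i < j → ∣ i ∣ ℕ.< ∣ j ∣
      ∣-∣-mono-< {+ m} _ (+<+ m<n) = m<n

      totals : ∀ {s i j s′} → i ≢ j → Rebalanced s i j s′ → ∀ w →
               sum (λ c → load s′ c w) ≡ sum (λ c → load s c w)
      totals {s} {i} {j} {s′} i≢j (pair , _ , rest) w =
        ∙-cancelʳ (load s i w + load s j w) _ _
          (trans (sum-change₂ (λ c → load s′ c w) (λ c → load s c w) i j i≢j λ c c≢i c≢j → rest c c≢i c≢j w)
                 (cong (_+_ (sum λ c → load s c w)) (pair w)))

      module _ {s i j s′} (i≢j : i ≢ j) (reb : Rebalanced s i j s′) where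
        private
          exchange : ∀ w → squares s′ w + (load s i w * load s i w + load s j w * load s j w) ≡
                           squares s w + (load s′ i w * load s′ i w + load s′ j w * load s′ j w)
          exchange w = sum-change₂ (λ c → load s′ c w * load s′ c w) (λ c → load s c w * load s c w) i j i≢j
            λ c c≢i c≢j → cong (λ x → x * x) (proj₂ (proj₂ reb) c c≢i c≢j w)

        squares-≤ : ∀ w → squares s′ w ≤ squares s w
        squares-≤ w = +-cancelʳ-≤ _ (squares s′ w) (squares s w) (subst (_≤ _) (sym (exchange w))
          (+-monoʳ-≤ (squares s w) (balanced-squares-≤ (load s i w) (load s j w) (load s′ i w) (load s′ j w) (proj₁ reb w) (proj₁ (proj₂ reb) w))))

        squares-< : ∀ w → ¬ (∣ load s i w - load s j w ∣ ℕ.≤ 1) → squares s′ w < squares s w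
        squares-< w unbal = +-cancelʳ-< _ (squares s′ w) (squares s w) (subst (_< _) (sym (exchange w))
          (+-monoʳ-< (squares s w) (balanced-squares-< (load s i w) (load s j w) (load s′ i w) (load s′ j w)
            (proj₁ reb w) (proj₁ (proj₂ reb) w) unbal)))

        energy-< : ∀ w → ¬ (∣ load s i w - load s j w ∣ ℕ.≤ 1) → energy s′ < energy s
        energy-< w unbal = sum-mono-< (squares s′) (squares s) squares-≤ w (squares-< w unbal)

      distinct : ∀ s {i j w} → 1 ℕ.< ∣ load s i w - load s j w ∣ → i ≢ j
      distinct s {i} {w = w} lt refl =
        ℕₚ.n≮0 (subst (1 ℕ.<_) (cong ∣_∣ (+-inverseʳ (load s i w))) lt)

    -- A step is triggered by one unbalanced place but balances the pair at all places, so no place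
    -- gets a larger sum of squares and the triggering one gets a smaller sum. The energy is a
    -- nonnegative integer and bounds the number of steps.
    equalise : (∀ s i j → i ≢ j → ∃ (Rebalanced s i j)) → ∀ s → ∃ λ s′ →
      Equitable s′ × (∀ w → sum (λ c → load s′ c w) ≡ sum (λ c → load s c w))
    equalise step s = go (ℕ.suc ∣ energy s ∣) s ℕₚ.≤-refl
      where
      go : ∀ fuel s → ∣ energy s ∣ ℕ.< fuel → ∃ λ s′ →
        Equitable s′ × (∀ w → sum (λ c → load s′ c w) ≡ sum (λ c → load s c w))
      go (suc fuel) s (ℕ.s≤s le)
        with Fin.any? (λ i → Fin.any? λ j → Fin.any? λ w → 1 ℕₚ.<? ∣ load s i w - load s j w ∣)
      ... | no  balanced = s , (λ i j w → ℕₚ.≮⇒≥ λ lt → balanced (i , j , w , lt)) , λ w → refl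
      ... | yes (i , j , w , lt) with step s i j (distinct s lt)
      ... | s₁ , reb with go fuel s₁ (ℕₚ.<-≤-trans (∣-∣-mono-< (0≤energy s₁) (energy-< (distinct s lt) reb w (ℕₚ.<⇒≱ lt))) le)
      ... | s₂ , equitable , same = s₂ , equitable , λ w → trans (same w) (totals (distinct s lt) reb w)

  module V {n : ℕ} = Incidence (Fin._≟_ {n})

  module _ {n m : ℕ} (tail head : Fin m → Fin n) where

    degreeIn : (Fin m → Fin n) → (Fin m → Bool) → Fin n → ℤ
    degreeIn end S v = sum λ e → if S e then V.δ (end e) v else 0ℤ

    private
      module VV = Incidence (Sum.≡-dec (Fin._≟_ {n}) (Fin._≟_ {n}))

      colourClass : ∀ {k} → (Fin m → Fin k) → Fin k → Fin m → Bool
      colourClass χ i e = does (χ e Fin.≟ i)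

      sideLoad : ∀ {k} → (Fin m → Fin k) → Fin k → Fin n ⊎ Fin n → ℤ
      sideLoad χ i (inj₁ v) = degreeIn tail (colourClass χ i) v
      sideLoad χ i (inj₂ v) = degreeIn head (colourClass χ i) v

      load : ∀ {k} → (Fin m → Fin k) → Fin k → Fin (n ℕ.+ n) → ℤ
      load χ i w = sideLoad χ i (splitAt n w)

      module Recolour {k} (χ : Fin m → Fin k) (i j : Fin k) (i≢j : i ≢ j) where

        active : Fin m → Bool
        active e = does (χ e Fin.≟ i) ∨ does (χ e Fin.≟ j)

        -- Edges of other colours become loops: they remain in the index set `Fin m` but contribute
        -- nothing to any net.
        edge : Fin m → (Fin n ⊎ Fin n) × (Fin n ⊎ Fin n)
        edge e = inj₁ (tail e) , (if active e then inj₂ (head e) else inj₁ (tail e))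

        σ : Fin m → Bool
        σ = proj₁ (VV.balanced-orientation edge)

        -- Colour `i` goes to the edges directed from out-side to in-side. All edges at one side
        -- then have the same sign, so the difference of the two colours there is the net up to
        -- sign.
        χ′ : Fin m → Fin k
        χ′ e = if active e then (if σ e then i else j) else χ e

        does-diag : ∀ (l : Fin k) → does (l Fin.≟ l) ≡ true
        does-diag l = dec-true (l Fin.≟ l) refl

        does-ij : does (i Fin.≟ j) ≡ false
        does-ij = dec-false (i Fin.≟ j) i≢j

        does-ji : does (j Fin.≟ i) ≡ false
        does-ji = dec-false (j Fin.≟ i) (i≢j ∘ sym)

        pair : ∀ (x : ℤ) e →
          (if does (χ′ e Fin.≟ i) then x else 0ℤ) + (if does (χ′ e Fin.≟ j) then x else 0ℤ) ≡
          (if does (χ e Fin.≟ i) then x else 0ℤ) + (if does (χ e Fin.≟ j) then x else 0ℤ)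
        pair x e with χ e Fin.≟ i | χ e Fin.≟ j | σ e
        ... | yes p | yes q | _ = ⊥-elim (i≢j (trans (sym p) q))
        ... | yes _ | no _ | true  rewrite does-diag i | does-ij = refl
        ... | yes _ | no _ | false rewrite does-ji | does-diag j = +-comm 0ℤ x
        ... | no _ | yes _ | true  rewrite does-diag i | does-ij = +-comm x 0ℤ
        ... | no _ | yes _ | false rewrite does-ji | does-diag j = refl
        ... | no p | no q | _ rewrite dec-false (χ e Fin.≟ i) p | dec-false (χ e Fin.≟ j) q = refl

        others : ∀ c → c ≢ i → c ≢ j → ∀ e → colourClass χ′ c e ≡ colourClass χ c e
        others c c≢i c≢j e with χ e Fin.≟ i | χ e Fin.≟ j | σ e
        ... | yes refl | _ | true  = refl
        ... | yes refl | _ | false =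
          trans (dec-false (j Fin.≟ c) (c≢j ∘ sym)) (sym (dec-false (i Fin.≟ c) (c≢i ∘ sym)))
        ... | no _ | yes refl | true =
          trans (dec-false (i Fin.≟ c) (c≢i ∘ sym)) (sym (dec-false (j Fin.≟ c) (c≢j ∘ sym)))
        ... | no _ | yes refl | false = refl
        ... | no _ | no _ | _ = refl

        difference : ∀ (x : ℤ) e →
          (if does (χ′ e Fin.≟ i) then x else 0ℤ) - (if does (χ′ e Fin.≟ j) then x else 0ℤ) ≡
          (if active e then sgn (σ e) x else 0ℤ)
        difference x e with χ e Fin.≟ i | χ e Fin.≟ j | σ e
        ... | yes p | yes q | _ = ⊥-elim (i≢j (trans (sym p) q))
        ... | yes _ | no _ | true  rewrite does-diag i | does-ij = +-identityʳ x
        ... | yes _ | no _ | false rewrite does-ji | does-diag j = +-identityˡ (- x)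
        ... | no _ | yes _ | true  rewrite does-diag i | does-ij = +-identityʳ x
        ... | no _ | yes _ | false rewrite does-ji | does-diag j = +-identityˡ (- x)
        ... | no p | no q | _ rewrite dec-false (χ e Fin.≟ i) p | dec-false (χ e Fin.≟ j) q = refl

        tail-boundary : ∀ b e v → (if active e then sgn b (V.δ (tail e) v) else 0ℤ) ≡
                                  sgn b (VV.boundary (edge e) (inj₁ v))
        tail-boundary b e v with active e
        ... | true  = cong (sgn b) (sym (+-identityʳ (V.δ (tail e) v)))
        ... | false = sym (VV.boundary-loop b (inj₁ (tail e)) (inj₁ v))

        negate : ∀ x → x ≡ - (0ℤ - x)
        negate = solve-∀

        head-boundary : ∀ b e v → (if active e then sgn b (V.δ (head e) v) else 0ℤ) ≡
                                  - sgn b (VV.boundary (edge e) (inj₂ v))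
        head-boundary b e v with active e
        ... | false = sym (cong -_ (VV.boundary-loop b (inj₁ (tail e)) (inj₂ v)))
        ... | true with b
        ...   | true  = negate (V.δ (head e) v)
        ...   | false = cong -_ (negate (V.δ (head e) v))

        term : ∀ (end : Fin m → Fin n) (c : Fin k) (χ : Fin m → Fin k) e v → ℤ
        term end c χ e v = if does (χ e Fin.≟ c) then V.δ (end e) v else 0ℤ

        pair-load : ∀ (end : Fin m → Fin n) v →
          degreeIn end (colourClass χ′ i) v + degreeIn end (colourClass χ′ j) v ≡
          degreeIn end (colourClass χ i) v + degreeIn end (colourClass χ j) v
        pair-load end v =
          trans (sym (∑-distrib-+ (λ e → term end i χ′ e v) (λ e → term end j χ′ e v)))
          (trans (sum-cong-≗ λ e → pair (V.δ (end e) v) e)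
                 (∑-distrib-+ (λ e → term end i χ e v) (λ e → term end j χ e v)))

        balance : Fin n ⊎ Fin n → ℤ
        balance = VV.net edge σ

        tail-load : ∀ v → degreeIn tail (colourClass χ′ i) v - degreeIn tail (colourClass χ′ j) v ≡
                          balance (inj₁ v)
        tail-load v = trans (sym (sum-- (λ e → term tail i χ′ e v) (λ e → term tail j χ′ e v)))
          (sum-cong-≗ λ e → trans (difference (V.δ (tail e) v) e) (tail-boundary (σ e) e v))

        head-load : ∀ v → degreeIn head (colourClass χ′ i) v - degreeIn head (colourClass χ′ j) v ≡
                          - balance (inj₂ v)
        head-load v = trans (sym (sum-- (λ e → term head i χ′ e v) (λ e → term head j χ′ e v)))
          (trans (sum-cong-≗ λ e → trans (difference (V.δ (head e) v) e) (head-boundary (σ e) e v))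
                 (sum-neg (λ e → sgn (σ e) (VV.boundary (edge e) (inj₂ v)))))

        bounded : ∀ w → ∣ balance w ∣ ℕ.≤ 1
        bounded = proj₂ (VV.balanced-orientation edge)

        rebalanced : Rebalanced load χ i j χ′
        rebalanced = (λ w → pair-side (splitAt n w)) , (λ w → bound-side (splitAt n w)) ,
                     (λ c c≢i c≢j w → other-side c c≢i c≢j (splitAt n w))
          where
          pair-side : ∀ w → sideLoad χ′ i w + sideLoad χ′ j w ≡ sideLoad χ i w + sideLoad χ j w
          pair-side (inj₁ v) = pair-load tail v
          pair-side (inj₂ v) = pair-load head v
          bound-side : ∀ w → ∣ sideLoad χ′ i w - sideLoad χ′ j w ∣ ℕ.≤ 1
          bound-side (inj₁ v) = subst (λ x → ∣ x ∣ ℕ.≤ 1) (sym (tail-load v)) (bounded (inj₁ v))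
          bound-side (inj₂ v) = subst (λ x → ∣ x ∣ ℕ.≤ 1) (sym (head-load v))
            (subst (ℕ._≤ 1) (sym (∣-i∣≡∣i∣ (balance (inj₂ v)))) (bounded (inj₂ v)))
          other-side : ∀ c → c ≢ i → c ≢ j → ∀ w → sideLoad χ′ c w ≡ sideLoad χ c w
          other-side c c≢i c≢j (inj₁ v) =
            sum-cong-≗ λ e → cong (λ b → if b then V.δ (tail e) v else 0ℤ) (others c c≢i c≢j e)
          other-side c c≢i c≢j (inj₂ v) =
            sum-cong-≗ λ e → cong (λ b → if b then V.δ (head e) v else 0ℤ) (others c c≢i c≢j e)

    equitable-colouring : ∀ k → ∃ λ (χ : Fin m → Fin (suc k)) → ∀ i j v →
      ∣ degreeIn tail (λ e → does (χ e Fin.≟ i)) v - degreeIn tail (λ e → does (χ e Fin.≟ j)) v ∣ ℕ.≤ 1 ×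
      ∣ degreeIn head (λ e → does (χ e Fin.≟ i)) v - degreeIn head (λ e → does (χ e Fin.≟ j)) v ∣ ℕ.≤ 1
    equitable-colouring k
      with equalise load (λ χ i j i≢j → Recolour.χ′ χ i j i≢j , Recolour.rebalanced χ i j i≢j) (λ _ → zero)
    ... | χ , equitable , _ = χ , λ i j v →
      subst (λ w → ∣ sideLoad χ i w - sideLoad χ j w ∣ ℕ.≤ 1) (Fin.splitAt-↑ˡ n v n) (equitable i j (v ↑ˡ n)) ,
      subst (λ w → ∣ sideLoad χ i w - sideLoad χ j w ∣ ℕ.≤ 1) (Fin.splitAt-↑ʳ n n v) (equitable i j (n ↑ʳ v))

    outdegree : (Fin m → Bool) → Fin n → ℤ
    outdegree o v = sum λ e → if o e then V.δ (tail e) v else V.δ (head e) v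

    module Reorient {K} (o : Fin K → Fin m → Bool) (i j : Fin K) (i≢j : i ≢ j) where

      -- Only edges on which the orientations `i` and `j` disagree can be exchanged, and the others
      -- become loops. On a disagreeing edge `o′` lets `i` follow `σ` and `j` its reverse, so the
      -- pair still uses each direction once.
      edge : Fin m → Fin n × Fin n
      edge e = tail e , (if o i e xor o j e then head e else tail e)

      σ : Fin m → Bool
      σ = proj₁ (V.balanced-orientation edge)

      o′ : Fin K → Fin m → Bool
      o′ c e = if o i e xor o j e
               then (if does (c Fin.≟ i) then σ e else if does (c Fin.≟ j) then not (σ e) else o c e)
               else o c e

      i=i : does (i Fin.≟ i) ≡ true
      i=i = dec-true (i Fin.≟ i) refl

      j=j : does (j Fin.≟ j) ≡ true
      j=j = dec-true (j Fin.≟ j) refl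

      j≠i : does (j Fin.≟ i) ≡ false
      j≠i = dec-false (j Fin.≟ i) (i≢j ∘ sym)

      pair : ∀ (x y : ℤ) e → (if o′ i e then x else y) + (if o′ j e then x else y) ≡
                             (if o i e then x else y) + (if o j e then x else y)
      pair x y e rewrite i=i | j=j | j≠i with o i e | o j e | σ e
      ... | true  | false | true  = refl
      ... | true  | false | false = +-comm y x
      ... | false | true  | true  = +-comm x y
      ... | false | true  | false = refl
      ... | true  | true  | _     = refl
      ... | false | false | _     = refl

      difference : ∀ e v → (if o′ i e then V.δ (tail e) v else V.δ (head e) v) -
                           (if o′ j e then V.δ (tail e) v else V.δ (head e) v) ≡
                           sgn (σ e) (V.boundary (edge e) v)
      difference e v rewrite i=i | j=j | j≠i with o i e | o j e | σ e
      ... | true  | false | true  = refl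
      ... | true  | false | false = flip (V.δ (tail e) v) (V.δ (head e) v)
        where
        flip : ∀ a b → b - a ≡ - (a - b)
        flip = solve-∀
      ... | false | true  | true  = refl
      ... | false | true  | false = flip (V.δ (tail e) v) (V.δ (head e) v)
        where
        flip : ∀ a b → b - a ≡ - (a - b)
        flip = solve-∀
      ... | true  | true  | b = trans (+-inverseʳ (V.δ (tail e) v)) (sym (V.boundary-loop b (tail e) v))
      ... | false | false | b = trans (+-inverseʳ (V.δ (head e) v)) (sym (V.boundary-loop b (tail e) v))

      others : ∀ c → c ≢ i → c ≢ j → ∀ e → o′ c e ≡ o c e
      others c c≢i c≢j e rewrite dec-false (c Fin.≟ i) c≢i | dec-false (c Fin.≟ j) c≢j with o i e xor o j e
      ... | true  = refl
      ... | false = refl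

      term : (Fin m → Bool) → Fin n → Fin m → ℤ
      term o v e = if o e then V.δ (tail e) v else V.δ (head e) v

      rebalanced : ∀ {a} (at : Fin a → Fin n) →
        Rebalanced (λ o c v → outdegree (o c) (at v)) o i j o′
      rebalanced at =
        (λ v → trans (sym (∑-distrib-+ (term (o′ i) (at v)) (term (o′ j) (at v))))
               (trans (sum-cong-≗ λ e → pair (V.δ (tail e) (at v)) (V.δ (head e) (at v)) e)
                      (∑-distrib-+ (term (o i) (at v)) (term (o j) (at v))))) ,
        (λ v → subst (λ x → ∣ x ∣ ℕ.≤ 1)
                 (trans (sym (sum-cong-≗ λ e → difference e (at v)))
                        (sum-- (term (o′ i) (at v)) (term (o′ j) (at v))))
                 (proj₂ (V.balanced-orientation edge) (at v))) ,
        (λ c c≢i c≢j v → sum-cong-≗ λ e →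
          cong (λ b → if b then V.δ (tail e) (at v) else V.δ (head e) (at v)) (others c c≢i c≢j e))

  -- Integers that pairwise differ by at most 1 cannot have both signs, so nothing cancels in the
  -- sum.
  ∑∣x∣≤∣∑x∣ : ∀ {n} (x : Fin n → ℤ) → (∀ i j → ∣ x i - x j ∣ ℕ.≤ 1) →
              sum (λ i → + ∣ x i ∣) ≤ + ∣ sum x ∣
  ∑∣x∣≤∣∑x∣ x close with Fin.all? (λ i → 0ℤ ≤? x i)
  ... | yes 0≤x = ≤-trans (≤-reflexive (sum-cong-≗ λ i → 0≤i⇒+∣i∣≡i (0≤x i))) (i≤+∣i∣ (sum x))
    where
    i≤+∣i∣ : ∀ i → i ≤ + ∣ i ∣
    i≤+∣i∣ (+ n)    = ≤-refl
    i≤+∣i∣ -[1+ n ] = -≤+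
  ... | no ¬0≤x with Fin.¬∀⟶∃¬ _ (λ i → 0ℤ ≤ x i) (λ i → 0ℤ ≤? x i) ¬0≤x
  ... | i₀ , ¬0≤x₀ = ≤-trans
          (≤-reflexive (trans (sum-cong-≗ λ i → trans (cong +_ (sym (∣-i∣≡∣i∣ (x i))))
                                                      (0≤i⇒+∣i∣≡i (neg-mono-≤ (x≤0 i))))
                              (sum-neg x)))
          (-i≤+∣i∣ (sum x))
    where
    -i≤+∣i∣ : ∀ i → - i ≤ + ∣ i ∣
    -i≤+∣i∣ (+ zero)    = ≤-refl
    -i≤+∣i∣ (+ suc n) = -≤+
    -i≤+∣i∣ -[1+ n ] = ≤-refl
    x₀+1≤0 : x i₀ + 1ℤ ≤ 0ℤ
    x₀+1≤0 = subst (_≤ 0ℤ) (+-comm 1ℤ (x i₀)) (i<j⇒suc[i]≤j (≰⇒> ¬0≤x₀))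
    regroup : ∀ a b → a ≡ a - b + b
    regroup = solve-∀
    x≤0 : ∀ i → x i ≤ 0ℤ
    x≤0 i = ≤-trans (subst₂ _≤_ (sym (regroup (x i) (x i₀))) (+-comm 1ℤ (x i₀))
                      (+-monoˡ-≤ (x i₀) (∣i-j∣≤1⇒i-j≤1 (x i) (x i₀) (close i i₀))))
                    x₀+1≤0

  -- Counts the starting family for the rounding: orientation s lets an edge leave its tail exactly
  -- when s is below the numerator of its share.
  sum-threshold : ∀ S X (a b : ℤ) → X ℕ.≤ S →
    sum {S} (λ s → if toℕ s ℕ.<ᵇ X then a else b) ≡ + X * a + (+ S - + X) * b
  sum-threshold S zero a b le = trans (sum-const S b) (lem (+ S) a b)
    where
    lem : ∀ S a b → S * b ≡ 0ℤ * a + (S - 0ℤ) * b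
    lem = solve-∀
  sum-threshold (suc S) (suc X) a b (ℕ.s≤s le) =
    trans (cong (_+_ a) (sum-threshold S X a b le)) (lem (+ S) (+ X) a b)
    where
    lem : ∀ S X a b → a + (X * a + (S - X) * b) ≡ (1ℤ + X) * a + ((1ℤ + S) - (1ℤ + X)) * b
    lem = solve-∀

  module _ {n m : ℕ} (tail head : Fin m → Fin n) where

    fractionalOutdegree : ℕ → (Fin m → ℕ) → Fin n → ℤ
    fractionalOutdegree S X v = sum λ e → + X e * V.δ (tail e) v + (+ S - + X e) * V.δ (head e) v

    -- X e / S is the share of e leaving its tail. S orientations with these shares are
    -- equalised; then the deviations from p at a vertex all have the same sign, and the
    -- hypothesis leaves no room for all S orientations to deviate.
    round-orientation : ∀ {a} (at : Fin a → Fin n) (S : ℕ) (X : Fin m → ℕ) → (∀ e → X e ℕ.≤ S) →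
      (p : Fin a → ℤ) →
      sum (λ v → + ∣ fractionalOutdegree S X (at v) - + S * p v ∣) < + S →
      ∃ λ o → ∀ v → outdegree tail head o (at v) ≡ p v
    round-orientation {a} at S X X≤S p small
      with equalise (λ o c v → outdegree tail head (o c) (at v))
             (λ o i j i≢j → Reorient.o′ tail head o i j i≢j , Reorient.rebalanced tail head o i j i≢j at)
             (λ s e → toℕ s ℕ.<ᵇ X e)
    ... | o , equitable , total = finish (Fin.any? λ s → deviation s ≟ 0ℤ)
      where
      x : Fin S → Fin a → ℤ
      x s v = outdegree tail head (o s) (at v) - p v

      deviation : Fin S → ℤ
      deviation s = sum λ v → + ∣ x s v ∣

      column : ∀ v → sum (λ s → x s v) ≡ fractionalOutdegree S X (at v) - + S * p v
      column v = trans (sum-- (λ s → outdegree tail head (o s) (at v)) (λ _ → p v))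
        (cong₂ _-_ (trans (total v) (trans (∑-comm {S} {m} (λ s e → if toℕ s ℕ.<ᵇ X e then V.δ (tail e) (at v) else V.δ (head e) (at v)))
                     (sum-cong-≗ λ e → sum-threshold S (X e) _ _ (X≤S e))))
                   (sum-const S (p v)))

      close : ∀ v i j → ∣ x i v - x j v ∣ ℕ.≤ 1
      close v i j = subst (λ y → ∣ y ∣ ℕ.≤ 1)
        (lem (outdegree tail head (o i) (at v)) (outdegree tail head (o j) (at v)) (p v)) (equitable i j v)
        where
        lem : ∀ a b c → a - b ≡ a - c - (b - c)
        lem = solve-∀

      total-deviation : sum deviation < + S
      total-deviation = ≤-<-trans
        (subst (_≤ sum (λ v → + ∣ sum (λ s → x s v) ∣)) (sym (∑-comm (λ s v → + ∣ x s v ∣)))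
          (sum-mono (λ v → sum λ s → + ∣ x s v ∣) (λ v → + ∣ sum (λ s → x s v) ∣) λ v → ∑∣x∣≤∣∑x∣ (λ s → x s v) (close v)))
        (subst (_< + S) (sym (sum-cong-≗ λ v → cong (λ y → + ∣ y ∣) (column v))) small)

      0≤deviation : ∀ s → 0ℤ ≤ deviation s
      0≤deviation s = subst (_≤ deviation s) (sum-zero {a} (λ _ → 0ℤ) λ _ → refl)
        (sum-mono (λ _ → 0ℤ) (λ v → + ∣ x s v ∣) λ v → +≤+ ℕ.z≤n)

      vanish : ∀ {b} (y : Fin b → ℤ) → sum (λ v → + ∣ y v ∣) ≡ 0ℤ → ∀ v → y v ≡ 0ℤ
      vanish {b} y sum≡0 v with + ∣ y v ∣ ≤? 0ℤ
      ... | yes le = ∣i∣≡0⇒i≡0 (ℕₚ.n≤0⇒n≡0 (drop‿+≤+ le))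
      ... | no ¬le = ⊥-elim (<-irrefl (sym sum≡0)
        (subst (_< sum (λ v → + ∣ y v ∣)) (sum-zero {b} (λ _ → 0ℤ) λ _ → refl)
          (sum-mono-< (λ _ → 0ℤ) (λ v → + ∣ y v ∣) (λ v → +≤+ ℕ.z≤n) v (≰⇒> ¬le))))

      finish : Dec (∃ λ s → deviation s ≡ 0ℤ) → ∃ λ o → ∀ v → outdegree tail head o (at v) ≡ p v
      finish (yes (s , eq)) = o s , λ v → i-j≡0⇒i≡j _ (p v) (vanish (x s) eq v)
      finish (no none) = ⊥-elim (<⇒≱ total-deviation
        (subst (_≤ sum deviation) (trans (sum-const S 1ℤ) (*-identityʳ (+ S)))
          (sum-mono (λ _ → 1ℤ) deviation λ s →
            i<j⇒suc[i]≤j (≤∧≢⇒< (0≤deviation s) λ eq → none (s , sym eq)))))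

-- Partitions, Kruskal's algorithm, and the weight of a maximum spanning tree.

module Forests where
  open import Data.Nat.Base using (_+_; _*_; _∸_; _≤_; _<_; z≤n; s≤s; s≤s⁻¹)
  open import Data.Nat.Properties
  open import Data.Nat.Tactic.RingSolver using (solve-∀)
  open import Algebra.Properties.CommutativeMonoid.Sum +-0-commutativeMonoid
    using (sum; sum-cong-≗; sum-remove)

  merge : ∀ {n} → (Fin n → Fin n) → Fin n → Fin n → Fin n → Fin n
  merge π u w v = if does (π v Fin.≟ π u) then π w else π v

  merge-coarser : ∀ {n} (π : Fin n → Fin n) u w {v v′} → π v ≡ π v′ → merge π u w v ≡ merge π u w v′
  merge-coarser π u w eq rewrite eq = refl

  merge-joins : ∀ {n} (π : Fin n → Fin n) u w → merge π u w u ≡ merge π u w w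
  merge-joins π u w with π u Fin.≟ π u | π w Fin.≟ π u
  ... | yes _   | yes _ = refl
  ... | yes _   | no _  = refl
  ... | no πu≢  | _     = ⊥-elim (πu≢ refl)

  kruskal : ∀ {n m} → (Fin m → Fin n × Fin n) → (Fin n → Fin n) → List (Fin m) → List (Fin m)
  kruskal ends π []       = []
  kruskal ends π (e ∷ es) with π (proj₁ (ends e)) Fin.≟ π (proj₂ (ends e))
  ... | yes _ = kruskal ends π es
  ... | no  _ = e ∷ kruskal ends (merge π (proj₁ (ends e)) (proj₂ (ends e))) es

  sum-changeℕ : ∀ {n} (f g : Fin n → ℕ) i → (∀ j → j ≢ i → f j ≡ g j) →
                sum f + g i ≡ sum g + f i
  sum-changeℕ {suc n} f g i eq = trans (cong (_+ g i) (sum-remove {i = i} f))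
    (trans (cong (λ s → f i + s + g i) (sum-cong-≗ λ j → eq (punchIn i j) (Fin.punchInᵢ≢i i j)))
    (trans (lem (f i) (g i) _) (cong (_+ f i) (sym (sum-remove {i = i} g)))))
    where
    lem : ∀ a b c → a + c + b ≡ b + c + a
    lem = solve-∀

  unit : Bool → ℕ
  unit b = if b then 1 else 0

  module _ {n : ℕ} where

    -- Encodes a partition: `π` sends each vertex to the representative of its block, so blocks can
    -- be counted as fixed points.
    Idempotent : (Fin n → Fin n) → Set
    Idempotent π = ∀ v → π (π v) ≡ π v

    blocks : (Fin n → Fin n) → ℕ
    blocks π = sum λ v → unit (does (π v Fin.≟ v))

    blocks≤n : ∀ π → blocks π ≤ n
    blocks≤n π = go (λ v → does (π v Fin.≟ v))
      where
      go : ∀ {n} (f : Fin n → Bool) → sum (unit ∘ f) ≤ n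
      go {zero}  f = z≤n
      go {suc n} f with f zero
      ... | true  = s≤s (go (f ∘ suc))
      ... | false = m≤n⇒m≤1+n (go (f ∘ suc))

    1≤blocks : ∀ π → Idempotent π → Fin n → 1 ≤ blocks π
    1≤blocks π idem v = go (λ v → does (π v Fin.≟ v)) (π v) (dec-true (π (π v) Fin.≟ π v) (idem v))
      where
      go : ∀ {n} (f : Fin n → Bool) i → f i ≡ true → 1 ≤ sum (unit ∘ f)
      go f zero    eq rewrite eq = s≤s z≤n
      go f (suc i) eq = ≤-trans (go (f ∘ suc) i eq) (m≤n+m _ (unit (f zero)))

    merge-idempotent : ∀ π u w → Idempotent π → π u ≢ π w → Idempotent (merge π u w)
    merge-idempotent π u w idem u≢w v with π v Fin.≟ π u
    ... | yes _  rewrite idem w | dec-false (π w Fin.≟ π u) (u≢w ∘ sym) = refl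
    ... | no v≢u rewrite idem v | dec-false (π v Fin.≟ π u) v≢u = refl

    merge-blocks : ∀ π u w → Idempotent π → π u ≢ π w → suc (blocks (merge π u w)) ≡ blocks π
    merge-blocks π u w idem u≢w = begin
      suc (blocks π′)                            ≡⟨ +-comm 1 (blocks π′) ⟩
      blocks π′ + 1                              ≡⟨ cong (λ b → blocks π′ + unit b) (dec-true (π (π u) Fin.≟ π u) (idem u)) ⟨
      blocks π′ + unit (does (π (π u) Fin.≟ π u)) ≡⟨ sum-changeℕ _ _ (π u) others ⟩
      blocks π + unit (does (π′ (π u) Fin.≟ π u)) ≡⟨ cong (λ b → blocks π + unit b) gone ⟩
      blocks π + 0                               ≡⟨ +-identityʳ _ ⟩
      blocks π ∎
      where
      open ≡-Reasoning
      π′ = merge π u w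
      gone : does (π′ (π u) Fin.≟ π u) ≡ false
      gone rewrite idem u | dec-true (π u Fin.≟ π u) refl = dec-false (π w Fin.≟ π u) (u≢w ∘ sym)
      others : ∀ v → v ≢ π u → unit (does (π′ v Fin.≟ v)) ≡ unit (does (π v Fin.≟ v))
      others v v≢ with π v Fin.≟ π u
      ... | no _ = refl
      ... | yes πv≡πu = cong unit (trans
        (dec-false (π w Fin.≟ v) λ πw≡v → v≢ (trans (sym πw≡v) (trans (sym (idem w)) (trans (cong π πw≡v) πv≡πu))))
        (sym (dec-false (π v Fin.≟ v) λ πv≡v → v≢ (trans (sym πv≡v) πv≡πu))))

  module _ {n m : ℕ} (ends : Fin m → Fin n × Fin n) where

    crosses : (Fin n → Fin n) → Fin m → ℕ
    crosses π e = if does (π (proj₁ (ends e)) Fin.≟ π (proj₂ (ends e))) then 0 else 1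

    crossing : (Fin n → Fin n) → ℕ
    crossing π = sumˡ (map (crosses π) (allFin m))

    -- With q = `suc (suc p)` blocks the bound is k (q - 1) + 1. Its surplus 1 turns into the ratio
    -- (k d + 1) / d in place of k for edges against tree edges.
    Dense : ℕ → Set
    Dense k = ∀ π → Idempotent π → ∀ p → blocks π ≡ suc (suc p) → k * suc p + 1 ≤ crossing π

    private
      -- Invariant of the greedy run with `es` still to be treated: edges already treated lie inside
      -- blocks of `π`, so every edge that crosses a coarser partition is still in `es`.
      Covers : List (Fin m) → (Fin n → Fin n) → Set
      Covers es π = ∀ π′ → (∀ v w → π v ≡ π w → π′ v ≡ π′ w) → crossing π′ ≤ sumˡ (map (crosses π′) es)

      crossing≤length : ∀ π es → sumˡ (map (crosses π) es) ≤ length es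
      crossing≤length π []       = z≤n
      crossing≤length π (e ∷ es) with does (π (proj₁ (ends e)) Fin.≟ π (proj₂ (ends e)))
      ... | true  = m≤n⇒m≤1+n (crossing≤length π es)
      ... | false = s≤s (crossing≤length π es)

      covers-step : ∀ e es {π π′} → (∀ v w → π v ≡ π w → π′ v ≡ π′ w) →
        π′ (proj₁ (ends e)) ≡ π′ (proj₂ (ends e)) → Covers (e ∷ es) π → Covers es π′
      covers-step e es coarser joined cov π″ coarser′ = ≤-trans
        (cov π″ λ v w eq → coarser′ v w (coarser v w eq))
        (≤-reflexive (cong (λ b → (if b then 0 else 1) + sumˡ (map (crosses π″) es)) (dec-true (π″ _ Fin.≟ π″ _) (coarser′ _ _ joined))))

    module _ {k : ℕ} (dense : Dense k) (z : Fin n) where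
      private
        single : ∀ π → Idempotent π → crossing π ≤ 0 → 1 ≡ blocks π
        single π idem none with blocks π in eq | 1≤blocks π idem z
        ... | suc zero    | _ = refl
        ... | suc (suc p) | _ = ⊥-elim (<⇒≱ (m≤n+m 1 (k * suc p)) (≤-trans (dense π idem p eq) none))

      -- Each chosen edge merges two blocks. At the end of the list `Covers` says that no edge
      -- crosses the partition, and density then leaves a single block.
      kruskal-length : ∀ es π → Idempotent π → Covers es π → suc (length (kruskal ends π es)) ≡ blocks π
      kruskal-length []       π idem cov = single π idem (cov π λ _ _ eq → eq)
      kruskal-length (e ∷ es) π idem cov with π (proj₁ (ends e)) Fin.≟ π (proj₂ (ends e))
      ... | yes joined = kruskal-length es π idem (covers-step e es (λ _ _ eq → eq) joined cov)
      ... | no  split  = trans (cong suc (kruskal-length es _ (merge-idempotent π _ _ idem split)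
                                 (covers-step e es (λ _ _ → merge-coarser π _ _) (merge-joins π _ _) cov)))
                               (merge-blocks π _ _ idem split)

      private
        -- If K ≥ 1 edges will still be chosen, the current partition has K + 1 blocks, so at least
        -- k K + 1 edges remain. Since K ≤ d, multiplying by d gives at least (k d + 1) K.
        density : ∀ {d} → n ≡ suc d → ∀ es π → Idempotent π → Covers es π →
                  (k * d + 1) * length (kruskal ends π es) ≤ d * length es
        density {d} refl es π idem cov with length (kruskal ends π es) | kruskal-length es π idem cov
        ... | zero  | _  = ≤-trans (≤-reflexive (*-zeroʳ (k * d + 1))) z≤n
        ... | suc p | eq = begin
          (k * d + 1) * suc p     ≡⟨ lem k d (suc p) ⟩
          d * (k * suc p) + suc p ≤⟨ +-monoʳ-≤ (d * (k * suc p)) (s≤s⁻¹ (≤-trans (≤-reflexive eq) (blocks≤n π))) ⟩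
          d * (k * suc p) + d     ≡⟨ lem′ d (k * suc p) ⟩
          d * (k * suc p + 1)     ≤⟨ *-monoʳ-≤ d (≤-trans (dense π idem p (sym eq))
                                       (≤-trans (cov π λ _ _ e → e) (crossing≤length π es))) ⟩
          d * length es ∎
          where
          open ≤-Reasoning
          lem : ∀ k d p → (k * d + 1) * p ≡ d * (k * p) + p
          lem = solve-∀
          lem′ : ∀ d x → d * x + d ≡ d * (x + 1)
          lem′ = solve-∀

        weight : (Fin m → ℕ) → List (Fin m) → ℕ
        weight h es = sumˡ (map h es)

      -- Abel summation: every suffix es of the sorted edge list satisfies
      -- (k d + 1) |kruskal es| ≤ d |es|.
      kruskal-weight : ∀ {d} → n ≡ suc d → ∀ h es π →
        AllPairs (λ e e′ → h e′ ≤ h e) es → Idempotent π → Covers es π → ∀ α → All (λ e → h e ≤ α) es →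
        (k * d + 1) * (length (kruskal ends π es) * α) + d * sumˡ (map h es) ≤
        (k * d + 1) * sumˡ (map h (kruskal ends π es)) + d * (length es * α)
      kruskal-weight {d} n≡ h [] π _ idem cov α [] = ≤-refl
      kruskal-weight {d} n≡ h (e ∷ es) π (below ∷ sorted) idem cov α (β≤α ∷ _)
        with density n≡ (e ∷ es) π idem cov
      ... | dens with π (proj₁ (ends e)) Fin.≟ π (proj₂ (ends e))
      ...   | yes joined = begin
        b * (K * α) + d * (β + S)               ≡⟨ cong (λ α → b * (K * α) + d * (β + S)) (m+[n∸m]≡n β≤α) ⟨
        b * (K * (β + γ)) + d * (β + S)         ≡⟨ lem₁ b K β γ d S ⟩
        (b * (K * β) + d * S) + (b * K * γ + d * β)
          ≤⟨ +-mono-≤ (kruskal-weight n≡ h es π sorted idem (covers-step e es (λ _ _ eq → eq) joined cov) β below)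
                      (+-monoˡ-≤ (d * β) (*-monoˡ-≤ γ dens)) ⟩
        (b * T + d * (L * β)) + (d * suc L * γ + d * β) ≡⟨ lem₂ b T d L β γ ⟩
        b * T + d * (suc L * (β + γ))            ≡⟨ cong (λ α → b * T + d * (suc L * α)) (m+[n∸m]≡n β≤α) ⟩
        b * T + d * (suc L * α) ∎
        where
        open ≤-Reasoning
        b = k * d + 1
        β = h e
        γ = α ∸ β
        K = length (kruskal ends π es)
        S = weight h es
        T = weight h (kruskal ends π es)
        L = length es
        lem₁ : ∀ b K β γ d S → b * (K * (β + γ)) + d * (β + S) ≡ (b * (K * β) + d * S) + (b * K * γ + d * β)
        lem₁ = solve-∀
        lem₂ : ∀ b T d L β γ → (b * T + d * (L * β)) + (d * suc L * γ + d * β) ≡ b * T + d * (suc L * (β + γ))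
        lem₂ = solve-∀
      ...   | no split = begin
        b * (suc K * α) + d * (β + S)           ≡⟨ cong (λ α → b * (suc K * α) + d * (β + S)) (m+[n∸m]≡n β≤α) ⟨
        b * (suc K * (β + γ)) + d * (β + S)     ≡⟨ lem₁ b K β γ d S ⟩
        (b * (K * β) + d * S) + (b * suc K * γ + (d * β + b * β))
          ≤⟨ +-mono-≤ (kruskal-weight n≡ h es _ sorted (merge-idempotent π _ _ idem split)
                        (covers-step e es (λ _ _ → merge-coarser π _ _) (merge-joins π _ _) cov) β below)
                      (+-monoˡ-≤ (d * β + b * β) (*-monoˡ-≤ γ dens)) ⟩
        (b * T + d * (L * β)) + (d * suc L * γ + (d * β + b * β)) ≡⟨ lem₂ b T d L β γ ⟩
        b * (β + T) + d * (suc L * (β + γ))      ≡⟨ cong (λ α → b * (β + T) + d * (suc L * α)) (m+[n∸m]≡n β≤α) ⟩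
        b * (β + T) + d * (suc L * α) ∎
        where
        open ≤-Reasoning
        π′ = merge π (proj₁ (ends e)) (proj₂ (ends e))
        b = k * d + 1
        β = h e
        γ = α ∸ β
        K = length (kruskal ends π′ es)
        S = weight h es
        T = weight h (kruskal ends π′ es)
        L = length es
        lem₁ : ∀ b K β γ d S → b * (suc K * (β + γ)) + d * (β + S) ≡ (b * (K * β) + d * S) + (b * suc K * γ + (d * β + b * β))
        lem₁ = solve-∀
        lem₂ : ∀ b T d L β γ → (b * T + d * (L * β)) + (d * suc L * γ + (d * β + b * β)) ≡ b * (β + T) + d * (suc L * (β + γ))
        lem₂ = solve-∀

      -- In terms of the deficits α - h e: the deficit of a maximum spanning tree, times k d + 1, is
      -- at most d times the deficit of the whole graph. Both sides are written as sums to avoid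
      -- truncated subtraction.
      heavy-tree : ∀ {d} → n ≡ suc d → ∀ h α → (∀ e → h e ≤ α) → ∃ λ es → es ↭ allFin m ×
        length (kruskal ends (λ v → v) es) ≡ d ×
        (k * d + 1) * (d * α) + d * sumˡ (map h (allFin m)) ≤
        (k * d + 1) * sumˡ (map h (kruskal ends (λ v → v) es)) + d * (m * α)
      heavy-tree {d} n≡ h α h≤α = es , es↭ , len , subst₂ _≤_
          (cong₂ (λ l s → (k * d + 1) * (l * α) + d * s) len (sum-↭ (map⁺ h es↭)))
          (cong (λ l → (k * d + 1) * sumˡ (map h (kruskal ends (λ v → v) es)) + d * (l * α))
                (trans (↭-length es↭) (length-tabulate {n = m} (λ e → e))))
          (kruskal-weight n≡ h es (λ v → v)
            (Linked⇒AllPairs (λ p q → ≤-trans q p) (Sorting.sort-↗ (allFin m))) (λ _ → refl) cov α (bounded es))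
        where
        module Sorting = Sort (On.decTotalOrder (Flip.decTotalOrder ≤-decTotalOrder) h)
        es = Sorting.sort (allFin m)
        es↭ : es ↭ allFin m
        es↭ = Sorting.sort-↭ (allFin m)
        cov : Covers es (λ v → v)
        cov π′ _ = ≤-reflexive (sym (sum-↭ (map⁺ (crosses π′) es↭)))
        bounded : ∀ es → All (λ e → h e ≤ α) es
        bounded []       = []
        bounded (e ∷ es) = h≤α e ∷ bounded es
        all-blocks : ∀ n → sum {n} (λ v → unit (does (v Fin.≟ v))) ≡ n
        all-blocks zero    = refl
        all-blocks (suc n) = cong suc (all-blocks n)
        len : length (kruskal ends (λ v → v) es) ≡ d
        len = suc-injective (trans (kruskal-length es (λ v → v) (λ _ → refl) cov) (trans (all-blocks n) n≡))

  sumˡ-allFin : ∀ {n} (f : Fin n → ℕ) → sumˡ (map f (allFin n)) ≡ sum f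
  sumˡ-allFin {n} f = trans (cong sumˡ (map-tabulate (λ i → i) f)) (go f)
    where
    go : ∀ {n} (f : Fin n → ℕ) → sumˡ (tabulate f) ≡ sum f
    go {zero}  f = refl
    go {suc n} f = cong (f zero +_) (go (f ∘ suc))

-- Both connectivity hypotheses imply density for k ≥ 3.

module Density where
  open import Defs
  open import Data.Nat.Base using (_+_; _*_; _∸_; _≤_; _<_; z≤n; s≤s; s≤s⁻¹)
  open import Data.Nat.Properties
  open import Data.Nat.Tactic.RingSolver using (solve-∀)
  open import Algebra.Properties.CommutativeMonoid.Sum +-0-commutativeMonoid
    using (sum; sum-cong-≗; ∑-comm; ∑-distrib-+)
  open Forests

  sum-mono : ∀ {n} (f g : Fin n → ℕ) → (∀ i → f i ≤ g i) → sum f ≤ sum g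
  sum-mono {zero}  f g le = z≤n
  sum-mono {suc n} f g le = +-mono-≤ (le zero) (sum-mono (f ∘ suc) (g ∘ suc) (le ∘ suc))

  sum-const : ∀ n x → sum {n} (λ _ → x) ≡ n * x
  sum-const zero    x = refl
  sum-const (suc n) x = cong (x +_) (sum-const n x)

  sum-single : ∀ {n} (c : Fin n) x → sum (λ v → if does (c Fin.≟ v) then x else 0) ≡ x
  sum-single {suc n} zero    x = trans (cong (x +_) (trans (sum-const n 0) (*-zeroʳ n))) (+-identityʳ x)
  sum-single (suc c) x = sum-single c x

  module _ (G : Graph) where

    private
      u w : Fin (m G) → Fin (n G)
      u e = proj₁ (ends G e)
      w e = proj₂ (ends G e)

      crossingIn : EdgeSet G → (Fin (n G) → Fin (n G)) → Fin (m G) → ℕ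
      crossingIn S π e = if S e then crosses (ends G) π e else 0

      crosses-mono : ∀ {π π′} → (∀ v v′ → π v ≡ π v′ → π′ v ≡ π′ v′) → ∀ e →
                     crosses (ends G) π′ e ≤ crosses (ends G) π e
      crosses-mono {π} {π′} coarser e with π (u e) Fin.≟ π (w e) | π′ (u e) Fin.≟ π′ (w e)
      ... | yes _  | yes _ = z≤n
      ... | yes eq | no ne = ⊥-elim (ne (coarser _ _ eq))
      ... | no _   | yes _ = z≤n
      ... | no _   | no _  = ≤-refl

      crossingIn-mono : ∀ S {π π′} → (∀ v v′ → π v ≡ π v′ → π′ v ≡ π′ v′) → ∀ es →
                        sumˡ (map (crossingIn S π′) es) ≤ sumˡ (map (crossingIn S π) es)
      crossingIn-mono S coarser []       = z≤n
      crossingIn-mono S {π} {π′} coarser (e ∷ es) = +-mono-≤ (go (S e)) (crossingIn-mono S {π} {π′} coarser es)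
        where
        go : ∀ b → (if b then crosses (ends G) π′ e else 0) ≤ (if b then crosses (ends G) π e else 0)
        go true  = crosses-mono {π} {π′} coarser e
        go false = z≤n

    -- Contract the edges of S one by one; an edge lowers the number of blocks by at most one,
    -- and only if it joins two different blocks.
    contract : ∀ S es π → Idempotent π → ∃ λ π′ → Idempotent π′ ×
      (∀ v v′ → π v ≡ π v′ → π′ v ≡ π′ v′) ×
      (∀ e → e ∈ es → S e ≡ true → π′ (u e) ≡ π′ (w e)) ×
      blocks π ≤ blocks π′ + sumˡ (map (crossingIn S π) es)
    contract S []       π idem = π , idem , (λ _ _ eq → eq) , (λ _ ()) , ≤-reflexive (sym (+-identityʳ _))
    contract S (e ∷ es) π idem = by (S e) refl (π (u e) Fin.≟ π (w e))
      where
      Goal = ∃ λ π′ → Idempotent π′ ×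
        (∀ v v′ → π v ≡ π v′ → π′ v ≡ π′ v′) ×
        (∀ f → f ∈ e ∷ es → S f ≡ true → π′ (u f) ≡ π′ (w f)) ×
        blocks π ≤ blocks π′ + sumˡ (map (crossingIn S π) (e ∷ es))

      keep : (S e ≡ true → π (u e) ≡ π (w e)) → Goal
      keep inside with contract S es π idem
      ... | π′ , idem′ , coarser , joined , bound = π′ , idem′ , coarser ,
        (λ { f (here refl) Sf → coarser _ _ (inside Sf) ; f (there f∈) Sf → joined f f∈ Sf }) ,
        ≤-trans bound (+-monoʳ-≤ (blocks π′) (m≤n+m _ (crossingIn S π e)))

      by : ∀ b → S e ≡ b → Dec (π (u e) ≡ π (w e)) → Goal
      by false Se _          = keep λ Se′ → ⊥-elim (case trans (sym Se) Se′ of λ ())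
      by true  Se (yes same) = keep λ _ → same
      by true  Se (no differ) with contract S es (merge π (u e) (w e)) (merge-idempotent π _ _ idem differ)
      ... | π′ , idem′ , coarser , joined , bound = π′ , idem′ ,
        (λ v v′ eq → coarser v v′ (merge-coarser π _ _ eq)) ,
        (λ { f (here refl) _ → coarser _ _ (merge-joins π _ _) ; f (there f∈) Sf → joined f f∈ Sf }) ,
        (begin
          blocks π                                              ≡⟨ merge-blocks π _ _ idem differ ⟨
          suc (blocks (merge π (u e) (w e)))                    ≤⟨ s≤s bound ⟩
          suc (blocks π′ + sumˡ (map (crossingIn S (merge π (u e) (w e))) es))
            ≤⟨ s≤s (+-monoʳ-≤ (blocks π′) (crossingIn-mono S {π} {merge π (u e) (w e)} (λ _ _ → merge-coarser π _ _) es)) ⟩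
          suc (blocks π′ + sumˡ (map (crossingIn S π) es))      ≡⟨ +-suc (blocks π′) _ ⟨
          blocks π′ + suc (sumˡ (map (crossingIn S π) es))      ≡⟨ cong (λ x → blocks π′ + (x + sumˡ (map (crossingIn S π) es))) one ⟨
          blocks π′ + sumˡ (map (crossingIn S π) (e ∷ es)) ∎)
        where
        open ≤-Reasoning
        one : crossingIn S π e ≡ 1
        one rewrite Se | dec-false (π (u e) Fin.≟ π (w e)) differ = refl

    -- Contracting all edges of `S`, starting from `π`, ends with one block because `S` is
    -- connected, and every lost block is paid for by an edge of `S` that crosses `π`.
    connected-crossing : ∀ S → Connected G S → ∀ π → Idempotent π → ∀ p → blocks π ≡ suc p →
                         p ≤ sum (crossingIn S π)
    connected-crossing S conn π idem p eq with contract S (allFin (m G)) π idem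
    ... | π′ , idem′ , coarser , joined , bound = s≤s⁻¹ (begin
      suc p                                       ≡⟨ eq ⟨
      blocks π                                    ≤⟨ bound ⟩
      blocks π′ + sumˡ (map (crossingIn S π) (allFin (m G))) ≤⟨ +-monoˡ-≤ _ one-block ⟩
      1 + sumˡ (map (crossingIn S π) (allFin (m G))) ≡⟨ cong suc (sumˡ-allFin (crossingIn S π)) ⟩
      suc (sum (crossingIn S π)) ∎)
      where
      open ≤-Reasoning
      along : ∀ {x y} → Reach G S x y → π′ x ≡ π′ y
      along here = refl
      along (fwd e Se refl r) = trans (joined e (∈-allFin e) Se) (along r)
      along (bwd e Se refl r) = trans (sym (joined e (∈-allFin e) Se)) (along r)
      one-block : blocks π′ ≤ 1
      one-block = at-most (λ v → does (π′ v Fin.≟ v)) λ i j p q →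
        trans (sym (holds i p)) (trans (along (conn i j)) (holds j q))
        where
        holds : ∀ i → does (π′ i Fin.≟ i) ≡ true → π′ i ≡ i
        holds i p with π′ i Fin.≟ i
        ... | yes eq = eq
        at-most : ∀ {n} (f : Fin n → Bool) → (∀ i j → f i ≡ true → f j ≡ true → i ≡ j) → sum (unit ∘ f) ≤ 1
        at-most {zero}  f unique = z≤n
        at-most {suc n} f unique with f zero in f0
        ... | false = at-most (f ∘ suc) λ i j p q → Fin.suc-injective (unique (suc i) (suc j) p q)
        ... | true  = s≤s (≤-reflexive (trans (sum-cong-≗ λ i → cong unit (none i)) (trans (sum-const n 0) (*-zeroʳ n))))
          where
          none : ∀ i → f (suc i) ≡ false
          none i with f (suc i) in fi
          ... | false = refl
          ... | true with () ← unique zero (suc i) f0 fi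

    -- The trees are edge-disjoint and each crosses a partition into q blocks at least q - 1 times.
    -- For k ≥ 3, (2k - 2)(q - 1) exceeds k (q - 1).
    trees-dense : ∀ j → TreeConnected (2 * (3 + j) ∸ 2) G → Dense (ends G) (3 + j)
    trees-dense j (a , tree) π idem p eq = begin
      (3 + j) * suc p + 1                       ≤⟨ few j p ⟩
      t * suc p                                 ≡⟨ sum-const t (suc p) ⟨
      sum {t} (λ _ → suc p)                     ≤⟨ sum-mono _ _ (λ i → connected-crossing (treeClass G a i) (proj₁ (tree i)) π idem (suc p) eq) ⟩
      sum (λ i → sum (crossingIn (treeClass G a i) π)) ≡⟨ ∑-comm (λ i e → crossingIn (treeClass G a i) π e) ⟩
      sum (λ e → sum (λ i → crossingIn (treeClass G a i) π e)) ≤⟨ sum-mono _ _ disjoint ⟩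
      sum (crosses (ends G) π)                  ≡⟨ sumˡ-allFin (crosses (ends G) π) ⟨
      crossing (ends G) π ∎
      where
      open ≤-Reasoning
      t = 2 * (3 + j) ∸ 2
      few : ∀ j p → (3 + j) * suc p + 1 ≤ (2 * (3 + j) ∸ 2) * suc p
      few j p = ≤-trans (m≤m+n _ (p + j * suc p)) (≤-reflexive (trans (lem j p) (cong (_* suc p) (sym (lem₂ j)))))
        where
        lem : ∀ j p → (3 + j) * suc p + 1 + (p + j * suc p) ≡ (4 + (j + j)) * suc p
        lem = solve-∀
        lem₂ : ∀ j → 2 * (3 + j) ∸ 2 ≡ 4 + (j + j)
        lem₂ j = cong (_∸ 2) (lem₃ j)
          where
          lem₃ : ∀ j → 2 * (3 + j) ≡ 6 + (j + j)
          lem₃ = solve-∀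
      disjoint : ∀ e → sum (λ i → crossingIn (treeClass G a i) π e) ≤ crosses (ends G) π e
      disjoint e with a e
      ... | nothing = ≤-trans (≤-reflexive (trans (sum-const t 0) (*-zeroʳ t))) z≤n
      ... | just i₀ = ≤-reflexive (trans
        (sum-cong-≗ λ i → cong (λ b → if b then crosses (ends G) π e else 0) (isYes≗does (i₀ Fin.≟ i)))
        (sum-single i₀ (crosses (ends G) π e)))

    -- Double counting: at least 3k - 3 edges leave each of the q blocks, and a crossing edge leaves
    -- two of them. For k ≥ 3, q (3k - 3) is at least 2 (k (q - 1) + 1).
    edge-connected-dense : ∀ j → EdgeConnected (3 * (3 + j) ∸ 3) G → Dense (ends G) (3 + j)
    edge-connected-dense j conn π idem p eq = *-cancelˡ-≤ 2 (begin
      2 * ((3 + j) * suc p + 1)                 ≤⟨ few ⟩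
      (2 + p) * ℓ                               ≡⟨ cong (_* ℓ) eq ⟨
      blocks π * ℓ                              ≡⟨ scale ℓ (λ v → does (π v Fin.≟ v)) ⟩
      sum (λ v → if does (π v Fin.≟ v) then ℓ else 0) ≤⟨ sum-mono _ _ cut-size ⟩
      sum (λ v → sum (λ e → unit (cut v e)))    ≡⟨ ∑-comm (λ v e → unit (cut v e)) ⟩
      sum (λ e → sum (λ v → unit (cut v e)))    ≤⟨ sum-mono _ _ twice ⟩
      sum (λ e → crosses (ends G) π e + crosses (ends G) π e) ≡⟨ ∑-distrib-+ (crosses (ends G) π) (crosses (ends G) π) ⟩
      sum (crosses (ends G) π) + sum (crosses (ends G) π) ≡⟨ cong₂ _+_ (sumˡ-allFin (crosses (ends G) π))
                                                               (trans (+-identityʳ _) (sumˡ-allFin (crosses (ends G) π))) ⟨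
      2 * crossing (ends G) π ∎)
      where
      open ≤-Reasoning
      ℓ = 3 * (3 + j) ∸ 3

      few : 2 * ((3 + j) * suc p + 1) ≤ (2 + p) * ℓ
      few = ≤-trans (m≤m+n _ (4 + j * p + 4 * j)) (≤-reflexive (trans (lem j p) (cong ((2 + p) *_) (sym (cong (_∸ 3) (lem₂ j))))))
        where
        lem : ∀ j p → 2 * ((3 + j) * suc p + 1) + (4 + j * p + 4 * j) ≡ (2 + p) * (6 + 3 * j)
        lem = solve-∀
        lem₂ : ∀ j → 3 * (3 + j) ≡ 9 + 3 * j
        lem₂ = solve-∀

      scale : ∀ ℓ {n} (f : Fin n → Bool) → sum (unit ∘ f) * ℓ ≡ sum (λ v → if f v then ℓ else 0)
      scale ℓ {zero}  f = refl
      scale ℓ {suc n} f with f zero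
      ... | true  = cong (ℓ +_) (scale ℓ (f ∘ suc))
      ... | false = scale ℓ (f ∘ suc)

      cut : Fin (n G) → EdgeSet G
      cut v e = does (π (u e) Fin.≟ v) xor does (π (w e) Fin.≟ v)

      another : ∀ v → ∃ λ v′ → π v′ ≡ v′ × v′ ≢ v
      another v with Fin.any? (λ v′ → (π v′ Fin.≟ v′) ×-dec ¬? (v′ Fin.≟ v))
      ... | yes found = found
      ... | no none   = ⊥-elim (<⇒≱ (s≤s (s≤s (z≤n {p}))) (≤-trans (≤-reflexive (sym eq))
          (≤-trans (sum-mono _ _ only) (≤-reflexive (sum-single v 1)))))
        where
        only : ∀ v′ → unit (does (π v′ Fin.≟ v′)) ≤ (if does (v Fin.≟ v′) then 1 else 0)
        only v′ with π v′ Fin.≟ v′ | v Fin.≟ v′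
        ... | no _   | _      = z≤n
        ... | yes _  | yes _  = ≤-refl
        ... | yes fx | no v≢v′ = ⊥-elim (none (v′ , fx , v≢v′ ∘ sym))

      size-cut : ∀ v → size G (cut v) ≡ sum (λ e → unit (cut v e))
      size-cut v = sumˡ-allFin (λ e → unit (cut v e))

      cut-size : ∀ v → (if does (π v Fin.≟ v) then ℓ else 0) ≤ sum (λ e → unit (cut v e))
      cut-size v with π v Fin.≟ v
      ... | no _   = z≤n
      ... | yes fx with ℓ ≤? size G (cut v)
      ...   | yes le = ≤-trans le (≤-reflexive (size-cut v))
      ...   | no ¬le with another v
      -- Deleting a cut of fewer than ℓ edges would keep the graph connected, but a walk avoiding
      -- the cut stays in the block of `v` and cannot reach `v′`.
      ...     | v′ , fx′ , v′≢v = ⊥-elim (v′≢v (trans (sym fx′) (stays (conn (cut v) (≰⇒> ¬le) v v′) fx)))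
        where
        stays : ∀ {x y} → Reach G (λ e → if cut v e then false else true) x y → π x ≡ v → π y ≡ v
        same-side : ∀ e → (if cut v e then false else true) ≡ true →
                    (π (u e) ≡ v → π (w e) ≡ v) × (π (w e) ≡ v → π (u e) ≡ v)
        same-side e off with π (u e) Fin.≟ v | π (w e) Fin.≟ v
        ... | yes p | yes q = (λ _ → q) , (λ _ → p)
        ... | no p  | no q  = (λ p′ → ⊥-elim (p p′)) , (λ q′ → ⊥-elim (q q′))
        stays here eq = eq
        stays (fwd e off refl r) eq = stays r (proj₁ (same-side e off) eq)
        stays (bwd e off refl r) eq = stays r (proj₂ (same-side e off) eq)

      twice : ∀ e → sum (λ v → unit (cut v e)) ≤ crosses (ends G) π e + crosses (ends G) π e
      twice e with π (u e) Fin.≟ π (w e)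
      ... | yes same rewrite same = ≤-reflexive (trans
            (sum-cong-≗ λ v → cong unit (xor-self (does (π (w e) Fin.≟ v)))) (trans (sum-const (n G) 0) (*-zeroʳ (n G))))
        where
        xor-self : ∀ b → b xor b ≡ false
        xor-self true  = refl
        xor-self false = refl
      ... | no _ = ≤-trans (sum-mono _ _ λ v → either (does (π (u e) Fin.≟ v)) (does (π (w e) Fin.≟ v)))
            (≤-reflexive (trans (∑-distrib-+ (λ v → if does (π (u e) Fin.≟ v) then 1 else 0) (λ v → if does (π (w e) Fin.≟ v) then 1 else 0))
              (cong₂ _+_ (sum-single (π (u e)) 1) (sum-single (π (w e)) 1))))
        where
        either : ∀ a b → unit (a xor b) ≤ (if a then 1 else 0) + (if b then 1 else 0)
        either true  true  = z≤n
        either true  false = ≤-refl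
        either false true  = ≤-refl
        either false false = z≤n

module Electrical where
  open import Data.Integer.Base as ℤ using (ℤ)
  import Data.Integer.Properties as ℤₚ
  open import Data.Integer.Tactic.RingSolver using () renaming (solve-∀ to solveℤ-∀)
  import Algebra.Properties.Semiring.Sum ℤₚ.+-*-semiring as ℤΣ
  open import Data.Nat.Tactic.RingSolver using () renaming (solve-∀ to solveℕ-∀)
  open import Algebra.Properties.CommutativeMonoid.Sum ℕₚ.+-0-commutativeMonoid
    using () renaming (sum to sumℕ; sum-cong-≗ to sumℕ-cong)
  open import Data.Rational.Base hiding (∣_∣; truncate)
  open import Data.Rational.Properties
  import Data.Rational.Unnormalised.Base as ℚᵘ
  import Data.Rational.Unnormalised.Properties as ℚᵘₚ
  open import Tactic.RingSolver using (solve-∀)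
  open import Tactic.RingSolver.Core.AlmostCommutativeRing using (AlmostCommutativeRing; fromCommutativeRing)
  open import Algebra.Properties.Semiring.Sum (CommutativeRing.semiring +-*-commutativeRing)
    using (sum; sum-cong-≗; *-distribˡ-sum)
  open import Algebra.Properties.Semiring.Exp (CommutativeRing.semiring +-*-commutativeRing)
    using (_^_; ^-homo-*; ^-assocʳ)
  open import Algebra.Properties.CommutativeSemiring.Exp (CommutativeRing.commutativeSemiring +-*-commutativeRing)
    using (^-distrib-*)
  open Balancing using (module V; outdegree; fractionalOutdegree; round-orientation)
  open Forests using (merge; merge-coarser; merge-joins; kruskal; Dense; heavy-tree; sum-changeℕ; sumˡ-allFin)

  -- Rational arithmetic and elementary estimates.

  ℚ-ring : AlmostCommutativeRing _ _
  ℚ-ring = fromCommutativeRing +-*-commutativeRing λ x → dec⇒maybe (0ℚ ≟ x)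

  abstract
    -- Total, with value 0 at 0, so positivity is asked for only where an inverse is cancelled. It
    -- is abstract so that it does not unfold in computations.
    inv : ℚ → ℚ
    inv p with p ≟ 0ℚ
    ... | yes _   = 0ℚ
    ... | no  p≢0 = (1/ p) {{≢-nonZero p≢0}}

    inv-inverse : ∀ {p} → 0ℚ < p → inv p * p ≡ 1ℚ
    inv-inverse {p} 0<p with p ≟ 0ℚ
    ... | yes refl = ⊥-elim (<-irrefl refl 0<p)
    ... | no  p≢0  = *-inverseˡ p {{≢-nonZero p≢0}}

  0≤+ : ∀ {p q} → 0ℚ ≤ p → 0ℚ ≤ q → 0ℚ ≤ p + q
  0≤+ {p} {q} 0≤p 0≤q = subst (_≤ p + q) (+-identityˡ 0ℚ) (+-mono-≤ 0≤p 0≤q)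

  0≤* : ∀ {p q} → 0ℚ ≤ p → 0ℚ ≤ q → 0ℚ ≤ p * q
  0≤* {p} {q} 0≤p 0≤q = nonNegative⁻¹ (p * q) {{nonNeg*nonNeg⇒nonNeg p {{nonNegative 0≤p}} q {{nonNegative 0≤q}}}}

  0<* : ∀ {p q} → 0ℚ < p → 0ℚ < q → 0ℚ < p * q
  0<* {p} {q} 0<p 0<q = positive⁻¹ (p * q) {{pos*pos⇒pos p {{positive 0<p}} q {{positive 0<q}}}}

  0<inv : ∀ {p} → 0ℚ < p → 0ℚ < inv p
  0<inv {p} 0<p = ≰⇒> λ inv≤0 → <-irrefl refl (<-≤-trans 0<1 (subst₂ _≤_ (inv-inverse 0<p) (*-zeroˡ p)
    (*-monoʳ-≤-nonNeg p {{nonNegative (<⇒≤ 0<p)}} inv≤0)))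
    where
    0<1 : 0ℚ < 1ℚ
    0<1 = positive⁻¹ 1ℚ

  0≤p² : ∀ p → 0ℚ ≤ p * p
  0≤p² p with ≤-total 0ℚ p
  ... | inj₁ 0≤p = 0≤* 0≤p 0≤p
  ... | inj₂ p≤0 = subst (0ℚ ≤_) (lem p) (0≤* (neg-antimono-≤ p≤0) (neg-antimono-≤ p≤0))
    where
    lem : ∀ p → - p * - p ≡ p * p
    lem = solve-∀ ℚ-ring

  -- The usual way of proving an estimate below: the slack `r` is written out, and the ring solver
  -- checks the identity.
  ≤-by : ∀ {p q} r → 0ℚ ≤ r → q ≡ p + r → p ≤ q
  ≤-by {p} r 0≤r refl = subst (_≤ p + r) (+-identityʳ p) (+-monoʳ-≤ p 0≤r)

  0≤q-p : ∀ {p q} → p ≤ q → 0ℚ ≤ q - p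
  0≤q-p {p} {q} p≤q = subst (_≤ q - p) (+-inverseʳ p) (+-monoˡ-≤ (- p) p≤q)

  *-mono-≤ : ∀ {p q r s} → 0ℚ ≤ p → 0ℚ ≤ r → p ≤ q → r ≤ s → p * r ≤ q * s
  *-mono-≤ {p} {q} {r} {s} 0≤p 0≤r p≤q r≤s = ≤-trans
    (*-monoˡ-≤-nonNeg p {{nonNegative 0≤p}} r≤s)
    (*-monoʳ-≤-nonNeg s {{nonNegative (≤-trans 0≤r r≤s)}} p≤q)

  0<1+ : ∀ {p} → 0ℚ ≤ p → 0ℚ < 1ℚ + p
  0<1+ {p} 0≤p = <-≤-trans (positive⁻¹ 1ℚ) (≤-by p 0≤p refl)

  sum-mono : ∀ {n} (f g : Fin n → ℚ) → (∀ i → f i ≤ g i) → sum f ≤ sum g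
  sum-mono {zero}  f g le = ≤-refl
  sum-mono {suc n} f g le = +-mono-≤ (le zero) (sum-mono _ _ (le ∘ suc))

  0≤sum : ∀ {n} (f : Fin n → ℚ) → (∀ i → 0ℚ ≤ f i) → 0ℚ ≤ sum f
  0≤sum {zero}  f le = ≤-refl
  0≤sum {suc n} f le = 0≤+ (le zero) (0≤sum _ (le ∘ suc))

  sum-linear : ∀ {n} (t : ℚ) (f g : Fin n → ℚ) → sum (λ i → f i - t * g i) ≡ sum f - t * sum g
  sum-linear {zero}  t f g = sym (lem t)
    where
    lem : ∀ t → 0ℚ - t * 0ℚ ≡ 0ℚ
    lem = solve-∀ ℚ-ring
  sum-linear {suc n} t f g =
    trans (cong ((f zero - t * g zero) +_) (sum-linear t (f ∘ suc) (g ∘ suc))) (lem t (f zero) (g zero) _ _)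
    where
    lem : ∀ t a b c d → (a - t * b) + (c - t * d) ≡ (a + c) - t * (b + d)
    lem = solve-∀ ℚ-ring

  abstract
    ι : ℤ → ℚ
    ι i = fromℚᵘ (ℚᵘ.mkℚᵘ i 0)

    private
      toℚᵘ-ι : ∀ i → toℚᵘ (ι i) ℚᵘ.≃ ℚᵘ.mkℚᵘ i 0
      toℚᵘ-ι i = toℚᵘ-fromℚᵘ (ℚᵘ.mkℚᵘ i 0)

    ι-0 : ι (ℤ.+ 0) ≡ 0ℚ
    ι-0 = refl

    ι-1 : ι (ℤ.+ 1) ≡ 1ℚ
    ι-1 = refl

    ι-+ : ∀ i j → ι (i ℤ.+ j) ≡ ι i + ι j
    ι-+ i j = toℚᵘ-injective (ℚᵘₚ.≃-trans (toℚᵘ-ι (i ℤ.+ j)) (ℚᵘₚ.≃-trans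
      (ℚᵘ.*≡* (cong (ℤ._* ℤ.+ 1) (cong₂ ℤ._+_ (sym (ℤₚ.*-identityʳ i)) (sym (ℤₚ.*-identityʳ j)))))
      (ℚᵘₚ.≃-sym (ℚᵘₚ.≃-trans (toℚᵘ-homo-+ (ι i) (ι j)) (ℚᵘₚ.+-cong (toℚᵘ-ι i) (toℚᵘ-ι j))))))

    ι-* : ∀ i j → ι (i ℤ.* j) ≡ ι i * ι j
    ι-* i j = toℚᵘ-injective (ℚᵘₚ.≃-trans (toℚᵘ-ι (i ℤ.* j)) (ℚᵘₚ.≃-trans
      (ℚᵘ.*≡* refl)
      (ℚᵘₚ.≃-sym (ℚᵘₚ.≃-trans (toℚᵘ-homo-* (ι i) (ι j)) (ℚᵘₚ.*-cong (toℚᵘ-ι i) (toℚᵘ-ι j))))))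

    ι-neg : ∀ i → ι (ℤ.- i) ≡ - ι i
    ι-neg i = toℚᵘ-injective (ℚᵘₚ.≃-trans (toℚᵘ-ι (ℤ.- i))
      (ℚᵘₚ.≃-sym (ℚᵘₚ.≃-trans (toℚᵘ-homo‿- (ι i)) (ℚᵘₚ.-‿cong (toℚᵘ-ι i)))))

    ι-mono-≤ : ∀ {i j} → i ℤ.≤ j → ι i ≤ ι j
    ι-mono-≤ {i} {j} le = toℚᵘ-cancel-≤ (ℚᵘₚ.≤-respˡ-≃ (ℚᵘₚ.≃-sym (toℚᵘ-ι i))
      (ℚᵘₚ.≤-respʳ-≃ (ℚᵘₚ.≃-sym (toℚᵘ-ι j)) (ℚᵘ.*≤* (ℤₚ.*-monoʳ-≤-nonNeg (ℤ.+ 1) le))))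

    ι-mono-< : ∀ {i j} → i ℤ.< j → ι i < ι j
    ι-mono-< {i} {j} lt = toℚᵘ-cancel-< (ℚᵘₚ.<-respˡ-≃ (ℚᵘₚ.≃-sym (toℚᵘ-ι i))
      (ℚᵘₚ.<-respʳ-≃ (ℚᵘₚ.≃-sym (toℚᵘ-ι j)) (ℚᵘ.*<* (ℤₚ.*-monoʳ-<-pos (ℤ.+ 1) lt))))

    archimedean : ∀ p → ∃ λ n → p < ι (ℤ.+ n)
    archimedean p@(mkℚ i d-1 _) = suc ℤ.∣ i ∣ , toℚᵘ-cancel-< (ℚᵘₚ.<-respʳ-≃ (ℚᵘₚ.≃-sym (toℚᵘ-ι (ℤ.+ suc ℤ.∣ i ∣)))
      (ℚᵘ.*<* (ℤₚ.≤-<-trans (ℤₚ.≤-reflexive (ℤₚ.*-identityʳ i)) (ℤₚ.<-≤-trans (i<1+∣i∣ i) (le ℤ.∣ i ∣)))))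
      where
      i<1+∣i∣ : ∀ i → i ℤ.< ℤ.+ suc ℤ.∣ i ∣
      i<1+∣i∣ (ℤ.+ n)    = ℤ.+<+ (ℕ.s≤s (ℕₚ.≤-refl))
      i<1+∣i∣ ℤ.-[1+ n ] = ℤ.-<+
      le : ∀ n → ℤ.+ suc n ℤ.≤ ℤ.+ suc n ℤ.* ℤ.+ suc d-1
      le n = subst (ℤ._≤ ℤ.+ suc n ℤ.* ℤ.+ suc d-1) (ℤₚ.*-identityʳ (ℤ.+ suc n))
        (ℤₚ.*-monoˡ-≤-nonNeg (ℤ.+ suc n) (ℤ.+≤+ (ℕ.s≤s ℕ.z≤n)))

  ι-cancel-< : ∀ {i j} → ι i < ι j → i ℤ.< j
  ι-cancel-< {i} {j} lt = ℤₚ.≰⇒> λ le → <-irrefl refl (<-≤-trans lt (ι-mono-≤ le))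

  # : ℕ → ℚ
  # n = ι (ℤ.+ n)

  #-suc : ∀ n → # (suc n) ≡ 1ℚ + # n
  #-suc n = trans (ι-+ (ℤ.+ 1) (ℤ.+ n)) (cong (_+ # n) ι-1)

  0≤# : ∀ n → 0ℚ ≤ # n
  0≤# n = subst (_≤ # n) ι-0 (ι-mono-≤ (ℤ.+≤+ ℕ.z≤n))

  0<#suc : ∀ n → 0ℚ < # (suc n)
  0<#suc n = subst (_< # (suc n)) ι-0 (ι-mono-< (ℤ.+<+ (ℕ.s≤s ℕ.z≤n)))

  sum-const : ∀ n p → sum {n} (λ _ → p) ≡ # n * p
  sum-const zero    p = sym (trans (cong (_* p) ι-0) (*-zeroˡ p))
  sum-const (suc n) p = trans (cong (p +_) (sum-const n p)) (trans (lem p (# n)) (cong (_* p) (sym (#-suc n))))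
    where
    lem : ∀ p n → p + n * p ≡ (1ℚ + n) * p
    lem = solve-∀ ℚ-ring

  0<^ : ∀ {p} n → 0ℚ < p → 0ℚ < p ^ n
  0<^ zero    0<p = positive⁻¹ 1ℚ
  0<^ (suc n) 0<p = 0<* 0<p (0<^ n 0<p)

  0≤^ : ∀ {p} n → 0ℚ ≤ p → 0ℚ ≤ p ^ n
  0≤^ zero    0≤p = <⇒≤ (positive⁻¹ 1ℚ)
  0≤^ (suc n) 0≤p = 0≤* 0≤p (0≤^ n 0≤p)

  ^-mono-≤ : ∀ {p q} n → 0ℚ ≤ p → p ≤ q → p ^ n ≤ q ^ n
  ^-mono-≤ zero    0≤p p≤q = ≤-refl
  ^-mono-≤ (suc n) 0≤p p≤q = *-mono-≤ 0≤p (0≤^ n 0≤p) p≤q (^-mono-≤ n 0≤p p≤q)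

  indicator : Bool → ℚ
  indicator b = if b then 1ℚ else 0ℚ

  0≤sum-² : ∀ {n} (f : Fin n → ℚ) → 0ℚ ≤ sum (λ i → f i * f i)
  0≤sum-² f = 0≤sum (λ i → f i * f i) (λ i → 0≤p² (f i))

  sum-square : ∀ {n} t (p x : Fin n → ℚ) → sum (λ v → (p v - t * x v) * (p v - t * x v)) ≡
    sum (λ v → p v * p v) - (t + t) * sum (λ v → x v * p v) + t * t * sum (λ v → x v * x v)
  sum-square {zero}  t p x = lem t
    where
    lem : ∀ t → 0ℚ ≡ 0ℚ - (t + t) * 0ℚ + t * t * 0ℚ
    lem = solve-∀ ℚ-ring
  sum-square {suc n} t p x = trans (cong (((p zero - t * x zero) * (p zero - t * x zero)) +_) (sum-square t (p ∘ suc) (x ∘ suc)))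
    (lem t (p zero) (x zero) _ _ _)
    where
    lem : ∀ t p x a b c → (p - t * x) * (p - t * x) + (a - (t + t) * b + t * t * c) ≡
      (p * p + a) - (t + t) * (x * p + b) + t * t * (x * x + c)
    lem = solve-∀ ℚ-ring

  0<1 : 0ℚ < 1ℚ
  0<1 = positive⁻¹ 1ℚ

  0≤1 : 0ℚ ≤ 1ℚ
  0≤1 = <⇒≤ 0<1

  #-* : ∀ a b → # (a ℕ.* b) ≡ # a * # b
  #-* a b = trans (cong ι (ℤₚ.pos-* a b)) (ι-* (ℤ.+ a) (ℤ.+ b))

  #-+ : ∀ a b → # (a ℕ.+ b) ≡ # a + # b
  #-+ a b = ι-+ (ℤ.+ a) (ℤ.+ b)

  #-mono : ∀ {a b} → a ℕ.≤ b → # a ≤ # b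
  #-mono le = ι-mono-≤ (ℤ.+≤+ le)

  1^ : ∀ n → 1ℚ ^ n ≡ 1ℚ
  1^ zero    = refl
  1^ (suc n) = trans (*-identityˡ (1ℚ ^ n)) (1^ n)

  1≤^ : ∀ {p} n → 1ℚ ≤ p → 1ℚ ≤ p ^ n
  1≤^ {p} n 1≤p = subst (_≤ p ^ n) (1^ n) (^-mono-≤ n 0≤1 1≤p)

  ^≤1 : ∀ {p} n → 0ℚ ≤ p → p ≤ 1ℚ → p ^ n ≤ 1ℚ
  ^≤1 {p} n 0≤p p≤1 = subst (p ^ n ≤_) (1^ n) (^-mono-≤ n 0≤p p≤1)

  bernoulli : ∀ {p} n → 0ℚ ≤ p → 1ℚ + # n * p ≤ (1ℚ + p) ^ n
  bernoulli {p} zero    0≤p = ≤-reflexive (trans (cong (λ z → 1ℚ + z * p) ι-0) (lem p))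
    where
    lem : ∀ p → 1ℚ + 0ℚ * p ≡ 1ℚ
    lem = solve-∀ ℚ-ring
  bernoulli {p} (suc n) 0≤p = ≤-trans
    (≤-by (# n * (p * p)) (0≤* (0≤# n) (0≤p² p))
      (sym (trans (cong (λ z → 1ℚ + z * p + # n * (p * p)) (#-suc n)) (lem p (# n)))))
    (*-monoˡ-≤-nonNeg (1ℚ + p) {{nonNegative (<⇒≤ (0<1+ 0≤p))}} (bernoulli n 0≤p))
    where
    lem : ∀ p n → 1ℚ + (1ℚ + n) * p + n * (p * p) ≡ (1ℚ + p) * (1ℚ + n * p)
    lem = solve-∀ ℚ-ring

  bernoulli⁻ : ∀ {p} n → 0ℚ ≤ p → p ≤ 1ℚ → 1ℚ - # n * p ≤ (1ℚ - p) ^ n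
  bernoulli⁻ {p} zero    0≤p p≤1 = ≤-reflexive (trans (cong (λ z → 1ℚ - z * p) ι-0) (lem p))
    where
    lem : ∀ p → 1ℚ - 0ℚ * p ≡ 1ℚ
    lem = solve-∀ ℚ-ring
  bernoulli⁻ {p} (suc n) 0≤p p≤1 = ≤-trans
    (≤-by (# n * (p * p)) (0≤* (0≤# n) (0≤p² p))
      (sym (trans (cong (λ z → 1ℚ - z * p + # n * (p * p)) (#-suc n)) (lem p (# n)))))
    (*-monoˡ-≤-nonNeg (1ℚ - p) {{nonNegative (0≤q-p p≤1)}} (bernoulli⁻ n 0≤p p≤1))
    where
    lem : ∀ p n → 1ℚ - (1ℚ + n) * p + n * (p * p) ≡ (1ℚ - p) * (1ℚ - n * p)
    lem = solve-∀ ℚ-ring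

  private
    difference-of-squares : ∀ p → (1ℚ - p) * (1ℚ + p) ≡ 1ℚ - p * p
    difference-of-squares = solve-∀ ℚ-ring

  -- Bernoulli's inequality bounds 1 + n p by (1 + p)^n, and (1 - p)(1 + p) ≤ 1. This rational
  -- estimate replaces bounds by the exponential function.
  power-decay : ∀ {p} n → 0ℚ ≤ p → p ≤ 1ℚ → (1ℚ - p) ^ n * (1ℚ + # n * p) ≤ 1ℚ
  power-decay {p} n 0≤p p≤1 = ≤-trans
    (*-monoˡ-≤-nonNeg ((1ℚ - p) ^ n) {{nonNegative (0≤^ n (0≤q-p p≤1))}} (bernoulli n 0≤p))
    (subst (_≤ 1ℚ) (^-distrib-* (1ℚ - p) (1ℚ + p) n)
      (^≤1 n (0≤* (0≤q-p p≤1) (<⇒≤ (0<1+ 0≤p)))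
        (≤-by (p * p) (0≤p² p) (sym (trans (cong (_+ p * p) (difference-of-squares p)) (lem p))))))
    where
    lem : ∀ p → 1ℚ - p * p + p * p ≡ 1ℚ
    lem = solve-∀ ℚ-ring

  -- With H V p > E, the value E (1 - p)^H is at most H V p (1 - p)^H, which is less than V (1 + H
  -- p)(1 - p)^H, and `power-decay` bounds the latter by V.
  geometric-decay : ∀ {p V} → 0ℚ < p → p < 1ℚ → 0ℚ < V → ∀ E → ∃ λ H → E * (1ℚ - p) ^ H < V
  geometric-decay {p} {V} 0<p p<1 0<V E with archimedean (E * inv (V * p))
  ... | H , large = H , ≤-<-trans step₁ step₂
    where
    0<Vp = 0<* 0<V 0<p
    E<HVp : E < # H * (V * p)
    E<HVp = subst (_< # H * (V * p))
      (trans (*-assoc E _ _) (trans (cong (E *_) (inv-inverse 0<Vp)) (*-identityʳ E)))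
      (*-monoˡ-<-pos (V * p) {{positive 0<Vp}} large)
    0<q : 0ℚ < (1ℚ - p) ^ H
    0<q = 0<^ H (subst (_< 1ℚ - p) (+-inverseʳ p) (+-monoˡ-< (- p) p<1))
    step₁ : E * (1ℚ - p) ^ H ≤ # H * (V * p) * (1ℚ - p) ^ H
    step₁ = *-monoʳ-≤-nonNeg ((1ℚ - p) ^ H) {{nonNegative (<⇒≤ 0<q)}} (<⇒≤ E<HVp)
    step₂ : # H * (V * p) * (1ℚ - p) ^ H < V
    step₂ = <-≤-trans
      (subst (_< V * ((1ℚ - p) ^ H * (1ℚ + # H * p))) (+-identityʳ _)
        (subst (# H * (V * p) * (1ℚ - p) ^ H + 0ℚ <_) (lem (# H) V p ((1ℚ - p) ^ H))
          (+-monoʳ-< (# H * (V * p) * (1ℚ - p) ^ H) (0<* 0<V 0<q))))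
      (subst (V * ((1ℚ - p) ^ H * (1ℚ + # H * p)) ≤_) (*-identityʳ V)
        (*-monoˡ-≤-nonNeg V {{nonNegative (<⇒≤ 0<V)}} (power-decay H (<⇒≤ 0<p) (<⇒≤ p<1))))
      where
      lem : ∀ H V p q → H * (V * p) * q + V * q ≡ V * (q * (1ℚ + H * p))
      lem = solve-∀ ℚ-ring

  inv≤1 : ∀ {p} → 1ℚ ≤ p → inv p ≤ 1ℚ
  inv≤1 {p} 1≤p = subst₂ _≤_ (*-identityʳ (inv p)) (inv-inverse 0<p)
    (*-monoˡ-≤-nonNeg (inv p) {{nonNegative (<⇒≤ (0<inv 0<p))}} 1≤p)
    where
    0<p : 0ℚ < p
    0<p = <-≤-trans 0<1 1≤p

  ι-sum : ∀ {n} (f : Fin n → ℤ) → ι (ℤΣ.sum f) ≡ sum (ι ∘ f)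
  ι-sum {zero}  f = ι-0
  ι-sum {suc n} f = trans (ι-+ (f zero) _) (cong (ι (f zero) +_) (ι-sum (f ∘ suc)))

  ∣∣-bound : ∀ i {q} → ι i ≤ q → - ι i ≤ q → ι (ℤ.+ ℤ.∣ i ∣) ≤ q
  ∣∣-bound (ℤ.+ n)      le _  = le
  ∣∣-bound ℤ.-[1+ n ] {q} _ le = subst (_≤ q) (sym (ι-neg ℤ.-[1+ n ])) le

  floor-of : ∀ p → 0ℚ ≤ p → ∃ λ X → # X ≤ p × p < # (suc X)
  floor-of p 0≤p with archimedean p
  ... | N , p<N = go N p<N
    where
    go : ∀ N → p < # N → ∃ λ X → # X ≤ p × p < # (suc X)
    go zero    p<0 = ⊥-elim (<-irrefl refl (≤-<-trans 0≤p (subst (p <_) ι-0 p<0)))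
    go (suc N) p<N = by (# N ≤? p)
      where
      by : Dec (# N ≤ p) → ∃ λ X → # X ≤ p × p < # (suc X)
      by (yes N≤p) = N , N≤p , p<N
      by (no  N≰p) = go N (≰⇒> N≰p)

  #-cancel-≤ : ∀ {a b} → # a ≤ # b → a ℕ.≤ b
  #-cancel-≤ {a} {b} le = ℕₚ.≮⇒≥ λ b<a → <-irrefl refl (<-≤-trans (ι-mono-< (ℤ.+<+ b<a)) le)

  positive-minimum : ∀ {n} (f : Fin n → ℚ) → (∀ i → 0ℚ < f i) → ∃ λ γ → 0ℚ < γ × (∀ i → γ ≤ f i)
  positive-minimum {zero}  f 0<f = 1ℚ , 0<1 , λ ()
  positive-minimum {suc n} f 0<f with positive-minimum (f ∘ suc) (0<f ∘ suc)
  ... | γ , 0<γ , below with ≤-total γ (f zero)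
  ...   | inj₁ γ≤f = γ , 0<γ , λ { zero → γ≤f ; (suc i) → below i }
  ...   | inj₂ f≤γ = f zero , 0<f zero , λ { zero → ≤-refl ; (suc i) → ≤-trans f≤γ (below i) }

  positive-minimum-⊎ : ∀ {m n} (f : Fin m ⊎ Fin n → ℚ) → (∀ i → 0ℚ < f i) → ∃ λ γ → 0ℚ < γ × (∀ i → γ ≤ f i)
  positive-minimum-⊎ {m} {n} f 0<f with positive-minimum (f ∘ splitAt m) (λ i → 0<f (splitAt m i))
  ... | γ , 0<γ , below = γ , 0<γ , λ i → subst (λ j → γ ≤ f j) (Fin.splitAt-join m n i) (below (join m n i))

  -- Grounded networks: inverse Laplacians and determinants under rank-one updates.

  module Network (d : ℕ) where

    Vector = Fin d → ℚ
    Form = Vector → Vector → ℚ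
    Item = ℚ × Vector

    δ : Fin d → Vector
    δ u v = if does (u Fin.≟ v) then 1ℚ else 0ℚ

    asum : (Item → ℚ) → List Item → ℚ
    asum f []       = 0ℚ
    asum f (a ∷ as) = f a + asum f as

    asum-ʳ++ : ∀ f as bs → asum f (as ʳ++ bs) ≡ asum f as + asum f bs
    asum-ʳ++ f []       bs = sym (+-identityˡ _)
    asum-ʳ++ f (a ∷ as) bs = trans (asum-ʳ++ f as (a ∷ bs)) (lem (f a) (asum f as) (asum f bs))
      where
      lem : ∀ x y z → y + (x + z) ≡ x + y + z
      lem = solve-∀ ℚ-ring

    0≤asum : ∀ f as → All (λ a → 0ℚ ≤ f a) as → 0ℚ ≤ asum f as
    0≤asum f []       []         = ≤-refl
    0≤asum f (a ∷ as) (le ∷ les) = 0≤+ le (0≤asum f as les)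

    _≐_ : Form → Form → Set
    B ≐ C = ∀ x y → B x y ≡ C x y

    -- The Sherman-Morrison formula: the inverse after c w wᵀ has been added to the matrix.
    insert : Item → Form → Form
    insert (c , w) B x y = B x y - c * inv (1ℚ + c * B w w) * B x w * B w y

    run : List Item → Form → Form
    run []       B = B
    run (a ∷ as) B = run as (insert a B)

    -- By the matrix determinant lemma, the quotient of the determinants after and before the
    -- insertion. Thus `det as dot` is the determinant of I + Σ c w wᵀ.
    factor : Item → Form → ℚ
    factor (c , w) B = 1ℚ + c * B w w

    det : List Item → Form → ℚ
    det []       B = 1ℚ
    det (a ∷ as) B = factor a B * det as (insert a B)

    run-++ : ∀ as bs B → run (as ++ bs) B ≡ run bs (run as B)
    run-++ []       bs B = refl
    run-++ (a ∷ as) bs B = run-++ as bs (insert a B)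

    det-++ : ∀ as bs B → det (as ++ bs) B ≡ det as B * det bs (run as B)
    det-++ []       bs B = sym (*-identityˡ _)
    det-++ (a ∷ as) bs B =
      trans (cong (factor a B *_) (det-++ as bs (insert a B))) (sym (*-assoc (factor a B) _ _))

    insert-cong : ∀ a {B C} → B ≐ C → insert a B ≐ insert a C
    insert-cong (c , w) eq x y rewrite eq x y | eq w w | eq x w | eq w y = refl

    run-cong : ∀ as {B C} → B ≐ C → run as B ≐ run as C
    run-cong []       eq = eq
    run-cong (a ∷ as) eq = run-cong as (insert-cong a eq)

    det-cong : ∀ as {B C} → B ≐ C → det as B ≡ det as C
    det-cong []             eq = refl
    det-cong ((c , w) ∷ as) eq =
      cong₂ _*_ (cong (λ b → 1ℚ + c * b) (eq w w)) (det-cong as (insert-cong (c , w) eq))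

    -- B is the inverse of the matrix I + Σ c w wᵀ, the sum running over the items.
    record Green (items : List Item) (B : Form) : Set where
      field
        nonneg    : All (λ a → 0ℚ ≤ proj₁ a) items
        symmetric : ∀ x y → B x y ≡ B y x
        expand    : ∀ x y → B x y ≡ sum (λ v → y v * B x (δ v))
        energy    : ∀ x y → B x y ≡ sum (λ v → B x (δ v) * B y (δ v)) +
                                    asum (λ (c , w) → c * (B x w * B y w)) items
        current   : ∀ x v → x v ≡ B x (δ v) + asum (λ (c , w) → c * B x w * w v) items

      0≤items : ∀ x → 0ℚ ≤ asum (λ (c , w) → c * (B x w * B x w)) items
      0≤items x = 0≤asum _ items (go items nonneg)
        where
        go : ∀ as → All (λ a → 0ℚ ≤ proj₁ a) as → All (λ (c , w) → 0ℚ ≤ c * (B x w * B x w)) as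
        go []             []         = []
        go ((c , w) ∷ as) (le ∷ les) = 0≤* le (0≤p² (B x w)) ∷ go as les

      squares≤ : ∀ x → sum (λ v → B x (δ v) * B x (δ v)) ≤ B x x
      squares≤ x = ≤-by _ (0≤items x) (energy x x)

      0≤diagonal : ∀ x → 0ℚ ≤ B x x
      0≤diagonal x = ≤-trans (0≤sum _ λ v → 0≤p² (B x (δ v))) (squares≤ x)

    open Green

    0<factor : ∀ {items B} → Green items B → ∀ a → 0ℚ ≤ proj₁ a → 0ℚ < factor a B
    0<factor G (c , w) 0≤c = 0<1+ (0≤* 0≤c (0≤diagonal G w))

    module _ {items B} (G : Green items B) (c : ℚ) (w : Vector) (0≤c : 0ℚ ≤ c) where
      private
        i = inv (1ℚ + c * B w w)

        i*F≡1 : i * (1ℚ + c * B w w) ≡ 1ℚ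
        i*F≡1 = inv-inverse (0<factor G (c , w) 0≤c)

        B′ = insert (c , w) B

        -- The ring solver knows nothing of i F = 1. Identities are therefore given to it with an
        -- explicit multiple of i F - 1, which is removed here.
        collapse : ∀ {p} q r → p ≡ q + r * (i * (1ℚ + c * B w w) - 1ℚ) → p ≡ q
        collapse q r eq = trans eq (trans (cong (λ z → q + r * (z - 1ℚ)) i*F≡1) (lem q r))
          where
          lem : ∀ q r → q + r * (1ℚ - 1ℚ) ≡ q
          lem = solve-∀ ℚ-ring

        current-sum : ∀ x v as → asum (λ (c , w) → c * B′ x w * w v) as ≡
          asum (λ (c , w) → c * B x w * w v) as - (c * i * B x w) * asum (λ (c , u) → c * B w u * u v) as
        current-sum x v [] = sym (lem (c * i * B x w))
          where
          lem : ∀ l → 0ℚ - l * 0ℚ ≡ 0ℚ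
          lem = solve-∀ ℚ-ring
        current-sum x v ((a , u) ∷ as) = trans (cong ((a * B′ x u * u v) +_) (current-sum x v as))
          (lem a (B x u) (B w u) (u v) (c * i * B x w) _ _)
          where
          lem : ∀ a p q r l s t → a * (p - l * q) * r + (s - l * t) ≡ (a * p * r + s) - l * (a * q * r + t)
          lem = solve-∀ ℚ-ring

        energy-sum : ∀ x y as → asum (λ (c , u) → c * (B′ x u * B′ y u)) as ≡
          asum (λ (c , u) → c * (B x u * B y u)) as
          - (c * i * B y w) * asum (λ (c , u) → c * (B x u * B w u)) as
          - (c * i * B x w) * asum (λ (c , u) → c * (B w u * B y u)) as
          + (c * i * B x w) * (c * i * B y w) * asum (λ (c , u) → c * (B w u * B w u)) as
        energy-sum x y [] = sym (lem (c * i * B x w) (c * i * B y w))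
          where
          lem : ∀ l k → 0ℚ - k * 0ℚ - l * 0ℚ + l * k * 0ℚ ≡ 0ℚ
          lem = solve-∀ ℚ-ring
        energy-sum x y ((a , u) ∷ as) = trans (cong ((a * (B′ x u * B′ y u)) +_) (energy-sum x y as))
          (lem a (B x u) (B y u) (B w u) (c * i * B x w) (c * i * B y w) _ _ _ _)
          where
          lem : ∀ a p q r l k s t u z → a * ((p - l * r) * (q - k * r)) + (s - k * t - l * u + l * k * z) ≡
            (a * (p * q) + s) - k * (a * (p * r) + t) - l * (a * (r * q) + u) + l * k * (a * (r * r) + z)
          lem = solve-∀ ℚ-ring

        square-sum : ∀ {n} x y (e : Fin n → Vector) → sum (λ v → B′ x (e v) * B′ y (e v)) ≡
          sum (λ v → B x (e v) * B y (e v))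
          - (c * i * B y w) * sum (λ v → B x (e v) * B w (e v))
          - (c * i * B x w) * sum (λ v → B w (e v) * B y (e v))
          + (c * i * B x w) * (c * i * B y w) * sum (λ v → B w (e v) * B w (e v))
        square-sum {zero} x y e = sym (lem (c * i * B x w) (c * i * B y w))
          where
          lem : ∀ l k → 0ℚ - k * 0ℚ - l * 0ℚ + l * k * 0ℚ ≡ 0ℚ
          lem = solve-∀ ℚ-ring
        square-sum {suc n} x y e = trans (cong ((B′ x (e zero) * B′ y (e zero)) +_) (square-sum x y (e ∘ suc)))
          (lem (B x (e zero)) (B y (e zero)) (B w (e zero)) (c * i * B x w) (c * i * B y w) _ _ _ _)
          where
          lem : ∀ p q r l k s t u z → ((p - l * r) * (q - k * r)) + (s - k * t - l * u + l * k * z) ≡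
            ((p * q) + s) - k * ((p * r) + t) - l * ((r * q) + u) + l * k * ((r * r) + z)
          lem = solve-∀ ℚ-ring

      insert-Green : Green ((c , w) ∷ items) (insert (c , w) B)
      nonneg insert-Green = 0≤c ∷ nonneg G
      symmetric insert-Green x y =
        trans (cong₂ (λ p q → p - c * i * B x w * q) (symmetric G x y) (symmetric G w y))
        (trans (cong (λ q → B y x - c * i * q * B y w) (symmetric G x w))
               (lem (B y x) (c * i) (B w x) (B y w)))
        where
        lem : ∀ a l p q → a - l * p * q ≡ a - l * q * p
        lem = solve-∀ ℚ-ring
      expand insert-Green x y =
        trans (cong₂ (λ p q → p - c * i * B x w * q) (expand G x y) (expand G w y))
        (trans (sym (sum-linear (c * i * B x w) (λ v → y v * B x (δ v)) (λ v → y v * B w (δ v))))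
               (sum-cong-≗ λ v → lem (y v) (B x (δ v)) (c * i * B x w) (B w (δ v))))
        where
        lem : ∀ y p l q → y * p - l * (y * q) ≡ y * (p - l * q)
        lem = solve-∀ ℚ-ring
      current insert-Green x v = sym (collapse (x v) (- (c * B x w * w v)) (begin
        B′ x (δ v) + (c * B′ x w * w v + asum (λ (c , w) → c * B′ x w * w v) items)
          ≡⟨ cong (λ s → B′ x (δ v) + (c * B′ x w * w v + s)) (current-sum x v items) ⟩
        B′ x (δ v) + (c * B′ x w * w v + (p - l * q))
          ≡⟨ lem₁ (B x (δ v)) (B w (δ v)) l (c * B′ x w * w v) p q ⟩
        (B x (δ v) + p) - l * (B w (δ v) + q) + c * B′ x w * w v
          ≡⟨ cong₂ (λ s t → s - l * t + c * B′ x w * w v) (current G x v) (current G w v) ⟨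
        x v - l * w v + c * B′ x w * w v
          ≡⟨ lem₂ (x v) (w v) c i (B x w) (B w w) ⟩
        x v + - (c * B x w * w v) * (i * (1ℚ + c * B w w) - 1ℚ) ∎))
        where
        open ≡-Reasoning
        l = c * i * B x w
        p = asum (λ (c , w) → c * B x w * w v) items
        q = asum (λ (c , u) → c * B w u * u v) items
        lem₁ : ∀ a b l n p q → (a - l * b) + (n + (p - l * q)) ≡ (a + p) - l * (b + q) + n
        lem₁ = solve-∀ ℚ-ring
        lem₂ : ∀ x w c i p b → x - c * i * p * w + c * (p - c * i * p * b) * w ≡
                               x + - (c * p * w) * (i * (1ℚ + c * b) - 1ℚ)
        lem₂ = solve-∀ ℚ-ring
      energy insert-Green x y = sym (collapse (B′ x y) (c * B x w * B y w * (i * (1ℚ + c * B w w) - 1ℚ - i)) (begin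
        sum (λ v → B′ x (δ v) * B′ y (δ v)) + (c * (B′ x w * B′ y w) + asum (λ (c , u) → c * (B′ x u * B′ y u)) items)
          ≡⟨ cong₂ (λ s t → s + (c * (B′ x w * B′ y w) + t)) (square-sum x y δ) (energy-sum x y items) ⟩
        (s x y - k * s x w - l * s w y + l * k * s w w) + (c * (B′ x w * B′ y w) + (t x y - k * t x w - l * t w y + l * k * t w w))
          ≡⟨ lem₁ k l (s x y) (s x w) (s w y) (s w w) (t x y) (t x w) (t w y) (t w w) _ ⟩
        (s x y + t x y) - k * (s x w + t x w) - l * (s w y + t w y) + l * k * (s w w + t w w) + c * (B′ x w * B′ y w)
          ≡⟨ cong₂ (λ a b → a - k * b - l * (s w y + t w y) + l * k * (s w w + t w w) + c * (B′ x w * B′ y w)) (energy G x y) (energy G x w) ⟨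
        B x y - k * B x w - l * (s w y + t w y) + l * k * (s w w + t w w) + c * (B′ x w * B′ y w)
          ≡⟨ cong₂ (λ a b → B x y - k * B x w - l * a + l * k * b + c * (B′ x w * B′ y w)) (energy G w y) (energy G w w) ⟨
        B x y - k * B x w - l * B w y + l * k * B w w + c * (B′ x w * B′ y w)
          ≡⟨ lem₂ (B x y) (B x w) (B y w) (B w w) c i (B w y) ⟩
        B′ x y + c * B x w * B y w * (i * (1ℚ + c * B w w) - 1ℚ - i) * (i * (1ℚ + c * B w w) - 1ℚ) ∎))
        where
        open ≡-Reasoning
        k = c * i * B y w
        l = c * i * B x w
        s t : Form
        s x y = sum (λ v → B x (δ v) * B y (δ v))
        t x y = asum (λ (c , w) → c * (B x w * B y w)) items
        lem₁ : ∀ k l s₁ s₂ s₃ s₄ t₁ t₂ t₃ t₄ n →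
          (s₁ - k * s₂ - l * s₃ + l * k * s₄) + (n + (t₁ - k * t₂ - l * t₃ + l * k * t₄)) ≡
          (s₁ + t₁) - k * (s₂ + t₂) - l * (s₃ + t₃) + l * k * (s₄ + t₄) + n
        lem₁ = solve-∀ ℚ-ring
        lem₂ : ∀ a p q b c i r →
          a - c * i * q * p - c * i * p * r + (c * i * p) * (c * i * q) * b + c * ((p - c * i * p * b) * (q - c * i * q * b)) ≡
          (a - c * i * p * r) + c * p * q * (i * (1ℚ + c * b) - 1ℚ - i) * (i * (1ℚ + c * b) - 1ℚ)
        lem₂ = solve-∀ ℚ-ring

    module _ {items B} (G : Green items B) (c e : ℚ) (w z : Vector) (0≤c : 0ℚ ≤ c) (0≤e : 0ℚ ≤ e) where
      private
        i = inv (1ℚ + c * B w w)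
        F₁ = 1ℚ + c * B w w
        B₁ = insert (c , w) B
        F₂ = 1ℚ + e * B₁ z z
        j = inv F₂
        G₁ : Green ((c , w) ∷ items) B₁
        G₁ = insert-Green G c w 0≤c
        0<F₁ : 0ℚ < F₁
        0<F₁ = 0<factor G (c , w) 0≤c
        0<F₂ : 0ℚ < F₂
        0<F₂ = 0<factor G₁ (e , z) 0≤e
        iF₁≡1 : i * F₁ ≡ 1ℚ
        iF₁≡1 = inv-inverse 0<F₁
        jF₂≡1 : j * F₂ ≡ 1ℚ
        jF₂≡1 = inv-inverse 0<F₂

        collapse : ∀ {p} q r → p ≡ q + r * (i * F₁ - 1ℚ) → p ≡ q
        collapse q r eq = trans eq (trans (cong (λ z → q + r * (z - 1ℚ)) iF₁≡1) (lem q r))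
          where
          lem : ∀ q r → q + r * (1ℚ - 1ℚ) ≡ q
          lem = solve-∀ ℚ-ring

      -- The 2 by 2 determinant by which the determinant grows when both items are inserted
      -- together. Unlike two successive insertions, it is visibly symmetric in the items.
      pairFactor : ℚ
      pairFactor = (1ℚ + c * B w w) * (1ℚ + e * B z z) - c * e * (B w z * B w z)

      pairForm : Form
      pairForm x y = B x y * pairFactor - c * B x w * B w y * (1ℚ + e * B z z)
        - e * B x z * B z y * (1ℚ + c * B w w) + c * e * B w z * (B x z * B w y + B x w * B z y)

      insert₂-factor : F₁ * F₂ ≡ pairFactor
      insert₂-factor = collapse pairFactor (- (c * e * (B w z * B w z))) (trans
        (cong (λ h → F₁ * (1ℚ + e * (B z z - c * i * h * B w z))) (symmetric G z w))
        (lem c e (B w w) (B z z) (B w z) i))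
        where
        lem : ∀ c e b g h i → (1ℚ + c * b) * (1ℚ + e * (g - c * i * h * h)) ≡
          ((1ℚ + c * b) * (1ℚ + e * g) - c * e * (h * h)) + - (c * e * (h * h)) * (i * (1ℚ + c * b) - 1ℚ)
        lem = solve-∀ ℚ-ring

      0<pairFactor : 0ℚ < pairFactor
      0<pairFactor = subst (0ℚ <_) insert₂-factor (0<* 0<F₁ 0<F₂)

      -- Denominators are cleared so that the two orders of insertion can be compared as
      -- polynomials.
      insert₂-form : ∀ x y → insert (e , z) B₁ x y * pairFactor ≡ pairForm x y
      insert₂-form x y = begin
        (B₁ x y - e * j * B₁ x z * B₁ z y) * pairFactor
          ≡⟨ cong ((B₁ x y - e * j * B₁ x z * B₁ z y) *_) insert₂-factor ⟨
        (B₁ x y - e * j * B₁ x z * B₁ z y) * (F₁ * F₂)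
          ≡⟨ lem₁ (B₁ x y) e j (B₁ x z) (B₁ z y) F₁ F₂ ⟩
        B₁ x y * (F₁ * F₂) - e * (j * F₂) * (B₁ x z * B₁ z y * F₁)
          ≡⟨ cong₂ (λ s t → B₁ x y * s - e * t * (B₁ x z * B₁ z y * F₁)) insert₂-factor jF₂≡1 ⟩
        B₁ x y * pairFactor - e * 1ℚ * (B₁ x z * B₁ z y * F₁)
          ≡⟨ cong (λ h → B₁ x y * pairFactor - e * 1ℚ * (B₁ x z * (B z y - c * i * h * B w y) * F₁)) (symmetric G z w) ⟩
        B₁ x y * pairFactor - e * 1ℚ * (B₁ x z * (B z y - c * i * B w z * B w y) * F₁)
          ≡⟨ collapse (pairForm x y)
               (- (c * B x w * B w y * (1ℚ + e * B z z)) + c * e * B w z * (B x z * B w y + B x w * B z y)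
                - c * c * e * i * B w z * B w z * B x w * B w y)
               (lem₂ (B x y) (B x w) (B w y) (B x z) (B z y) (B w w) (B z z) (B w z) c e i) ⟩
        pairForm x y ∎
        where
        open ≡-Reasoning
        lem₁ : ∀ a e j p q F G → (a - e * j * p * q) * (F * G) ≡ a * (F * G) - e * (j * G) * (p * q * F)
        lem₁ = solve-∀ ℚ-ring
        lem₂ : ∀ a xw wy xz zy b g h c e i →
          (a - c * i * xw * wy) * ((1ℚ + c * b) * (1ℚ + e * g) - c * e * (h * h))
          - e * 1ℚ * ((xz - c * i * xw * h) * (zy - c * i * h * wy) * (1ℚ + c * b))
          ≡ (a * ((1ℚ + c * b) * (1ℚ + e * g) - c * e * (h * h)) - c * xw * wy * (1ℚ + e * g)
             - e * xz * zy * (1ℚ + c * b) + c * e * h * (xz * wy + xw * zy))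
            + (- (c * xw * wy * (1ℚ + e * g)) + c * e * h * (xz * wy + xw * zy) - c * c * e * i * h * h * xw * wy)
              * (i * (1ℚ + c * b) - 1ℚ)
        lem₂ = solve-∀ ℚ-ring

    *-cancelʳ : ∀ {p q} r → 0ℚ < r → p * r ≡ q * r → p ≡ q
    *-cancelʳ {p} {q} r 0<r eq = trans (sym (undo p)) (trans (cong (_* inv r) eq) (undo q))
      where
      undo : ∀ p → p * r * inv r ≡ p
      undo p = trans (*-assoc p r (inv r))
        (trans (cong (p *_) (trans (*-comm r (inv r)) (inv-inverse 0<r))) (*-identityʳ p))

    module _ {items B} (G : Green items B) (a b : Item) (0≤a : 0ℚ ≤ proj₁ a) (0≤b : 0ℚ ≤ proj₁ b) where
      private
        c = proj₁ a
        w = proj₂ a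
        e = proj₁ b
        z = proj₂ b

        lem-factor : ∀ c e b g h → (1ℚ + c * b) * (1ℚ + e * g) - c * e * (h * h) ≡
                                   (1ℚ + e * g) * (1ℚ + c * b) - e * c * (h * h)
        lem-factor = solve-∀ ℚ-ring

        pairFactor-sym : pairFactor G c e w z 0≤a 0≤b ≡ pairFactor G e c z w 0≤b 0≤a
        pairFactor-sym = trans (lem-factor c e (B w w) (B z z) (B w z))
          (cong (λ h → (1ℚ + e * B z z) * (1ℚ + c * B w w) - e * c * (h * h)) (symmetric G w z))

        pairForm-sym : ∀ x y → pairForm G c e w z 0≤a 0≤b x y ≡ pairForm G e c z w 0≤b 0≤a x y
        pairForm-sym x y = trans
          (lem (B x y) (B x w) (B w y) (B x z) (B z y) (B w w) (B z z) (B w z) c e _)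
          (cong₂ (λ f h → B x y * f - e * B x z * B z y * (1ℚ + c * B w w)
                          - c * B x w * B w y * (1ℚ + e * B z z) + e * c * h * (B x w * B z y + B x z * B w y))
                 pairFactor-sym (symmetric G w z))
          where
          lem : ∀ a xw wy xz zy b g h c e f →
            a * f - c * xw * wy * (1ℚ + e * g) - e * xz * zy * (1ℚ + c * b) + c * e * h * (xz * wy + xw * zy) ≡
            a * f - e * xz * zy * (1ℚ + c * b) - c * xw * wy * (1ℚ + e * g) + e * c * h * (xw * zy + xz * wy)
          lem = solve-∀ ℚ-ring

      factor-swap : factor a B * factor b (insert a B) ≡ factor b B * factor a (insert b B)
      factor-swap = trans (insert₂-factor G c e w z 0≤a 0≤b)
        (trans pairFactor-sym (sym (insert₂-factor G e c z w 0≤b 0≤a)))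

      insert-swap : insert b (insert a B) ≐ insert a (insert b B)
      insert-swap x y = *-cancelʳ (pairFactor G c e w z 0≤a 0≤b) (0<pairFactor G c e w z 0≤a 0≤b)
        (trans (insert₂-form G c e w z 0≤a 0≤b x y)
        (trans (pairForm-sym x y)
        (trans (sym (insert₂-form G e c z w 0≤b 0≤a x y))
               (cong (insert a (insert b B) x y *_) (sym pairFactor-sym)))))

    NonNegWeights : List Item → Set
    NonNegWeights = All λ a → 0ℚ ≤ proj₁ a

    run-Green : ∀ {items B} as → NonNegWeights as → Green items B → Green (as ʳ++ items) (run as B)
    run-Green []             []         G = G
    run-Green ((c , w) ∷ as) (le ∷ les) G = run-Green as les (insert-Green G c w le)

    -- Independence of the order allows an item that is to be rescaled to be inserted last, and the
    -- edges to be inserted in the order of Kruskal's algorithm.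
    run-det-↭ : ∀ {as bs} → as ↭ bs → NonNegWeights as → ∀ {items B} → Green items B →
                run as B ≐ run bs B × det as B ≡ det bs B
    run-det-↭ Perm.refl nn G = (λ x y → refl) , refl
    run-det-↭ (Perm.prep a p) (le ∷ nn) {B = B} G with run-det-↭ p nn (insert-Green G _ _ le)
    ... | runs , dets = runs , cong (factor a B *_) dets
    run-det-↭ (Perm.swap {xs} {ys} a b p) (le₁ ∷ le₂ ∷ nn) {B = B} G
      with run-det-↭ p nn (insert-Green (insert-Green G _ _ le₁) _ _ le₂)
    ... | runs , dets =
      (λ x y → trans (runs x y) (run-cong ys (insert-swap G a b le₁ le₂) x y)) ,
      (begin
        factor a B * (factor b (insert a B) * det xs B₂) ≡⟨ *-assoc (factor a B) _ _ ⟨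
        factor a B * factor b (insert a B) * det xs B₂   ≡⟨ cong₂ _*_ (factor-swap G a b le₁ le₂)
                                                             (trans dets (det-cong ys (insert-swap G a b le₁ le₂))) ⟩
        factor b B * factor a (insert b B) * det ys B₂′  ≡⟨ *-assoc (factor b B) _ _ ⟩
        factor b B * (factor a (insert b B) * det ys B₂′) ∎)
      where
      open ≡-Reasoning
      B₂ = insert b (insert a B)
      B₂′ = insert a (insert b B)
    run-det-↭ (Perm.trans p q) nn G with run-det-↭ p nn G | run-det-↭ q (All-resp-↭ p nn) G
    ... | runs₁ , dets₁ | runs₂ , dets₂ = (λ x y → trans (runs₁ x y) (runs₂ x y)) , trans dets₁ dets₂

    1≤det : ∀ as {items B} → NonNegWeights as → Green items B → 1ℚ ≤ det as B
    1≤det []             []         G = ≤-refl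
    1≤det ((c , w) ∷ as) {B = B} (le ∷ nn) G = *-mono-≤ (<⇒≤ (positive⁻¹ 1ℚ)) (<⇒≤ (positive⁻¹ 1ℚ))
      (≤-by _ (0≤* le (0≤diagonal G w)) refl) (1≤det as nn (insert-Green G c w le))

    -- The determinant is affine in the weight of one item. Its logarithmic derivative is the
    -- effective resistance R in the network that contains the item, so changing c to c t multiplies
    -- it by exactly 1 - (1 - t) c R.
    det-rescale : ∀ as {items B} → NonNegWeights as → Green items B → ∀ c w t → 0ℚ ≤ c →
      det (as ++ [ (c * t , w) ]) B ≡
      det (as ++ [ (c , w) ]) B * (1ℚ - (1ℚ - t) * (c * run (as ++ [ (c , w) ]) B w w))
    det-rescale as {B = B} nn G c w t 0≤c = begin
      det (as ++ [ (c * t , w) ]) B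
        ≡⟨ det-++ as _ B ⟩
      det as B * ((1ℚ + c * t * b) * 1ℚ)
        ≡⟨ cong (det as B *_) inner ⟩
      det as B * ((1ℚ + c * b) * 1ℚ * (1ℚ - (1ℚ - t) * (c * (b - c * i * b * b))))
        ≡⟨ *-assoc (det as B) _ _ ⟨
      det as B * ((1ℚ + c * b) * 1ℚ) * (1ℚ - (1ℚ - t) * (c * (b - c * i * b * b)))
        ≡⟨ cong₂ (λ D (C : Form) → D * (1ℚ - (1ℚ - t) * (c * C w w))) (det-++ as _ B) (run-++ as _ B) ⟨
      det (as ++ [ (c , w) ]) B * (1ℚ - (1ℚ - t) * (c * run (as ++ [ (c , w) ]) B w w)) ∎
      where
      open ≡-Reasoning
      b = run as B w w
      i = inv (1ℚ + c * b)
      iF≡1 : i * (1ℚ + c * b) ≡ 1ℚ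
      iF≡1 = inv-inverse (0<factor (run-Green as nn G) (c , w) 0≤c)
      lem : ∀ c t b i → (1ℚ + c * b) * 1ℚ * (1ℚ - (1ℚ - t) * (c * (b - c * i * b * b))) ≡
        (1ℚ + c * t * b) * 1ℚ + (1ℚ - t) * c * c * b * b * (i * (1ℚ + c * b) - 1ℚ)
      lem = solve-∀ ℚ-ring
      vanish : ∀ q r → q + r * (1ℚ - 1ℚ) ≡ q
      vanish = solve-∀ ℚ-ring
      inner : (1ℚ + c * t * b) * 1ℚ ≡ (1ℚ + c * b) * 1ℚ * (1ℚ - (1ℚ - t) * (c * (b - c * i * b * b)))
      inner = sym (trans (lem c t b i)
        (trans (cong (λ z → (1ℚ + c * t * b) * 1ℚ + (1ℚ - t) * c * c * b * b * (z - 1ℚ)) iF≡1)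
               (vanish ((1ℚ + c * t * b) * 1ℚ) ((1ℚ - t) * c * c * b * b))))

    dot : Form
    dot x y = sum λ v → x v * y v

    sum-δ : ∀ {n} (f : Fin n → ℚ) v → sum (λ u → f u * (if does (u Fin.≟ v) then 1ℚ else 0ℚ)) ≡ f v
    sum-δ {suc n} f zero    = trans (cong₂ _+_ (*-identityʳ (f zero))
        (trans (sum-cong-≗ λ u → *-zeroʳ (f (suc u))) (trans (sum-const n 0ℚ) (*-zeroʳ (# n)))))
        (+-identityʳ (f zero))
    sum-δ {suc n} f (suc v) = trans (cong₂ _+_ (*-zeroʳ (f zero)) (sum-δ (f ∘ suc) v)) (+-identityˡ (f (suc v)))

    δ-sym : ∀ u v → δ u v ≡ δ v u
    δ-sym u v with u Fin.≟ v | v Fin.≟ u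
    ... | yes _ | yes _ = refl
    ... | no _  | no _  = refl
    ... | yes p | no ¬p = ⊥-elim (¬p (sym p))
    ... | no ¬p | yes p = ⊥-elim (¬p (sym p))

    dot-δ : ∀ x v → dot x (δ v) ≡ x v
    dot-δ x v = trans (sum-cong-≗ λ u → cong (x u *_) (δ-sym v u)) (sum-δ x v)

    dot-Green : Green [] dot
    nonneg dot-Green = []
    symmetric dot-Green x y = sum-cong-≗ λ v → *-comm (x v) (y v)
    expand dot-Green x y = sum-cong-≗ λ v → trans (*-comm (x v) (y v)) (cong (y v *_) (sym (dot-δ x v)))
    energy dot-Green x y = trans
      (sum-cong-≗ λ v → cong₂ _*_ (sym (dot-δ x v)) (sym (dot-δ y v))) (sym (+-identityʳ _))
    current dot-Green x v = trans (sym (dot-δ x v)) (sym (+-identityʳ _))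

    -- Rayleigh monotonicity: each insertion subtracts a nonnegative multiple of a square. Hence a
    -- factor of the determinant is largest when its item comes first.
    diagonal-decreasing : ∀ as {items B} → NonNegWeights as → Green items B → ∀ x → run as B x x ≤ B x x
    diagonal-decreasing []                      nn        G x = ≤-refl
    diagonal-decreasing ((c , w) ∷ as) {B = B} (le ∷ nn) G x = ≤-trans
      (diagonal-decreasing as nn (insert-Green G c w le) x)
      (≤-by (c * inv (1ℚ + c * B w w) * (B x w * B x w))
        (0≤* (0≤* le (<⇒≤ (0<inv (0<factor G (c , w) le)))) (0≤p² (B x w)))
        (trans (lem (B x x) (c * inv (1ℚ + c * B w w)) (B x w))
          (cong (λ q → B x x - c * inv (1ℚ + c * B w w) * B x w * q + c * inv (1ℚ + c * B w w) * (B x w * B x w))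
                (symmetric G x w))))
      where
      lem : ∀ a l p → a ≡ a - l * p * p + l * (p * p)
      lem = solve-∀ ℚ-ring

    det-upper : ∀ as {items B} M → 0ℚ ≤ M → NonNegWeights as → Green items B →
                All (λ a → factor a B ≤ M) as → det as B ≤ M ^ length as
    det-upper []             M 0≤M nn        G []         = ≤-refl
    det-upper ((c , w) ∷ as) {B = B} M 0≤M (le ∷ nn) G (fac ∷ facs) = *-mono-≤
      (<⇒≤ (0<factor G (c , w) le)) (≤-trans (<⇒≤ (positive⁻¹ 1ℚ)) (1≤det as nn G₁)) fac
      (det-upper as M 0≤M nn G₁ (go as nn facs))
      where
      G₁ = insert-Green G c w le
      go : ∀ as → NonNegWeights as → All (λ a → factor a B ≤ M) as →
           All (λ a → factor a (insert (c , w) B) ≤ M) as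
      go []             []        []         = []
      go ((e , z) ∷ as) (0≤e ∷ ns) (f ∷ fs) =
        ≤-trans (+-monoʳ-≤ 1ℚ (*-monoˡ-≤-nonNeg e {{nonNegative 0≤e}}
                  (diagonal-decreasing ((c , w) ∷ []) (le ∷ []) G z))) f ∷ go as ns fs

    -- Cauchy-Schwarz for B x x = Σ x v · B x (δ v), in the form of a completed square. Under the
    -- hypothesis, the square of B x x is at most |x|² · B x x / κ.
    scaled-norm : ∀ {items B} → Green items B → ∀ κ → 0ℚ < κ → ∀ x →
      κ * sum (λ v → B x (δ v) * B x (δ v)) ≤ B x x → κ * B x x ≤ sum (λ v → x v * x v)
    scaled-norm {B = B} G κ 0<κ x dom = ≤-by
        (κ * (B x x - κ * S) + κ * (κ * sum (λ v → (B x (δ v) - inv κ * x v) * (B x (δ v) - inv κ * x v))))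
        (0≤+ (0≤* 0≤κ (0≤q-p dom)) (0≤* 0≤κ (0≤* 0≤κ (0≤sum-² λ v → B x (δ v) - inv κ * x v))))
        (sym (trans
          (cong (λ q → κ * B x x + (κ * (B x x - κ * S) + κ * (κ * q)))
            (trans (sum-square (inv κ) (λ v → B x (δ v)) x)
                   (cong (λ b → S - (inv κ + inv κ) * b + inv κ * inv κ * T) (sym (expand G x x)))))
          (trans (lem κ (inv κ) (B x x) S T)
          (trans (cong (λ o → κ * B x x + (κ * (B x x - κ * S) + (κ * (κ * S) - (o + o) * (κ * B x x) + o * o * T))) (inv-inverse 0<κ))
                 (lem₂ κ (B x x) S T)))))
      where
      0≤κ = <⇒≤ 0<κ
      S = sum (λ v → B x (δ v) * B x (δ v))
      T = sum (λ v → x v * x v)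
      lem : ∀ κ i b S T → κ * b + (κ * (b - κ * S) + κ * (κ * (S - (i + i) * b + i * i * T))) ≡
        κ * b + (κ * (b - κ * S) + (κ * (κ * S) - (i * κ + i * κ) * (κ * b) + (i * κ) * (i * κ) * T))
      lem = solve-∀ ℚ-ring
      lem₂ : ∀ κ b S T → κ * b + (κ * (b - κ * S) + (κ * (κ * S) - (1ℚ + 1ℚ) * (κ * b) + 1ℚ * 1ℚ * T)) ≡ T
      lem₂ = solve-∀ ℚ-ring

    -- Again Cauchy-Schwarz: 1 = (Σ Y v · B x (δ v))² ≤ d · Σ (B x (δ v))² ≤ d · B x x. The proof
    -- completes the square with coefficient ν · B x Y, which avoids square roots and division by d.
    cut-resistance : ∀ {items B} → Green items B → ∀ ν → 0ℚ ≤ ν → ν * # d ≤ 1ℚ → ∀ x (Y : Fin d → ℚ) →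
      (∀ v → Y v * Y v ≤ 1ℚ) → B x Y * B x Y ≡ 1ℚ → ν ≤ B x x
    cut-resistance {B = B} G ν 0≤ν νd≤1 x Y Y²≤1 ε²≡1 = ≤-by
        ((B x x - S) + (sum (λ v → (B x (δ v) - t * Y v) * (B x (δ v) - t * Y v))
          + (ν * (1ℚ - ν * # d) + ν * ν * (# d - T))))
        (0≤+ (0≤q-p (squares≤ G x)) (0≤+ (0≤sum-² λ v → B x (δ v) - t * Y v)
          (0≤+ (0≤* 0≤ν (0≤q-p νd≤1)) (0≤* (0≤* 0≤ν 0≤ν) (0≤q-p T≤d)))))
        (sym (trans (cong (λ q → ν + ((B x x - S) + (q + (ν * (1ℚ - ν * # d) + ν * ν * (# d - T)))))
               (trans (sum-square t (λ v → B x (δ v)) Y) (cong (λ b → S - (t + t) * b + t * t * T) (sym (expand G x Y)))))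
          (trans (lem ν ε (B x x) S T (# d))
          (trans (cong (λ o → ν + ((B x x - S) + ((S - (ν + ν) * o + ν * ν * o * T) + (ν * (1ℚ - ν * # d) + ν * ν * (# d - T))))) ε²≡1)
                 (lem₂ ν (B x x) S T (# d))))))
      where
      ε = B x Y
      t = ν * ε
      S = sum (λ v → B x (δ v) * B x (δ v))
      T = sum (λ v → Y v * Y v)
      T≤d : T ≤ # d
      T≤d = subst (T ≤_) (trans (sum-const d 1ℚ) (*-identityʳ (# d))) (sum-mono (λ v → Y v * Y v) (λ _ → 1ℚ) Y²≤1)
      lem : ∀ ν ε b S T d → ν + ((b - S) + ((S - (ν * ε + ν * ε) * ε + (ν * ε) * (ν * ε) * T) + (ν * (1ℚ - ν * d) + ν * ν * (d - T)))) ≡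
        ν + ((b - S) + ((S - (ν + ν) * (ε * ε) + ν * ν * (ε * ε) * T) + (ν * (1ℚ - ν * d) + ν * ν * (d - T))))
      lem = solve-∀ ℚ-ring
      lem₂ : ∀ ν b S T d → ν + ((b - S) + ((S - (ν + ν) * 1ℚ + ν * ν * 1ℚ * T) + (ν * (1ℚ - ν * d) + ν * ν * (d - T)))) ≡ b
      lem₂ = solve-∀ ℚ-ring

  product : List ℚ → ℚ
  product []       = 1ℚ
  product (p ∷ ps) = p * product ps

  product-split : ∀ {A : Set} ν s (h : A → ℕ) es →
    product (map (λ e → ν * s ^ h e) es) ≡ ν ^ length es * s ^ sumˡ (map h es)
  product-split ν s h []       = sym (*-identityˡ 1ℚ)
  product-split ν s h (e ∷ es) = trans (cong (ν * s ^ h e *_) (product-split ν s h es))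
    (trans (lem ν (s ^ h e) (ν ^ length es) _)
           (cong (ν * ν ^ length es *_) (sym (^-homo-* s (h e) (sumˡ (map h es))))))
    where
    lem : ∀ ν p q r → ν * p * (q * r) ≡ ν * q * (p * r)
    lem = solve-∀ ℚ-ring

  -- A spanning tree bounds the determinant from below.

  module TreeBound {d m : ℕ} (z : Fin (suc d)) (ends : Fin m → Fin (suc d) × Fin (suc d)) where
    open Network d
    open Green

    private
      n = suc d

    -- The coordinate of z is dropped: z is the grounded vertex.
    edgeVector : Fin m → Fin d → ℤ
    edgeVector e v = V.boundary (ends e) (punchIn z v)

    edge : Fin m → Vector
    edge e v = ι (edgeVector e v)

    private
      restrict : (Fin n → Bool) → Vector
      restrict Y v = indicator (Y (punchIn z v))

      ι-δ : ∀ {n} (u v : Fin n) → ι (V.δ u v) ≡ indicator (does (u Fin.≟ v))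
      ι-δ u v with does (u Fin.≟ v)
      ... | true  = ι-1
      ... | false = ι-0

      does-punchIn : ∀ v w → does (punchIn z w Fin.≟ punchIn z v) ≡ does (v Fin.≟ w)
      does-punchIn v w with v Fin.≟ w | punchIn z w Fin.≟ punchIn z v
      ... | yes _   | yes _ = refl
      ... | no  _   | no _  = refl
      ... | yes v≡w | no ne = ⊥-elim (ne (cong (punchIn z) (sym v≡w)))
      ... | no  v≢w | yes e = ⊥-elim (v≢w (sym (Fin.punchIn-injective z w v e)))

      does-z : ∀ v → does (z Fin.≟ punchIn z v) ≡ false
      does-z v with z Fin.≟ punchIn z v
      ... | yes e = ⊥-elim (Fin.punchInᵢ≢i z v (sym e))
      ... | no _  = refl

      pick : ∀ Y → Y z ≡ false → ∀ u →
             sum (λ v → ι (V.δ u (punchIn z v)) * restrict Y v) ≡ indicator (Y u)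
      pick Y Yz u with z Fin.≟ u
      ... | yes refl = trans (sum-cong-≗ λ v → trans
                           (cong (_* restrict Y v) (trans (ι-δ z (punchIn z v)) (cong indicator (does-z v))))
                           (*-zeroˡ (restrict Y v)))
                         (trans (sum-const d 0ℚ) (trans (*-zeroʳ (# d)) (cong indicator (sym Yz))))
      ... | no z≢u = subst (λ u → sum (λ v → ι (V.δ u (punchIn z v)) * restrict Y v) ≡ indicator (Y u))
                       (Fin.punchIn-punchOut z≢u)
                       (trans (sum-cong-≗ λ v → trans (*-comm _ (restrict Y v))
                                 (cong (restrict Y v *_) (trans (ι-δ (punchIn z v₀) (punchIn z v))
                                                                (cong indicator (does-punchIn v v₀)))))
                              (sum-δ (restrict Y) v₀))
        where v₀ = punchOut z≢u

      cut : ∀ Y → Y z ≡ false → ∀ e →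
            dot (edge e) (restrict Y) ≡ indicator (Y (proj₁ (ends e))) - indicator (Y (proj₂ (ends e)))
      cut Y Yz e = trans (sum-cong-≗ λ v → trans (cong (_* restrict Y v) (split v))
                            (lem (ι (V.δ u (punchIn z v))) (ι (V.δ w (punchIn z v))) (restrict Y v)))
        (trans (sum-linear 1ℚ (λ v → ι (V.δ u (punchIn z v)) * restrict Y v) (λ v → ι (V.δ w (punchIn z v)) * restrict Y v))
          (cong₂ _-_ (pick Y Yz u) (trans (*-identityˡ _) (pick Y Yz w))))
        where
        u = proj₁ (ends e)
        w = proj₂ (ends e)
        split : ∀ v → edge e v ≡ ι (V.δ u (punchIn z v)) - ι (V.δ w (punchIn z v))
        split v = trans (ι-+ (V.δ u (punchIn z v)) (ℤ.- V.δ w (punchIn z v)))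
                        (cong (ι (V.δ u (punchIn z v)) +_) (ι-neg (V.δ w (punchIn z v))))
        lem : ∀ a b y → (a - b) * y ≡ a * y - 1ℚ * (b * y)
        lem = solve-∀ ℚ-ring

    -- The items inserted so far join only vertices with equal labels.
    Respects : (Fin n → Fin n) → Form → Set
    Respects π B = ∀ Y → Y z ≡ false → (∀ v w → π v ≡ π w → Y v ≡ Y w) →
                   ∀ x → B x (restrict Y) ≡ dot x (restrict Y)

    dot-Respects : ∀ π → Respects π dot
    dot-Respects π Y Yz sat x = refl

    private
      -- An edge inside a block is orthogonal to the indicator of any union of blocks, so the
      -- correction term of `insert` vanishes on that indicator.
      insert-Respects : ∀ {π π′ B} c e → (∀ v w → π v ≡ π w → π′ v ≡ π′ w) →
        π′ (proj₁ (ends e)) ≡ π′ (proj₂ (ends e)) → Respects π B → Respects π′ (insert (c , edge e) B)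
      insert-Respects {B = B} c e coarser joined resp Y Yz sat x =
        trans (cong₂ (λ p q → p - l * q) (resp Y Yz sat′ x)
                 (trans (resp Y Yz sat′ (edge e)) (trans (cut Y Yz e) Yu-Yw≡0)))
              (lem (dot x (restrict Y)) l)
        where
        l = c * inv (1ℚ + c * B (edge e) (edge e)) * B x (edge e)
        sat′ : ∀ v w → _ → Y v ≡ Y w
        sat′ v w eq = sat v w (coarser v w eq)
        Yu-Yw≡0 : indicator (Y (proj₁ (ends e))) - indicator (Y (proj₂ (ends e))) ≡ 0ℚ
        Yu-Yw≡0 = trans (cong (λ b → indicator b - indicator (Y (proj₂ (ends e)))) (sat _ _ joined))
                        (+-inverseʳ (indicator (Y (proj₂ (ends e)))))
        lem : ∀ p l → p - l * 0ℚ ≡ p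
        lem = solve-∀ ℚ-ring

      -- One of the blocks of the two ends misses `z`. Its indicator Y meets only the unit auxiliary
      -- edges, hence B (edge e) Y = dot (edge e) Y = ± 1, and `cut-resistance` bounds the
      -- resistance of the new edge by ν from below.
      bridge-factor : ∀ {items π B} → Green items B → Respects π B → ∀ ν → 0ℚ ≤ ν → ν * # d ≤ 1ℚ → ∀ c → 0ℚ ≤ c →
        ∀ e → π (proj₁ (ends e)) ≢ π (proj₂ (ends e)) → ν * c ≤ factor (c , edge e) B
      bridge-factor {π = π} {B} G resp ν 0≤ν νd≤1 c 0≤c e πu≢πw = ≤-trans
        (subst (_≤ c * B (edge e) (edge e)) (*-comm c ν)
          (*-monoˡ-≤-nonNeg c {{nonNegative 0≤c}} (bound (π z Fin.≟ π u))))
        (≤-by 1ℚ (<⇒≤ (positive⁻¹ 1ℚ)) (+-comm 1ℚ (c * B (edge e) (edge e))))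
        where
        u = proj₁ (ends e)
        w = proj₂ (ends e)
        class : Fin n → Fin n → Bool
        class a v = does (π v Fin.≟ π a)
        saturated : ∀ a v v′ → π v ≡ π v′ → class a v ≡ class a v′
        saturated a v v′ eq = cong (λ l → does (l Fin.≟ π a)) eq
        idempotent : ∀ b → indicator b * indicator b ≤ 1ℚ
        idempotent true  = ≤-refl
        idempotent false = <⇒≤ (positive⁻¹ 1ℚ)
        same : ∀ {a b} → π a ≡ π b → class b a ≡ true
        same {a} {b} eq with π a Fin.≟ π b
        ... | yes _ = refl
        ... | no ne = ⊥-elim (ne eq)
        differ : ∀ {a b} → π a ≢ π b → class b a ≡ false
        differ {a} {b} ne with π a Fin.≟ π b
        ... | yes eq = ⊥-elim (ne eq)
        ... | no _   = refl
        through : ∀ a → class a z ≡ false → (indicator (class a u) - indicator (class a w)) *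
                  (indicator (class a u) - indicator (class a w)) ≡ 1ℚ → ν ≤ B (edge e) (edge e)
        through a az ε² = cut-resistance G ν 0≤ν νd≤1 (edge e) (restrict (class a))
          (λ v → idempotent (class a (punchIn z v)))
          (trans (cong (λ p → p * p) (trans (resp (class a) az (saturated a) (edge e)) (cut (class a) az e))) ε²)
        bound : Dec (π z ≡ π u) → ν ≤ B (edge e) (edge e)
        bound (no πz≢πu) = through u (differ πz≢πu)
          (cong₂ (λ a b → (indicator a - indicator b) * (indicator a - indicator b)) (same refl) (differ (πu≢πw ∘ sym)))
        bound (yes πz≡πu) = through w (differ λ eq → πu≢πw (trans (sym πz≡πu) eq))
          (cong₂ (λ a b → (indicator a - indicator b) * (indicator a - indicator b)) (differ πu≢πw) (same refl))

    -- An edge chosen by Kruskal's algorithm contributes a factor of at least ν c, and any other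
    -- edge a factor of at least 1.
    det-lower : ∀ ν → 0ℚ ≤ ν → ν * # d ≤ 1ℚ → ∀ (c : Fin m → ℚ) → (∀ e → 0ℚ ≤ c e) →
      ∀ es π {items B} → Green items B → Respects π B →
      product (map (λ e → ν * c e) (kruskal ends π es)) ≤ det (map (λ e → c e , edge e) es) B
    det-lower ν 0≤ν νd≤1 c 0≤c [] π G resp = ≤-refl
    det-lower ν 0≤ν νd≤1 c 0≤c (e ∷ es) π {B = B} G resp
      with π (proj₁ (ends e)) Fin.≟ π (proj₂ (ends e))
    ... | yes joined = ≤-trans
      (det-lower ν 0≤ν νd≤1 c 0≤c es π G₁ (insert-Respects {π} {π} {B} (c e) e (λ _ _ eq → eq) joined resp))
      (subst (_≤ factor (c e , edge e) B * D) (*-identityˡ D)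
        (*-monoʳ-≤-nonNeg D {{nonNegative 0≤D}} (≤-by {1ℚ} _ (0≤* (0≤c e) (0≤diagonal G (edge e))) refl)))
      where
      G₁ = insert-Green G (c e) (edge e) (0≤c e)
      D = det (map (λ e → c e , edge e) es) (insert (c e , edge e) B)
      weights : ∀ es → NonNegWeights (map (λ e → c e , edge e) es)
      weights []       = []
      weights (e ∷ es) = 0≤c e ∷ weights es
      0≤D : 0ℚ ≤ D
      0≤D = ≤-trans (<⇒≤ (positive⁻¹ 1ℚ)) (1≤det _ (weights es) G₁)
    ... | no split = *-mono-≤ (0≤* 0≤ν (0≤c e)) (0≤product (kruskal ends π′ es))
      (bridge-factor G resp ν 0≤ν νd≤1 (c e) (0≤c e) e split)
      (det-lower ν 0≤ν νd≤1 c 0≤c es π′ G₁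
        (insert-Respects {π} {π′} {B} (c e) e (λ _ _ → merge-coarser π _ _) (merge-joins π _ _) resp))
      where
      π′ = merge π (proj₁ (ends e)) (proj₂ (ends e))
      G₁ = insert-Green G (c e) (edge e) (0≤c e)
      0≤product : ∀ es → 0ℚ ≤ product (map (λ e → ν * c e) es)
      0≤product []       = <⇒≤ (positive⁻¹ 1ℚ)
      0≤product (e ∷ es) = 0≤* (0≤* 0≤ν (0≤c e)) (0≤product es)

  -- The constants of the descent.

  module Constants (k′ d : ℕ) where

    k = suc k′
    n = suc d

    -- A step multiplies a conductance by 1 - u = 1 / s, where u = 1 / (2 k n). The threshold θ = 1
    -- / (2 n) makes the two auxiliary currents at a vertex at most 1 / n together. If k c R is at
    -- least 1 for an edge, or at least θ for an auxiliary edge, a step multiplies the determinant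
    -- by at most `x` or `ζ`, respectively.
    κ a θ u ν s ζ x : ℚ
    κ = # k
    a = inv κ
    ν = inv (# n)
    θ = inv (1ℚ + 1ℚ) * ν
    u = a * θ
    s = inv (1ℚ - u)
    ζ = 1ℚ - u * (a * θ)
    x = 1ℚ - u * a

    0<κ : 0ℚ < κ
    0<κ = 0<#suc k′

    0<2 : 0ℚ < 1ℚ + 1ℚ
    0<2 = 0<1+ 0≤1

    1≤#suc : ∀ n → 1ℚ ≤ # (suc n)
    1≤#suc n = subst (_≤ # (suc n)) ι-1 (#-mono (ℕ.s≤s (ℕ.z≤n {n})))

    aκ≡1 : a * κ ≡ 1ℚ
    aκ≡1 = inv-inverse 0<κ

    νn≡1 : ν * # n ≡ 1ℚ
    νn≡1 = inv-inverse (0<#suc d)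

    0<a : 0ℚ < a
    0<a = 0<inv 0<κ

    a≤1 : a ≤ 1ℚ
    a≤1 = inv≤1 (1≤#suc k′)

    0<ν : 0ℚ < ν
    0<ν = 0<inv (0<#suc d)

    ν≤1 : ν ≤ 1ℚ
    ν≤1 = inv≤1 (1≤#suc d)

    νd≤1 : ν * # d ≤ 1ℚ
    νd≤1 = subst (ν * # d ≤_) νn≡1 (*-monoˡ-≤-nonNeg ν {{nonNegative (<⇒≤ 0<ν)}} (#-mono (ℕₚ.n≤1+n d)))

    0<θ : 0ℚ < θ
    0<θ = 0<* (0<inv 0<2) 0<ν

    θ+θ≡ν : θ + θ ≡ ν
    θ+θ≡ν = trans (lem (inv (1ℚ + 1ℚ)) ν) (trans (cong (_* ν) (inv-inverse 0<2)) (*-identityˡ ν))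
      where
      lem : ∀ i ν → i * ν + i * ν ≡ i * (1ℚ + 1ℚ) * ν
      lem = solve-∀ ℚ-ring

    θ+θ≤1 : θ + θ ≤ 1ℚ
    θ+θ≤1 = subst (_≤ 1ℚ) (sym θ+θ≡ν) ν≤1

    θ<1 : θ < 1ℚ
    θ<1 = <-≤-trans (subst (_< θ + θ) (+-identityʳ θ) (+-monoʳ-< θ 0<θ)) θ+θ≤1

    0<u : 0ℚ < u
    0<u = 0<* 0<a 0<θ

    u<1 : u < 1ℚ
    u<1 = ≤-<-trans (subst (u ≤_) (*-identityˡ θ) (*-monoʳ-≤-nonNeg θ {{nonNegative (<⇒≤ 0<θ)}} a≤1)) θ<1

    0<1-u : 0ℚ < 1ℚ - u
    0<1-u = subst (_< 1ℚ - u) (+-inverseʳ u) (+-monoˡ-< (- u) u<1)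

    s*[1-u]≡1 : s * (1ℚ - u) ≡ 1ℚ
    s*[1-u]≡1 = inv-inverse 0<1-u

    0<s : 0ℚ < s
    0<s = 0<inv 0<1-u

    1≤s : 1ℚ ≤ s
    1≤s = subst₂ _≤_ s*[1-u]≡1 (*-identityʳ s)
      (*-monoˡ-≤-nonNeg s {{nonNegative (<⇒≤ 0<s)}} (≤-by u (<⇒≤ 0<u) (lem u)))
      where
      lem : ∀ u → 1ℚ ≡ 1ℚ - u + u
      lem = solve-∀ ℚ-ring

    0<uaθ : 0ℚ < u * (a * θ)
    0<uaθ = 0<* 0<u 0<u

    uaθ<1 : u * (a * θ) < 1ℚ
    uaθ<1 = ≤-<-trans (subst (u * u ≤_) (*-identityʳ u) (*-monoˡ-≤-nonNeg u {{nonNegative (<⇒≤ 0<u)}} (<⇒≤ u<1))) u<1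

    0<ζ : 0ℚ < ζ
    0<ζ = subst (_< ζ) (+-inverseʳ (u * (a * θ))) (+-monoˡ-< (- (u * (a * θ))) uaθ<1)

    ζ≤1 : ζ ≤ 1ℚ
    ζ≤1 = ≤-by (u * (a * θ)) (<⇒≤ 0<uaθ) (lem (u * (a * θ)))
      where
      lem : ∀ u → 1ℚ ≡ 1ℚ - u + u
      lem = solve-∀ ℚ-ring

    ua≤1 : u * a ≤ 1ℚ
    ua≤1 = ≤-trans (*-mono-≤ (<⇒≤ 0<u) (<⇒≤ 0<a) (<⇒≤ u<1) a≤1) (≤-reflexive (*-identityˡ 1ℚ))

    0≤x : 0ℚ ≤ x
    0≤x = 0≤q-p ua≤1

    ζ-power : ∀ N → ζ ^ suc N ≤ ζ
    ζ-power N = subst (ζ ^ suc N ≤_) (*-identityʳ ζ)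
      (*-monoˡ-≤-nonNeg ζ {{nonNegative (<⇒≤ 0<ζ)}} (^≤1 N (<⇒≤ 0<ζ) ζ≤1))

    -- x^k s ≤ 1 / (1 - u²), and the d-th power of the right-hand side is at most 1 / (1 - d u²).
    x-power : x ^ (k ℕ.* d ℕ.+ 1) * s ^ d ≤ ζ
    x-power = begin
      x ^ (k ℕ.* d ℕ.+ 1) * s ^ d                        ≡⟨ cong (_* s ^ d) (^-homo-* x (k ℕ.* d) 1) ⟩
      x ^ (k ℕ.* d) * (x * 1ℚ) * s ^ d                   ≡⟨ cong (λ p → p * (x * 1ℚ) * s ^ d) (^-assocʳ x k d) ⟨
      (x ^ k) ^ d * (x * 1ℚ) * s ^ d                     ≡⟨ lem₁ ((x ^ k) ^ d) x (s ^ d) ⟩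
      x * ((x ^ k) ^ d * s ^ d)                          ≡⟨ cong (x *_) (^-distrib-* (x ^ k) s d) ⟨
      x * y ^ d                                          ≤⟨ *-monoʳ-≤-nonNeg (y ^ d) {{nonNegative 0≤y^d}} x≤ ⟩
      ζ * (1ℚ - # d * (u * u)) * y ^ d                   ≡⟨ *-assoc ζ _ _ ⟩
      ζ * ((1ℚ - # d * (u * u)) * y ^ d)
        ≤⟨ *-monoˡ-≤-nonNeg ζ {{nonNegative (<⇒≤ 0<ζ)}} (*-monoʳ-≤-nonNeg (y ^ d) {{nonNegative 0≤y^d}} (bernoulli⁻ d (0≤p² u) u²≤1)) ⟩
      ζ * ((1ℚ - u * u) ^ d * y ^ d)                     ≡⟨ cong (ζ *_) (^-distrib-* (1ℚ - u * u) y d) ⟨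
      ζ * ((1ℚ - u * u) * y) ^ d
        ≤⟨ *-monoˡ-≤-nonNeg ζ {{nonNegative (<⇒≤ 0<ζ)}} (^≤1 d (0≤* (0≤q-p u²≤1) 0≤y) y-bound) ⟩
      ζ * 1ℚ                                             ≡⟨ *-identityʳ ζ ⟩
      ζ ∎
      where
      open ≤-Reasoning
      y = x ^ k * s
      0≤y : 0ℚ ≤ y
      0≤y = 0≤* (0≤^ k 0≤x) (<⇒≤ 0<s)
      0≤y^d : 0ℚ ≤ y ^ d
      0≤y^d = 0≤^ d 0≤y
      u²≤1 : u * u ≤ 1ℚ
      u²≤1 = <⇒≤ uaθ<1
      lem₁ : ∀ p x s → p * (x * 1ℚ) * s ≡ x * (p * s)
      lem₁ = solve-∀ ℚ-ring
      y-bound : (1ℚ - u * u) * y ≤ 1ℚ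
      y-bound = subst (_≤ 1ℚ)
        (trans (cong (λ p → x ^ k * (1ℚ + p)) kua≡u) (sym (trans (lem₂ u (x ^ k) s)
          (trans (cong (λ o → x ^ k * (1ℚ + u) * o) s*[1-u]≡1) (*-identityʳ _)))))
        (power-decay k (0≤* (<⇒≤ 0<u) (<⇒≤ 0<a)) ua≤1)
        where
        kua≡u : # k * (u * a) ≡ u
        kua≡u = trans (lem κ u a) (trans (cong (u *_) aκ≡1) (*-identityʳ u))
          where
          lem : ∀ κ u a → κ * (u * a) ≡ u * (a * κ)
          lem = solve-∀ ℚ-ring
        lem₂ : ∀ u p s → (1ℚ - u * u) * (p * s) ≡ p * (1ℚ + u) * (s * (1ℚ - u))
        lem₂ = solve-∀ ℚ-ring
      -- The choice of u is made for this bound: d u ≤ a / 2, so in `x≤` the term u a outweighs u a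
      -- θ and d u² together.
      du≤ : # d * u ≤ a * (1ℚ - θ)
      du≤ = begin
        # d * u                       ≡⟨ lem (# d) a (inv (1ℚ + 1ℚ)) ν ⟩
        a * (inv (1ℚ + 1ℚ) * (ν * # d)) ≤⟨ *-monoˡ-≤-nonNeg a {{nonNegative (<⇒≤ 0<a)}}
                                            (*-monoˡ-≤-nonNeg (inv (1ℚ + 1ℚ)) {{nonNegative (<⇒≤ (0<inv 0<2))}} νd≤1) ⟩
        a * (inv (1ℚ + 1ℚ) * 1ℚ)       ≤⟨ *-monoˡ-≤-nonNeg a {{nonNegative (<⇒≤ 0<a)}} half≤ ⟩
        a * (1ℚ - θ) ∎
        where
        lem : ∀ d a i ν → d * (a * (i * ν)) ≡ a * (i * (ν * d))
        lem = solve-∀ ℚ-ring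
        half : inv (1ℚ + 1ℚ) + inv (1ℚ + 1ℚ) ≡ 1ℚ
        half = trans (lem₃ (inv (1ℚ + 1ℚ))) (inv-inverse 0<2)
          where
          lem₃ : ∀ i → i + i ≡ i * (1ℚ + 1ℚ)
          lem₃ = solve-∀ ℚ-ring
        half≤ : inv (1ℚ + 1ℚ) * 1ℚ ≤ 1ℚ - θ
        half≤ = ≤-by (inv (1ℚ + 1ℚ) * (1ℚ - ν)) (0≤* (<⇒≤ (0<inv 0<2)) (0≤q-p ν≤1))
          (trans (cong (_- θ) (sym half)) (lem₄ (inv (1ℚ + 1ℚ)) ν))
          where
          lem₄ : ∀ i ν → i + i - i * ν ≡ i * 1ℚ + i * (1ℚ - ν)
          lem₄ = solve-∀ ℚ-ring
      x≤ : x ≤ ζ * (1ℚ - # d * (u * u))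
      x≤ = ≤-by (u * (a * (1ℚ - θ) - # d * u) + # d * (u * u) * (u * (a * θ)))
        (0≤+ (0≤* (<⇒≤ 0<u) (0≤q-p du≤)) (0≤* (0≤* (0≤# d) (0≤p² u)) (<⇒≤ 0<uaθ)))
        (lem (# d) u a θ)
        where
        lem : ∀ d u a θ → (1ℚ - u * (a * θ)) * (1ℚ - d * (u * u)) ≡
          1ℚ - u * a + (u * (a * (1ℚ - θ) - d * u) + d * (u * u) * (u * (a * θ)))
        lem = solve-∀ ℚ-ring

  -- Lowering conductances until no edge is overloaded.

  module Reweighting (k′ : ℕ) {d m : ℕ} (z : Fin (suc d)) (ends : Fin m → Fin (suc d) × Fin (suc d))
                     (dense : Dense ends (suc k′)) where
    open Network d
    open Green
    open TreeBound z ends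
    open Constants k′ d

    -- `inj₁` stands for the edges of the graph and `inj₂` for the adjustable auxiliary edges. The
    -- auxiliary edges of conductance 1 are the identity form `dot` with which `run` starts.
    Index : Set
    Index = Fin m ⊎ Fin d

    vec : Index → Vector
    vec (inj₁ e) = edge e
    vec (inj₂ v) = δ v

    -- Edges may carry a unit of current, the auxiliary edges to the ground only a little.
    threshold : Index → ℚ
    threshold (inj₁ e) = 1ℚ
    threshold (inj₂ v) = θ

    indices : List Index
    indices = map inj₂ (allFin d) ++ map inj₁ (allFin m)

    items : (Index → ℕ) → List Index → List Item
    items h is = map (λ i → s ^ h i , vec i) is

    private
      asum-tabulate : ∀ {n} f (g : Fin n → Item) → asum f (tabulate g) ≡ sum (f ∘ g)
      asum-tabulate {zero}  f g = refl
      asum-tabulate {suc n} f g = cong (f (g zero) +_) (asum-tabulate f (g ∘ suc))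

      asum-items : ∀ {n} f h (g : Fin n → Index) → asum f (items h (map g (allFin n))) ≡ sum (λ i → f (s ^ h (g i) , vec (g i)))
      asum-items {n} f h g = trans
        (cong (asum f) (trans (sym (map-∘ (allFin n))) (map-tabulate (λ v → v) (λ i → s ^ h (g i) , vec (g i)))))
        (asum-tabulate f (λ i → s ^ h (g i) , vec (g i)))

    asum-indices : ∀ f h → asum f (items h indices ʳ++ []) ≡
      sum (λ v → f (s ^ h (inj₂ v) , δ v)) + sum (λ e → f (s ^ h (inj₁ e) , edge e))
    asum-indices f h = trans (asum-ʳ++ f (items h indices) []) (trans (+-identityʳ _)
      (trans (cong (asum f) (map-++ (λ i → s ^ h i , vec i) (map inj₂ (allFin d)) (map inj₁ (allFin m))))
      (trans (asum-++ f (items h (map inj₂ (allFin d))) _) (cong₂ _+_ (asum-items f h inj₂) (asum-items f h inj₁)))))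
      where
      asum-++ : ∀ f as bs → asum f (as ++ bs) ≡ asum f as + asum f bs
      asum-++ f []       bs = sym (+-identityˡ _)
      asum-++ f (a ∷ as) bs = trans (cong (f a +_) (asum-++ f as bs)) (sym (+-assoc (f a) _ _))

    green : (Index → ℕ) → Form
    green h = run (items h indices) dot

    private
      N₁ = k ℕ.* d ℕ.+ 1

      D : (Index → ℕ) → ℚ
      D h = det (items h indices) dot

      _≟_I : (i j : Index) → Dec (i ≡ j)
      _≟_I = Sum.≡-dec Fin._≟_ Fin._≟_

      indices-complete : ∀ i → i ∈ indices
      indices-complete (inj₁ e) = ∈-++⁺ʳ (map inj₂ (allFin d)) (∈-map⁺ inj₁ (∈-allFin e))
      indices-complete (inj₂ v) = ∈-++⁺ˡ (∈-map⁺ inj₂ (∈-allFin v))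

      indices-unique : Unique indices
      indices-unique = Unique.++⁺ (Unique.map⁺ Sum.inj₂-injective (Unique.allFin⁺ d))
        (Unique.map⁺ Sum.inj₁-injective (Unique.allFin⁺ m)) λ (p , q) → disjoint (∈-map⁻ inj₂ p) (∈-map⁻ inj₁ q)
        where
        disjoint : ∀ {i} → ∃ (λ v → v ∈ allFin d × i ≡ inj₂ v) → ¬ ∃ (λ e → e ∈ allFin m × i ≡ inj₁ e)
        disjoint (_ , _ , refl) (_ , _ , ())

      extract : ∀ i → ∃ λ others → indices ↭ others ++ [ i ] × All (i ≢_) others
      extract i with ∈-∃++ (indices-complete i)
      ... | xs , ys , eq = xs ++ ys , subst (_↭ (xs ++ ys) ++ [ i ]) (sym eq) front , distinct
        where
        front : xs ++ i ∷ ys ↭ (xs ++ ys) ++ [ i ]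
        front = ↭-trans (shift i xs ys) (∷↭∷ʳ i (xs ++ ys))
        remove : ∀ xs → Unique (xs ++ i ∷ ys) → All (i ≢_) (xs ++ ys)
        remove []       (p ∷ _) = p
        remove (x ∷ xs) (p ∷ q) = All.head (++⁻ʳ xs p) ∘ sym ∷ remove xs q
        distinct : All (i ≢_) (xs ++ ys)
        distinct = remove xs (subst Unique eq indices-unique)

      0≤s^ : ∀ a → 0ℚ ≤ s ^ a
      0≤s^ a = 0≤^ a (<⇒≤ 0<s)

      0≤weights : ∀ h is → NonNegWeights (items h is)
      0≤weights h []       = []
      0≤weights h (i ∷ is) = 0≤s^ (h i) ∷ 0≤weights h is

    green-Green : ∀ h → Green (items h indices ʳ++ []) (green h)
    green-Green h = run-Green (items h indices) (0≤weights h indices) dot-Green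

    load : (Index → ℕ) → Index → ℚ
    load h i = s ^ h i * green h (vec i) (vec i)

    private
      0≤D : ∀ h → 0ℚ ≤ D h
      0≤D h = ≤-trans 0≤1 (1≤det _ (0≤weights h indices) dot-Green)

      decrease : (Index → ℕ) → Index → Index → ℕ
      decrease h i j = if does (j ≟ i I) then ℕ.pred (h j) else h j

      decrease-same : ∀ h i → decrease h i i ≡ ℕ.pred (h i)
      decrease-same h i rewrite dec-true (i ≟ i I) refl = refl

      decrease-other : ∀ h i {j} → j ≢ i → decrease h i j ≡ h j
      decrease-other h i {j} j≢i rewrite dec-false (j ≟ i I) j≢i = refl

      -- The item is moved to the end of the list, where `det-rescale` applies with t = 1 - u,
      -- because s ^ suc l times 1 - u is s ^ l.
      D-decrease : ∀ h i l → h i ≡ suc l → D (decrease h i) ≡ D h * (1ℚ - u * load h i)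
      D-decrease h i l hi with extract i
      ... | others , perm , distinct = begin
        D (decrease h i)
          ≡⟨ proj₂ (run-det-↭ (map⁺ _ perm) (0≤weights h′ indices) dot-Green) ⟩
        det (items h′ (others ++ [ i ])) dot
          ≡⟨ cong (λ is → det is dot) (trans (map-++ _ others [ i ]) (cong₂ _++_ same (cong (λ c → [ c , vec i ]) lowered))) ⟩
        det (items h others ++ [ (s ^ h i * (1ℚ - u) , vec i) ]) dot
          ≡⟨ det-rescale (items h others) (0≤weights h others) dot-Green (s ^ h i) (vec i) (1ℚ - u) (0≤s^ (h i)) ⟩
        det (items h others ++ [ (s ^ h i , vec i) ]) dot *
          (1ℚ - (1ℚ - (1ℚ - u)) * (s ^ h i * run (items h others ++ [ (s ^ h i , vec i) ]) dot (vec i) (vec i)))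
          ≡⟨ cong (λ is → det is dot * (1ℚ - (1ℚ - (1ℚ - u)) * (s ^ h i * run is dot (vec i) (vec i)))) (map-++ _ others [ i ]) ⟨
        det (items h (others ++ [ i ])) dot *
          (1ℚ - (1ℚ - (1ℚ - u)) * (s ^ h i * run (items h (others ++ [ i ])) dot (vec i) (vec i)))
          ≡⟨ cong₂ (λ D b → D * (1ℚ - (1ℚ - (1ℚ - u)) * (s ^ h i * b))) (proj₂ same-run) (proj₁ same-run (vec i) (vec i)) ⟨
        D h * (1ℚ - (1ℚ - (1ℚ - u)) * load h i)
          ≡⟨ lem (D h) u (load h i) ⟩
        D h * (1ℚ - u * load h i) ∎
        where
        open ≡-Reasoning
        h′ = decrease h i
        same-run = run-det-↭ (map⁺ (λ i → s ^ h i , vec i) perm) (0≤weights h indices) dot-Green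
        same : items h′ others ≡ items h others
        same = map-cong-local (All.map (λ i≢j → cong (λ a → s ^ a , _) (decrease-other h i (i≢j ∘ sym))) distinct)
        lowered : s ^ h′ i ≡ s ^ h i * (1ℚ - u)
        lowered = trans (cong (s ^_) (trans (decrease-same h i) (cong ℕ.pred hi)))
          (sym (trans (cong (λ a → s ^ a * (1ℚ - u)) hi)
               (trans (lem′ s (s ^ l) (1ℚ - u)) (trans (cong (s ^ l *_) s*[1-u]≡1) (*-identityʳ (s ^ l))))))
          where
          lem′ : ∀ s p t → s * p * t ≡ p * (s * t)
          lem′ = solve-∀ ℚ-ring
        lem : ∀ D u q → D * (1ℚ - (1ℚ - (1ℚ - u)) * q) ≡ D * (1ℚ - u * q)
        lem = solve-∀ ℚ-ring

      total : (Index → ℕ) → ℕ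
      total h = sumℕ (h ∘ inj₁)

      -- The tree bound D h ≥ ν^d s^T, raised to the power N₁ = k d + 1 so that `heavy-tree` can
      -- compare the tree weight T with the total weight without fractions. The auxiliary edges are
      -- inserted last and only increase the determinant.
      D-lower : ∀ h H → (∀ i → h i ℕ.≤ H) →
        s ^ (N₁ ℕ.* (d ℕ.* H) ℕ.+ d ℕ.* total h) * (ν ^ d) ^ N₁ ≤ D h ^ N₁ * s ^ (d ℕ.* (m ℕ.* H))
      D-lower h H h≤H with heavy-tree ends {k} dense z refl (h ∘ inj₁) H (λ e → h≤H (inj₁ e))
      ... | es , es↭ , len , heavy = begin
        s ^ (N₁ ℕ.* (d ℕ.* H) ℕ.+ d ℕ.* total h) * (ν ^ d) ^ N₁
          ≤⟨ *-monoʳ-≤-nonNeg ((ν ^ d) ^ N₁) {{nonNegative (0≤^ N₁ (0≤^ d (<⇒≤ 0<ν)))}}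
               (s^-mono (subst (λ r → N₁ ℕ.* (d ℕ.* H) ℕ.+ d ℕ.* r ℕ.≤ N₁ ℕ.* T ℕ.+ d ℕ.* (m ℕ.* H)) (sumˡ-allFin (h ∘ inj₁)) heavy)) ⟩
        s ^ (N₁ ℕ.* T ℕ.+ d ℕ.* (m ℕ.* H)) * (ν ^ d) ^ N₁
          ≡⟨ cong (_* (ν ^ d) ^ N₁) (trans (^-homo-* s (N₁ ℕ.* T) _)
               (cong (_* s ^ (d ℕ.* (m ℕ.* H))) (trans (cong (s ^_) (ℕₚ.*-comm N₁ T)) (sym (^-assocʳ s T N₁))))) ⟩
        (s ^ T) ^ N₁ * s ^ (d ℕ.* (m ℕ.* H)) * (ν ^ d) ^ N₁
          ≡⟨ lem ((s ^ T) ^ N₁) (s ^ (d ℕ.* (m ℕ.* H))) ((ν ^ d) ^ N₁) ⟩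
        ((ν ^ d) ^ N₁ * (s ^ T) ^ N₁) * s ^ (d ℕ.* (m ℕ.* H))
          ≡⟨ cong (_* s ^ (d ℕ.* (m ℕ.* H))) (^-distrib-* (ν ^ d) (s ^ T) N₁) ⟨
        (ν ^ d * s ^ T) ^ N₁ * s ^ (d ℕ.* (m ℕ.* H))
          ≤⟨ *-monoʳ-≤-nonNeg (s ^ (d ℕ.* (m ℕ.* H))) {{nonNegative (0≤s^ (d ℕ.* (m ℕ.* H)))}}
               (^-mono-≤ N₁ (0≤* (0≤^ d (<⇒≤ 0<ν)) (0≤s^ T)) tree≤) ⟩
        D h ^ N₁ * s ^ (d ℕ.* (m ℕ.* H)) ∎
        where
        open ≤-Reasoning
        tree = kruskal ends (λ v → v) es
        T = sumˡ (map (h ∘ inj₁) tree)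
        s^-mono : ∀ {a b} → a ℕ.≤ b → s ^ a ≤ s ^ b
        s^-mono {a} {b} a≤b = subst₂ _≤_ (*-identityʳ (s ^ a))
          (trans (sym (^-homo-* s a (b ℕ.∸ a))) (cong (s ^_) (ℕₚ.m+[n∸m]≡n a≤b)))
          (*-monoˡ-≤-nonNeg (s ^ a) {{nonNegative (0≤s^ a)}} (1≤^ (b ℕ.∸ a) 1≤s))
        lem : ∀ a b c → a * b * c ≡ (c * a) * b
        lem = solve-∀ ℚ-ring
        stars = map inj₂ (allFin d)
        edges = map inj₁ es
        perm : indices ↭ edges ++ stars
        perm = ↭-trans (++-comm stars (map inj₁ (allFin m))) (++⁺ (map⁺ inj₁ (↭-sym es↭)) ↭-refl)
        tree≤ : ν ^ d * s ^ T ≤ D h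
        tree≤ = begin
          ν ^ d * s ^ T
            ≡⟨ cong (λ l → ν ^ l * s ^ T) len ⟨
          ν ^ length tree * s ^ T
            ≡⟨ product-split ν s (h ∘ inj₁) tree ⟨
          product (map (λ e → ν * s ^ h (inj₁ e)) tree)
            ≤⟨ det-lower ν (<⇒≤ 0<ν) νd≤1 (λ e → s ^ h (inj₁ e)) (λ e → 0≤s^ (h (inj₁ e))) es (λ v → v) dot-Green (dot-Respects (λ v → v)) ⟩
          det (map (λ e → s ^ h (inj₁ e) , edge e) es) dot
            ≡⟨ cong (λ is → det is dot) (map-∘ es) ⟩
          det (items h edges) dot
            ≡⟨ *-identityʳ _ ⟨
          det (items h edges) dot * 1ℚ
            ≤⟨ *-monoˡ-≤-nonNeg (det (items h edges) dot) {{nonNegative (≤-trans 0≤1 (1≤det _ (0≤weights h edges) dot-Green))}}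
                 (1≤det _ (0≤weights h stars) (run-Green _ (0≤weights h edges) dot-Green)) ⟩
          det (items h edges) dot * det (items h stars) (run (items h edges) dot)
            ≡⟨ det-++ (items h edges) (items h stars) dot ⟨
          det (items h edges ++ items h stars) dot
            ≡⟨ cong (λ is → det is dot) (map-++ _ edges stars) ⟨
          det (items h (edges ++ stars)) dot
            ≡⟨ proj₂ (run-det-↭ (map⁺ _ perm) (0≤weights h indices) dot-Green) ⟨
          D h ∎

      module Start (H : ℕ) where
        K = s ^ H
        stars = items (λ _ → H) (map inj₂ (allFin d))
        edges = items (λ _ → H) (map inj₁ (allFin m))

        0<K : 0ℚ < K
        0<K = 0<^ H 0<s

        Gₛ : Green (stars ʳ++ []) (run stars dot)
        Gₛ = run-Green stars (0≤weights (λ _ → H) (map inj₂ (allFin d))) dot-Green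

        star-energy : ∀ x → K * sum (λ v → run stars dot x (δ v) * run stars dot x (δ v)) ≤ run stars dot x x
        star-energy x = ≤-by (sum (λ v → Bₛ x (δ v) * Bₛ x (δ v))) (0≤sum-² (λ v → Bₛ x (δ v)))
          (trans (energy Gₛ x x) (trans (cong (sum (λ v → Bₛ x (δ v) * Bₛ x (δ v)) +_) stars-sum) (+-comm _ (K * _))))
          where
          Bₛ = run stars dot
          f : Item → ℚ
          f (c , w) = c * (Bₛ x w * Bₛ x w)
          stars-sum : asum f (stars ʳ++ []) ≡ K * sum (λ v → Bₛ x (δ v) * Bₛ x (δ v))
          stars-sum = trans (asum-ʳ++ f stars []) (trans (+-identityʳ _)
            (trans (asum-items f (λ _ → H) inj₂)
                   (sym (*-distribˡ-sum K (λ v → Bₛ x (δ v) * Bₛ x (δ v))))))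

        edge²≤1 : ∀ e v → edge e v * edge e v ≤ 1ℚ
        edge²≤1 e v = subst₂ _≤_ (ι-* (edgeVector e v) (edgeVector e v)) ι-1
          (ι-mono-≤ (small (edgeVector e v) (V.∣δ-δ∣≤1 (proj₁ (ends e)) (proj₂ (ends e)) (punchIn z v))))
          where
          small : ∀ i → ℤ.∣ i ∣ ℕ.≤ 1 → i ℤ.* i ℤ.≤ ℤ.+ 1
          small (ℤ.+ 0)       _ = ℤ.+≤+ ℕ.z≤n
          small (ℤ.+ 1)       _ = ℤ.+≤+ (ℕ.s≤s ℕ.z≤n)
          small ℤ.-[1+ 0 ]    _ = ℤ.+≤+ (ℕ.s≤s ℕ.z≤n)
          small (ℤ.+ suc (suc _)) (ℕ.s≤s ())
          small ℤ.-[1+ suc _ ]    (ℕ.s≤s ())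

        -- The auxiliary edges come first in `indices` for the sake of this bound: each contributes
        -- 1 + K, and once they are present an edge has resistance at most d / K, so the edges
        -- contribute at most 1 + d each, independently of H.
        upper : D (λ _ → H) ≤ (1ℚ + K) ^ d * (1ℚ + # d) ^ m
        upper = begin
          det (items (λ _ → H) indices) dot
            ≡⟨ cong (λ is → det is dot) (map-++ _ (map inj₂ (allFin d)) (map inj₁ (allFin m))) ⟩
          det (stars ++ edges) dot
            ≡⟨ det-++ stars edges dot ⟩
          det stars dot * det edges (run stars dot)
            ≤⟨ *-mono-≤ (≤-trans 0≤1 (1≤det stars nnₛ dot-Green)) (≤-trans 0≤1 (1≤det edges nnₑ Gₛ))
                 (det-upper stars (1ℚ + K) (<⇒≤ (0<1+ (<⇒≤ 0<K))) nnₛ dot-Green (star-factors (allFin d)))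
                 (det-upper edges (1ℚ + # d) (<⇒≤ (0<1+ (0≤# d))) nnₑ Gₛ (edge-factors (allFin m))) ⟩
          (1ℚ + K) ^ length stars * (1ℚ + # d) ^ length edges
            ≡⟨ cong₂ (λ a b → (1ℚ + K) ^ a * (1ℚ + # d) ^ b) (len inj₂ d) (len inj₁ m) ⟩
          (1ℚ + K) ^ d * (1ℚ + # d) ^ m ∎
          where
          open ≤-Reasoning
          nnₛ = 0≤weights (λ _ → H) (map inj₂ (allFin d))
          nnₑ = 0≤weights (λ _ → H) (map inj₁ (allFin m))
          len : ∀ {A : Set} (f : A → Index) → ∀ n {xs : Fin n → A} → length (items (λ _ → H) (map f (tabulate xs))) ≡ n
          len f n {xs} = trans (length-map _ (map f (tabulate xs))) (trans (length-map f (tabulate xs)) (length-tabulate xs))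
          star-factors : ∀ vs → All (λ a → factor a dot ≤ 1ℚ + K) (items (λ _ → H) (map inj₂ vs))
          star-factors []       = []
          star-factors (v ∷ vs) = ≤-reflexive (cong (1ℚ +_) (trans (cong (K *_) (trans (dot-δ (δ v) v) δ-self)) (*-identityʳ K))) ∷ star-factors vs
            where
            δ-self : δ v v ≡ 1ℚ
            δ-self rewrite dec-true (v Fin.≟ v) refl = refl
          edge-factors : ∀ es → All (λ a → factor a (run stars dot) ≤ 1ℚ + # d) (items (λ _ → H) (map inj₁ es))
          edge-factors []       = []
          edge-factors (e ∷ es) = +-monoʳ-≤ 1ℚ (≤-trans (scaled-norm Gₛ K 0<K (edge e) (star-energy (edge e)))
            (subst (sum (λ v → edge e v * edge e v) ≤_) (trans (sum-const d 1ℚ) (*-identityʳ (# d)))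
              (sum-mono (λ v → edge e v * edge e v) (λ _ → 1ℚ) (edge²≤1 e)))) ∷ edge-factors es

      -- The j-th step multiplies D h ^ N₁ by at most ζ s^(-d) or ζ, according to whether the
      -- weight of an edge or of an auxiliary edge is lowered; D-lower forbids this to go on.
      Invariant : ℕ → (Index → ℕ) → ℕ → Set
      Invariant H h j = D h ^ N₁ * s ^ (d ℕ.* (m ℕ.* H)) ≤ D (λ _ → H) ^ N₁ * s ^ (d ℕ.* total h) * ζ ^ j

      invariant-start : ∀ H → Invariant H (λ _ → H) 0
      invariant-start H = ≤-reflexive (trans
        (cong (λ a → D (λ _ → H) ^ N₁ * s ^ (d ℕ.* a)) (sym (sumℕ-const m H))) (sym (*-identityʳ _)))
        where
        sumℕ-const : ∀ m H → sumℕ {m} (λ _ → H) ≡ m ℕ.* H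
        sumℕ-const zero    H = refl
        sumℕ-const (suc m) H = cong (H ℕ.+_) (sumℕ-const m H)

      invariant-step : ∀ H h h′ j g y → 0ℚ ≤ y → D h′ ≤ D h * y → total h ≡ g ℕ.+ total h′ →
        y ^ N₁ * s ^ (d ℕ.* g) ≤ ζ → Invariant H h j → Invariant H h′ (suc j)
      invariant-step H h h′ j g y 0≤y D≤ tot y≤ inv = begin
        D h′ ^ N₁ * S
          ≤⟨ *-monoʳ-≤-nonNeg S {{nonNegative (0≤s^ (d ℕ.* (m ℕ.* H)))}} (^-mono-≤ N₁ (0≤D h′) D≤) ⟩
        (D h * y) ^ N₁ * S
          ≡⟨ cong (_* S) (^-distrib-* (D h) y N₁) ⟩
        D h ^ N₁ * y ^ N₁ * S
          ≡⟨ lem₁ (D h ^ N₁) (y ^ N₁) S ⟩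
        y ^ N₁ * (D h ^ N₁ * S)
          ≤⟨ *-monoˡ-≤-nonNeg (y ^ N₁) {{nonNegative (0≤^ N₁ 0≤y)}} inv ⟩
        y ^ N₁ * (C * s ^ (d ℕ.* total h) * ζ ^ j)
          ≡⟨ cong (λ a → y ^ N₁ * (C * a * ζ ^ j)) (trans (cong (s ^_) (trans (cong (d ℕ.*_) tot) (ℕₚ.*-distribˡ-+ d g (total h′))))
               (^-homo-* s (d ℕ.* g) (d ℕ.* total h′))) ⟩
        y ^ N₁ * (C * (s ^ (d ℕ.* g) * s ^ (d ℕ.* total h′)) * ζ ^ j)
          ≡⟨ lem₂ (y ^ N₁) C (s ^ (d ℕ.* g)) (s ^ (d ℕ.* total h′)) (ζ ^ j) ⟩
        (y ^ N₁ * s ^ (d ℕ.* g)) * (C * s ^ (d ℕ.* total h′) * ζ ^ j)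
          ≤⟨ *-monoʳ-≤-nonNeg (C * s ^ (d ℕ.* total h′) * ζ ^ j)
               {{nonNegative (0≤* (0≤* (0≤^ N₁ (0≤D (λ _ → H))) (0≤s^ (d ℕ.* total h′))) (0≤^ j (<⇒≤ 0<ζ)))}} y≤ ⟩
        ζ * (C * s ^ (d ℕ.* total h′) * ζ ^ j)
          ≡⟨ lem₃ ζ C (s ^ (d ℕ.* total h′)) (ζ ^ j) ⟩
        C * s ^ (d ℕ.* total h′) * (ζ * ζ ^ j) ∎
        where
        open ≤-Reasoning
        S = s ^ (d ℕ.* (m ℕ.* H))
        C = D (λ _ → H) ^ N₁
        lem₁ : ∀ a b c → a * b * c ≡ b * (a * c)
        lem₁ = solve-∀ ℚ-ring
        lem₂ : ∀ y c p q z → y * (c * (p * q) * z) ≡ (y * p) * (c * q * z)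
        lem₂ = solve-∀ ℚ-ring
        lem₃ : ∀ z c p q → z * (c * p * q) ≡ c * p * (z * q)
        lem₃ = solve-∀ ℚ-ring

      -- Bounds the N₁-th power of the initial determinant divided by K^d, uniformly in the starting
      -- height H. The 2 comes from 1 + K ≤ 2 K.
      E : ℚ
      E = ((1ℚ + 1ℚ) ^ d * (1ℚ + # d) ^ m) ^ N₁

      -- Combining the invariant with `D-lower` cancels all powers of s. What remains depends on the
      -- number j of steps but not on H, so H can be chosen large enough to refute it at j = H.
      invariant-bound : ∀ H h j → (∀ i → h i ℕ.≤ H) → Invariant H h j → (ν ^ d) ^ N₁ ≤ E * ζ ^ j
      invariant-bound H h j h≤H inv = *-cancelˡ-≤-pos (P * Q) {{positive (0<* 0<P 0<Q)}} (begin
        P * Q * (ν ^ d) ^ N₁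
          ≡⟨ cong (_* (ν ^ d) ^ N₁) (^-homo-* s (N₁ ℕ.* (d ℕ.* H)) (d ℕ.* total h)) ⟨
        s ^ (N₁ ℕ.* (d ℕ.* H) ℕ.+ d ℕ.* total h) * (ν ^ d) ^ N₁
          ≤⟨ D-lower h H h≤H ⟩
        D h ^ N₁ * s ^ (d ℕ.* (m ℕ.* H))
          ≤⟨ inv ⟩
        D (λ _ → H) ^ N₁ * Q * ζ ^ j
          ≤⟨ *-monoʳ-≤-nonNeg (ζ ^ j) {{nonNegative (0≤^ j (<⇒≤ 0<ζ))}}
               (*-monoʳ-≤-nonNeg Q {{nonNegative (<⇒≤ 0<Q)}} (^-mono-≤ N₁ (0≤D (λ _ → H)) upper′)) ⟩
        (M * K ^ d) ^ N₁ * Q * ζ ^ j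
          ≡⟨ cong (λ a → a * Q * ζ ^ j) (trans (^-distrib-* M (K ^ d) N₁) (cong (E *_) K≡P)) ⟩
        E * P * Q * ζ ^ j
          ≡⟨ lem E P Q (ζ ^ j) ⟩
        P * Q * (E * ζ ^ j) ∎)
        where
        open ≤-Reasoning
        open Start H using (K; 0<K; upper)
        P = s ^ (N₁ ℕ.* (d ℕ.* H))
        Q = s ^ (d ℕ.* total h)
        M = (1ℚ + 1ℚ) ^ d * (1ℚ + # d) ^ m
        0<P : 0ℚ < P
        0<P = 0<^ (N₁ ℕ.* (d ℕ.* H)) 0<s
        0<Q : 0ℚ < Q
        0<Q = 0<^ (d ℕ.* total h) 0<s
        1≤K : 1ℚ ≤ K
        1≤K = 1≤^ H 1≤s
        double : ∀ K → 1ℚ + K + (K - 1ℚ) ≡ (1ℚ + 1ℚ) * K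
        double = solve-∀ ℚ-ring
        swap : ∀ a b c → a * b * c ≡ a * c * b
        swap = solve-∀ ℚ-ring
        upper′ : D (λ _ → H) ≤ M * K ^ d
        upper′ = ≤-trans upper (subst ((1ℚ + K) ^ d * (1ℚ + # d) ^ m ≤_)
          (trans (cong (_* (1ℚ + # d) ^ m) (^-distrib-* (1ℚ + 1ℚ) K d)) (swap ((1ℚ + 1ℚ) ^ d) (K ^ d) ((1ℚ + # d) ^ m)))
          (*-monoʳ-≤-nonNeg ((1ℚ + # d) ^ m) {{nonNegative (0≤^ m (<⇒≤ (0<1+ (0≤# d))))}}
            (^-mono-≤ d (<⇒≤ (0<1+ (<⇒≤ 0<K))) (≤-by (K - 1ℚ) (0≤q-p 1≤K) (sym (double K))))))
        K≡P : (K ^ d) ^ N₁ ≡ P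
        K≡P = trans (cong (_^ N₁) (^-assocʳ s H d)) (trans (^-assocʳ s (H ℕ.* d) N₁)
          (cong (s ^_) (rearrange H d N₁)))
          where
          rearrange : ∀ H d N → H ℕ.* d ℕ.* N ≡ N ℕ.* (d ℕ.* H)
          rearrange = solveℕ-∀
        lem : ∀ e p q z → e * p * q * z ≡ p * q * (e * z)
        lem = solve-∀ ℚ-ring

      drop : ∀ {q y} D → 0ℚ ≤ D → ∀ b → b ≤ κ * q → y ≡ 1ℚ - u * (a * b) → D * (1ℚ - u * q) ≤ D * y
      drop {q} D 0≤D b b≤κq refl = *-monoˡ-≤-nonNeg D {{nonNegative 0≤D}}
        (≤-by (u * (q - a * b)) (0≤* (<⇒≤ 0<u) (0≤q-p ab≤q)) (lem u q (a * b)))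
        where
        ab≤q : a * b ≤ q
        ab≤q = subst (a * b ≤_) (trans (sym (*-assoc a κ q)) (trans (cong (_* q) aκ≡1) (*-identityˡ q)))
          (*-monoˡ-≤-nonNeg a {{nonNegative (<⇒≤ 0<a)}} b≤κq)
        lem : ∀ u q b → 1ℚ - u * b ≡ 1ℚ - u * q + u * (q - b)
        lem = solve-∀ ℚ-ring

      decrease-step : ∀ H h j i l → h i ≡ suc l → threshold i ≤ κ * load h i →
                      Invariant H h j → Invariant H (decrease h i) (suc j)
      decrease-step H h j (inj₁ e) l hi over = invariant-step H h (decrease h (inj₁ e)) j 1 x 0≤x
        (subst (_≤ D h * x) (sym (D-decrease h (inj₁ e) l hi))
          (drop (D h) (0≤D h) 1ℚ over (cong (λ b → 1ℚ - u * b) (sym (*-identityʳ a)))))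
        totals (subst (λ g → x ^ N₁ * s ^ g ≤ ζ) (sym (ℕₚ.*-identityʳ d)) x-power)
        where
        totals : total h ≡ 1 ℕ.+ total (decrease h (inj₁ e))
        totals = ℕₚ.+-cancelʳ-≡ l _ _ (begin
          total h ℕ.+ l ≡⟨ cong (total h ℕ.+_) (trans (decrease-same h (inj₁ e)) (cong ℕ.pred hi)) ⟨
          total h ℕ.+ decrease h (inj₁ e) (inj₁ e)
            ≡⟨ sum-changeℕ (h ∘ inj₁) (decrease h (inj₁ e) ∘ inj₁) e (λ j j≢e →
                 sym (decrease-other h (inj₁ e) (j≢e ∘ Sum.inj₁-injective))) ⟩
          total (decrease h (inj₁ e)) ℕ.+ h (inj₁ e) ≡⟨ cong (total (decrease h (inj₁ e)) ℕ.+_) hi ⟩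
          total (decrease h (inj₁ e)) ℕ.+ suc l ≡⟨ ℕₚ.+-suc _ l ⟩
          1 ℕ.+ total (decrease h (inj₁ e)) ℕ.+ l ∎)
          where open ≡-Reasoning
      decrease-step H h j (inj₂ v) l hi over = invariant-step H h (decrease h (inj₂ v)) j 0 ζ (<⇒≤ 0<ζ)
        (subst (_≤ D h * ζ) (sym (D-decrease h (inj₂ v) l hi)) (drop (D h) (0≤D h) θ over refl))
        (sumℕ-cong unchanged)
        (subst₂ (λ N g → ζ ^ N * s ^ g ≤ ζ) (ℕₚ.+-comm 1 (k ℕ.* d)) (sym (ℕₚ.*-zeroʳ d))
          (subst (_≤ ζ) (sym (*-identityʳ _)) (ζ-power (k ℕ.* d))))
        where
        unchanged : ∀ e → h (inj₁ e) ≡ decrease h (inj₂ v) (inj₁ e)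
        unchanged e = sym (decrease-other h (inj₂ v) {inj₁ e} λ ())

    Loaded : (Index → ℕ) → Set
    Loaded h = ∀ i → κ * load h i < threshold i

    reweight : ∃ Loaded
    reweight = start (geometric-decay 0<uaθ uaθ<1 (0<^ N₁ (0<^ d 0<ν)) E)
      where
      module Descent (H : ℕ) (small : E * ζ ^ H < (ν ^ d) ^ N₁) where
        -- H is both the starting height and the number of steps allowed. With r steps left every
        -- height is still at least r, so a height to be lowered is never 0.
        go : ∀ r j h → r ℕ.+ j ≡ H → (∀ i → r ℕ.≤ h i) → (∀ i → h i ℕ.≤ H) → Invariant H h j → ∃ Loaded
        go zero    j h refl _   h≤H inv = ⊥-elim (<-irrefl refl (≤-<-trans (invariant-bound H h j h≤H inv) small))
        go (suc r) j h eq   r<h h≤H inv = search (Fin.any? λ e → 1ℚ ≤? κ * load h (inj₁ e)) (Fin.any? λ v → θ ≤? κ * load h (inj₂ v))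
          where
          lower : ∀ i l → h i ≡ suc l → threshold i ≤ κ * load h i → ∃ Loaded
          lower i l hi over = go r (suc j) (decrease h i) (trans (ℕₚ.+-suc r j) eq) r≤h′ h′≤H (decrease-step H h j i l hi over inv)
            where
            r≤h′ : ∀ j → r ℕ.≤ decrease h i j
            r≤h′ j with does (j ≟ i I)
            ... | true  = ℕₚ.pred-mono-≤ (r<h j)
            ... | false = ℕₚ.≤-trans (ℕₚ.n≤1+n r) (r<h j)
            h′≤H : ∀ j → decrease h i j ℕ.≤ H
            h′≤H j with does (j ≟ i I)
            ... | true  = ℕₚ.≤-trans ℕₚ.pred[n]≤n (h≤H j)
            ... | false = h≤H j
          positive-height : ∀ {a} → suc r ℕ.≤ a → ∃ λ l → a ≡ suc l
          positive-height {suc l} _ = l , refl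
          overloaded : ∀ i → threshold i ≤ κ * load h i → ∃ Loaded
          overloaded i over = lower i (proj₁ (positive-height (r<h i))) (proj₂ (positive-height (r<h i))) over
          search : Dec (∃ λ e → 1ℚ ≤ κ * load h (inj₁ e)) → Dec (∃ λ v → θ ≤ κ * load h (inj₂ v)) → ∃ Loaded
          search (yes (e , over)) _                = overloaded (inj₁ e) over
          search (no _)           (yes (v , over)) = overloaded (inj₂ v) over
          search (no none₁)       (no none₂)       = h , λ
            { (inj₁ e) → ≰⇒> λ over → none₁ (e , over)
            ; (inj₂ v) → ≰⇒> λ over → none₂ (v , over) }

      start : (∃ λ H → E * ζ ^ H < (ν ^ d) ^ N₁) → ∃ Loaded
      start (H , small) = Descent.go H small H 0 (λ _ → H) (ℕₚ.+-identityʳ H) (λ _ → ℕₚ.≤-refl) (λ _ → ℕₚ.≤-refl) (invariant-start H)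

  -- A demand in a given residue class modulo 2k whose currents are small.

  module LocalMinimum (k′ : ℕ) {d m : ℕ} (z : Fin (suc d)) (ends : Fin m → Fin (suc d) × Fin (suc d))
                      (dense : Dense ends (suc k′)) where
    open Network d
    open Green
    open TreeBound z ends
    open Constants k′ d
    open Reweighting k′ z ends dense

    indexVector : Index → Fin d → ℤ
    indexVector (inj₁ e) = edgeVector e
    indexVector (inj₂ v) = λ w → if does (v Fin.≟ w) then ℤ.+ 1 else ℤ.+ 0

    ι-indexVector : ∀ i v → ι (indexVector i v) ≡ vec i v
    ι-indexVector (inj₁ e) v = refl
    ι-indexVector (inj₂ w) v with does (w Fin.≟ v)
    ... | true  = ι-1
    ... | false = ι-0

    module _ (h : Index → ℕ) (loaded : Loaded h) (β₀ : Fin d → ℤ) where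

      private
        B = green h
        G = green-Green h

      -- `β₀` will be minus the degree. The modulus is 2k and not k because an outdegree is half the
      -- sum of degree and demand.
      demand : (Fin d → ℤ) → Vector
      demand T v = ι (β₀ v ℤ.+ ℤ.+ (k ℕ.+ k) ℤ.* T v)

      flow : (Fin d → ℤ) → Index → ℚ
      flow T i = s ^ h i * B (demand T) (vec i)

      private
        expand-square : ∀ x y w τ → (∀ v → y v ≡ x v - τ * w v) →
          B y y ≡ B x x - (τ + τ) * B x w + τ * τ * B w w
        expand-square x y w τ eq = begin
          B y y                                          ≡⟨ linear y ⟩
          B y x - τ * B y w                              ≡⟨ cong₂ (λ p q → p - τ * q) (symmetric G y x) (symmetric G y w) ⟩
          B x y - τ * B w y                              ≡⟨ cong₂ (λ p q → p - τ * q) (linear x) (linear w) ⟩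
          (B x x - τ * B x w) - τ * (B w x - τ * B w w)  ≡⟨ cong (λ p → (B x x - τ * B x w) - τ * (p - τ * B w w)) (symmetric G w x) ⟩
          (B x x - τ * B x w) - τ * (B x w - τ * B w w)  ≡⟨ lem (B x x) τ (B x w) (B w w) ⟩
          B x x - (τ + τ) * B x w + τ * τ * B w w ∎
          where
          open ≡-Reasoning
          linear : ∀ p → B p y ≡ B p x - τ * B p w
          linear p = begin
            B p y                                                    ≡⟨ expand G p y ⟩
            sum (λ v → y v * B p (δ v))
              ≡⟨ sum-cong-≗ (λ v → trans (cong (_* B p (δ v)) (eq v)) (split (x v) τ (w v) (B p (δ v)))) ⟩
            sum (λ v → x v * B p (δ v) - τ * (w v * B p (δ v)))      ≡⟨ sum-linear τ (λ v → x v * B p (δ v)) (λ v → w v * B p (δ v)) ⟩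
            sum (λ v → x v * B p (δ v)) - τ * sum (λ v → w v * B p (δ v)) ≡⟨ cong₂ (λ p q → p - τ * q) (expand G p x) (expand G p w) ⟨
            B p x - τ * B p w ∎
            where
            split : ∀ x τ w b → (x - τ * w) * b ≡ x * b - τ * (w * b)
            split = solve-∀ ℚ-ring
          lem : ∀ a τ p q → (a - τ * p) - τ * (p - τ * q) ≡ a - (τ + τ) * p + τ * τ * q
          lem = solve-∀ ℚ-ring

        energyOf : (Fin d → ℤ) → ℚ
        energyOf T = B (demand T) (demand T)

        0<4κ : 0ℚ < (1ℚ + 1ℚ) * ((1ℚ + 1ℚ) * κ)
        0<4κ = 0<* 0<2 (0<* 0<2 0<κ)

        -- Shifting the demand by 2k against an item with potential difference X changes the energy
        -- by - 4 k X + 4 k² R. When the current c X reaches the threshold, this is a drop of at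
        -- least `gain`, which is positive because k c R is strictly below the threshold.
        gain : Index → ℚ
        gain i = (1ℚ + 1ℚ) * ((1ℚ + 1ℚ) * κ) * (inv (s ^ h i) * (threshold i - κ * load h i))

        0<gain : ∀ i → 0ℚ < gain i
        0<gain i = 0<* 0<4κ (0<* (0<inv (0<^ (h i) 0<s))
          (subst (_< threshold i - κ * load h i) (+-inverseʳ (κ * load h i)) (+-monoˡ-< (- (κ * load h i)) (loaded i))))

        -- σ is the sign of the overload of i, and T′ = T - σ vec i.
        improve : ∀ T T′ i σ → σ * σ ≡ 1ℚ → threshold i ≤ σ * flow T i →
          (∀ v → demand T′ v ≡ demand T v - (κ + κ) * σ * vec i v) → energyOf T′ ≤ energyOf T - gain i
        improve T T′ i σ σ² over eq = ≤-by ((1ℚ + 1ℚ) * ((1ℚ + 1ℚ) * κ) * (inv c * (σ * flow T i - threshold i)))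
          (0≤* (<⇒≤ 0<4κ) (0≤* (<⇒≤ (0<inv (0<^ (h i) 0<s))) (0≤q-p over)))
          (sym (trans (cong (_+ four * (inv c * (σ * (c * X) - threshold i)))
                        (expand-square (demand T) (demand T′) (vec i) ((κ + κ) * σ) eq))
               (trans (lem (energyOf T) κ σ X b c (inv c) (threshold i))
               (trans (cong₂ (λ o p → energyOf T - four * σ * X + (κ + κ) * (κ + κ) * o * b
                               + four * (σ * X * p - inv c * threshold i)) σ² (inv-inverse (0<^ (h i) 0<s)))
               (trans (lem₂ (energyOf T) κ σ X b (inv c) (threshold i))
               (trans (cong (λ o → energyOf T - four * (inv c * threshold i - κ * b * o)) (sym (inv-inverse (0<^ (h i) 0<s))))
                      (lem₃ (energyOf T) κ b (inv c) c (threshold i))))))))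
          where
          c = s ^ h i
          X = B (demand T) (vec i)
          b = B (vec i) (vec i)
          four = (1ℚ + 1ℚ) * ((1ℚ + 1ℚ) * κ)
          lem : ∀ e κ σ X b c i t →
            e - ((κ + κ) * σ + (κ + κ) * σ) * X + (κ + κ) * σ * ((κ + κ) * σ) * b
              + (1ℚ + 1ℚ) * ((1ℚ + 1ℚ) * κ) * (i * (σ * (c * X) - t)) ≡
            e - (1ℚ + 1ℚ) * ((1ℚ + 1ℚ) * κ) * σ * X + (κ + κ) * (κ + κ) * (σ * σ) * b
              + (1ℚ + 1ℚ) * ((1ℚ + 1ℚ) * κ) * (σ * X * (i * c) - i * t)
          lem = solve-∀ ℚ-ring
          lem₂ : ∀ e κ σ X b i t →
            e - (1ℚ + 1ℚ) * ((1ℚ + 1ℚ) * κ) * σ * X + (κ + κ) * (κ + κ) * 1ℚ * b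
              + (1ℚ + 1ℚ) * ((1ℚ + 1ℚ) * κ) * (σ * X * 1ℚ - i * t) ≡
            e - (1ℚ + 1ℚ) * ((1ℚ + 1ℚ) * κ) * (i * t - κ * b * 1ℚ)
          lem₂ = solve-∀ ℚ-ring
          lem₃ : ∀ e κ b i c t →
            e - (1ℚ + 1ℚ) * ((1ℚ + 1ℚ) * κ) * (i * t - κ * b * (i * c)) ≡
            e - (1ℚ + 1ℚ) * ((1ℚ + 1ℚ) * κ) * (i * (t - κ * (c * b)))
          lem₃ = solve-∀ ℚ-ring

        shift-demand : ∀ T i (ς : ℤ) v →
          demand (λ v → T v ℤ.- ς ℤ.* indexVector i v) v ≡ demand T v - (κ + κ) * ι ς * vec i v
        shift-demand T i ς v = begin
          ι (β₀ v ℤ.+ K ℤ.* (T v ℤ.- ς ℤ.* W))          ≡⟨ cong ι (lem (β₀ v) K (T v) ς W) ⟩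
          ι (β₀ v ℤ.+ K ℤ.* T v ℤ.+ ℤ.- (K ℤ.* ς ℤ.* W)) ≡⟨ ι-+ (β₀ v ℤ.+ K ℤ.* T v) _ ⟩
          demand T v + ι (ℤ.- (K ℤ.* ς ℤ.* W))          ≡⟨ cong (demand T v +_) (ι-neg (K ℤ.* ς ℤ.* W)) ⟩
          demand T v - ι (K ℤ.* ς ℤ.* W)                ≡⟨ cong (λ q → demand T v - q) (trans (ι-* (K ℤ.* ς) W) (cong (_* ι W) (ι-* K ς))) ⟩
          demand T v - ι K * ι ς * ι W                  ≡⟨ cong₂ (λ κ w → demand T v - κ * ι ς * w) (#-+ k k) (ι-indexVector i v) ⟩
          demand T v - (κ + κ) * ι ς * vec i v ∎
          where
          open ≡-Reasoning
          K = ℤ.+ (k ℕ.+ k)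
          W = indexVector i v
          lem : ∀ b K t ς w → b ℤ.+ K ℤ.* (t ℤ.- ς ℤ.* w) ≡ b ℤ.+ K ℤ.* t ℤ.+ ℤ.- (K ℤ.* ς ℤ.* w)
          lem = solveℤ-∀

      Feasible : (Fin d → ℤ) → Set
      Feasible T = ∀ i → flow T i ≤ threshold i × - flow T i ≤ threshold i

      private
        minimum : ∃ λ γ → 0ℚ < γ × (∀ i → γ ≤ gain i)
        minimum = positive-minimum-⊎ gain 0<gain

        γ = proj₁ minimum

      -- The energy is nonnegative and every repair lowers it by at least the smallest gain γ. Hence
      -- the initial energy divided by γ bounds the number of repairs, and no search for a minimiser
      -- is involved.
      feasible : ∃ Feasible
      feasible = start (archimedean (energyOf (λ _ → ℤ.+ 0) * inv γ))
        where
        0<γ : 0ℚ < γ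
        0<γ = proj₁ (proj₂ minimum)

        Violated : (Fin d → ℤ) → ℚ → Index → Set
        Violated T σ i = threshold i < σ * flow T i

        -1² : - 1ℚ * - 1ℚ ≡ 1ℚ
        -1² = refl

        go : ∀ fuel T → energyOf T < # fuel * γ → ∃ Feasible
        go zero T lt = ⊥-elim (<-irrefl refl (≤-<-trans (0≤diagonal G (demand T))
          (subst (energyOf T <_) (trans (cong (_* γ) ι-0) (*-zeroˡ γ)) lt)))
        go (suc fuel) T lt = search
            (Fin.any? (λ e → violated? 1ℚ (inj₁ e))) (Fin.any? (λ v → violated? 1ℚ (inj₂ v)))
            (Fin.any? (λ e → violated? (- 1ℚ) (inj₁ e))) (Fin.any? (λ v → violated? (- 1ℚ) (inj₂ v)))
          where
          violated? : ∀ σ i → Dec (Violated T σ i)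
          violated? σ i = threshold i <? σ * flow T i

          move : ∀ (ς : ℤ) i → ι ς * ι ς ≡ 1ℚ → Violated T (ι ς) i → ∃ Feasible
          move ς i ς² over = go fuel _ (≤-<-trans
            (≤-trans (improve T _ i (ι ς) ς² (<⇒≤ over) (shift-demand T i ς))
                     (+-monoʳ-≤ (energyOf T) (neg-antimono-≤ (proj₂ (proj₂ minimum) i))))
            (subst (energyOf T - γ <_) (trans (cong (λ f → f * γ - γ) (#-suc fuel)) (lem (# fuel) γ)) (+-monoˡ-< (- γ) lt)))
            where
            lem : ∀ f γ → (1ℚ + f) * γ - γ ≡ f * γ
            lem = solve-∀ ℚ-ring

          up : ∀ i → Violated T 1ℚ i → ∃ Feasible
          up i over = move (ℤ.+ 1) i (trans (cong₂ _*_ ι-1 ι-1) (*-identityˡ 1ℚ))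
            (subst (λ σ → Violated T σ i) (sym ι-1) over)

          down : ∀ i → Violated T (- 1ℚ) i → ∃ Feasible
          down i over = move (ℤ.- ℤ.+ 1) i (trans (cong₂ _*_ minus minus) -1²)
            (subst (λ σ → Violated T σ i) (sym minus) over)
            where
            minus : ι (ℤ.- ℤ.+ 1) ≡ - 1ℚ
            minus = trans (ι-neg (ℤ.+ 1)) (cong -_ ι-1)

          search : Dec (∃ λ e → Violated T 1ℚ (inj₁ e)) → Dec (∃ λ v → Violated T 1ℚ (inj₂ v)) →
                   Dec (∃ λ e → Violated T (- 1ℚ) (inj₁ e)) → Dec (∃ λ v → Violated T (- 1ℚ) (inj₂ v)) → ∃ Feasible
          search (yes (e , over)) _ _ _ = up (inj₁ e) over
          search (no _) (yes (v , over)) _ _ = up (inj₂ v) over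
          search (no _) (no _) (yes (e , over)) _ = down (inj₁ e) over
          search (no _) (no _) (no _) (yes (v , over)) = down (inj₂ v) over
          search (no a) (no b) (no c) (no e) = T , λ
            { (inj₁ i) → plus (inj₁ i) (λ over → a (i , over)) , minus (inj₁ i) (λ over → c (i , over))
            ; (inj₂ i) → plus (inj₂ i) (λ over → b (i , over)) , minus (inj₂ i) (λ over → e (i , over)) }
            where
            plus : ∀ i → ¬ Violated T 1ℚ i → flow T i ≤ threshold i
            plus i ¬over = subst (_≤ threshold i) (*-identityˡ (flow T i)) (≮⇒≥ ¬over)
            minus : ∀ i → ¬ Violated T (- 1ℚ) i → - flow T i ≤ threshold i
            minus i ¬over = subst (_≤ threshold i) (lem (flow T i)) (≮⇒≥ ¬over)
              where
              lem : ∀ f → - 1ℚ * f ≡ - f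
              lem = solve-∀ ℚ-ring

        start : (∃ λ N → energyOf (λ _ → ℤ.+ 0) * inv γ < # N) → ∃ Feasible
        start (N , lt) = go N (λ _ → ℤ.+ 0) (subst (_< # N * γ)
          (trans (*-assoc (energyOf (λ _ → ℤ.+ 0)) (inv γ) γ)
                 (trans (cong (energyOf (λ _ → ℤ.+ 0) *_) (inv-inverse 0<γ)) (*-identityʳ _)))
          (*-monoˡ-<-pos γ {{positive 0<γ}} lt))

  -- Rounding the flow to an orientation.

  module Orientation (k′ : ℕ) {d m : ℕ} (z : Fin (suc d)) (ends : Fin m → Fin (suc d) × Fin (suc d))
                      (dense : Dense ends (suc k′)) where
    open Network d
    open Green
    open TreeBound z ends
    open Constants k′ d
    open Reweighting k′ z ends dense
    open LocalMinimum k′ z ends dense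

    private
      tail head : Fin m → Fin n
      tail = proj₁ ∘ ends
      head = proj₂ ∘ ends

      degree : Fin d → ℤ
      degree v = ℤΣ.sum λ e → V.δ (tail e) (punchIn z v) ℤ.+ V.δ (head e) (punchIn z v)

      half : ℚ
      half = inv (1ℚ + 1ℚ)

      half+half≡1 : half + half ≡ 1ℚ
      half+half≡1 = trans (lem half) (inv-inverse 0<2)
        where
        lem : ∀ h → h + h ≡ h * (1ℚ + 1ℚ)
        lem = solve-∀ ℚ-ring

      0<half : 0ℚ < half
      0<half = 0<inv 0<2

      module Rounding (h : Index → ℕ) (loaded : Loaded h) (T : Fin d → ℤ)
                      (feasible : Feasible h loaded (λ v → ℤ.- degree v) T) where

        B = green h
        G = green-Green h
        b : Vector
        b = demand h loaded (λ v → ℤ.- degree v) T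
        f : Fin m → ℚ
        f e = s ^ h (inj₁ e) * B b (edge e)

        leak : Fin d → ℚ
        leak v = B b (δ v) + s ^ h (inj₂ v) * B b (δ v)

        f≤1 : ∀ e → f e ≤ 1ℚ
        f≤1 e = proj₁ (feasible (inj₁ e))

        -f≤1 : ∀ e → - f e ≤ 1ℚ
        -f≤1 e = proj₂ (feasible (inj₁ e))

        weaken : ∀ {c p} → 1ℚ ≤ c → c * p ≤ θ → p ≤ θ
        weaken {c} {p} 1≤c cp≤θ = by (≤-total 0ℚ p)
          where
          by : 0ℚ ≤ p ⊎ p ≤ 0ℚ → p ≤ θ
          by (inj₁ 0≤p) = ≤-trans (subst (_≤ c * p) (*-identityˡ p) (*-monoʳ-≤-nonNeg p {{nonNegative 0≤p}} 1≤c)) cp≤θ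
          by (inj₂ p≤0) = ≤-trans p≤0 (<⇒≤ 0<θ)

        leak≤ν : ∀ v → leak v ≤ ν
        leak≤ν v = subst (leak v ≤_) θ+θ≡ν (+-mono-≤ (weaken (1≤^ (h (inj₂ v)) 1≤s) q) q)
          where q = proj₁ (feasible (inj₂ v))

        -leak≤ν : ∀ v → - leak v ≤ ν
        -leak≤ν v = subst₂ _≤_ (sym (lem (B b (δ v)) (s ^ h (inj₂ v)))) θ+θ≡ν
          (+-mono-≤ (weaken (1≤^ (h (inj₂ v)) 1≤s) q) q)
          where
          lem : ∀ p c → - (p + c * p) ≡ - p + c * - p
          lem = solve-∀ ℚ-ring
          lem₂ : ∀ p c → - (c * p) ≡ c * - p
          lem₂ = solve-∀ ℚ-ring
          q : s ^ h (inj₂ v) * - B b (δ v) ≤ θ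
          q = subst (_≤ θ) (lem₂ (B b (δ v)) (s ^ h (inj₂ v))) (proj₂ (feasible (inj₂ v)))

        -- Kirchhoff's law: the demand at `v` leaves through its two auxiliary edges or through the
        -- edges of the graph.
        divergence : ∀ v → b v ≡ leak v + sum (λ e → f e * edge e v)
        divergence v = trans (current G b v) (trans
          (cong (B b (δ v) +_) (trans (asum-indices (λ (c , w) → c * B b w * w v) h)
            (cong (_+ sum (λ e → f e * edge e v)) (sum-δ (λ u → s ^ h (inj₂ u) * B b (δ u)) v))))
          (sym (+-assoc (B b (δ v)) _ _)))

        -- The common denominator 1 + 2 d m of the rounded shares. Rounding costs at most m at each
        -- of d vertices and the leakage at most S / 2 in all; d m + S / 2 < S is what
        -- `round-orientation` requires.
        S : ℕ
        S = suc (d ℕ.* m ℕ.+ d ℕ.* m)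

        -- A current f in [-1, 1] splits an edge into the share (1 + f) / 2 leaving its tail and (1
        -- - f) / 2 leaving its head.
        y : Fin m → ℚ
        y e = half * (1ℚ + f e)

        0≤y : ∀ e → 0ℚ ≤ y e
        0≤y e = 0≤* (<⇒≤ 0<half) (subst (0ℚ ≤_) (lem (f e)) (0≤q-p (-f≤1 e)))
          where
          lem : ∀ f → 1ℚ - - f ≡ 1ℚ + f
          lem = solve-∀ ℚ-ring

        y≤1 : ∀ e → y e ≤ 1ℚ
        y≤1 e = ≤-trans (*-monoˡ-≤-nonNeg half {{nonNegative (<⇒≤ 0<half)}} (+-monoʳ-≤ 1ℚ (f≤1 e)))
          (≤-reflexive (inv-inverse 0<2))

        rounded : ∀ e → ∃ λ X → # X ≤ # S * y e × # S * y e < # (suc X)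
        rounded e = floor-of (# S * y e) (0≤* (0≤# S) (0≤y e))

        X : Fin m → ℕ
        X e = proj₁ (rounded e)

        X≤S : ∀ e → X e ℕ.≤ S
        X≤S e = #-cancel-≤ (≤-trans (proj₁ (proj₂ (rounded e)))
          (subst (# S * y e ≤_) (*-identityʳ (# S)) (*-monoˡ-≤-nonNeg (# S) {{nonNegative (0≤# S)}} (y≤1 e))))

        r : Fin m → ℚ
        r e = # S * y e - # (X e)

        0≤r : ∀ e → 0ℚ ≤ r e
        0≤r e = 0≤q-p (proj₁ (proj₂ (rounded e)))

        r≤1 : ∀ e → r e ≤ 1ℚ
        r≤1 e = subst (r e ≤_) (lem (# (X e))) (+-monoˡ-≤ (- # (X e))
          (≤-trans (<⇒≤ (proj₂ (proj₂ (rounded e)))) (≤-reflexive (#-suc (X e)))))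
          where
          lem : ∀ x → 1ℚ + x - x ≡ 1ℚ
          lem = solve-∀ ℚ-ring

        -- Half the sum of the degree and the demand 2 k T - degree.
        target : Fin d → ℤ
        target v = ℤ.+ k ℤ.* T v

        deviation : Fin d → ℤ
        deviation v = fractionalOutdegree tail head S X (punchIn z v) ℤ.- ℤ.+ S ℤ.* target v

        ta hd : Fin m → Fin d → ℚ
        ta e v = ι (V.δ (tail e) (punchIn z v))
        hd e v = ι (V.δ (head e) (punchIn z v))

        edge-split : ∀ e v → edge e v ≡ ta e v - hd e v
        edge-split e v = trans (ι-+ (V.δ (tail e) (punchIn z v)) (ℤ.- V.δ (head e) (punchIn z v)))
          (cong (ta e v +_) (ι-neg (V.δ (head e) (punchIn z v))))

        ι-share : ∀ e v → ι (ℤ.+ X e ℤ.* V.δ (tail e) (punchIn z v) ℤ.+ (ℤ.+ S ℤ.- ℤ.+ X e) ℤ.* V.δ (head e) (punchIn z v))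
                          ≡ # (X e) * ta e v + (# S - # (X e)) * hd e v
        ι-share e v = trans (ι-+ (ℤ.+ X e ℤ.* t) _) (cong₂ _+_ (ι-* (ℤ.+ X e) t)
          (trans (ι-* (ℤ.+ S ℤ.- ℤ.+ X e) w) (cong (_* ι w) (trans (ι-+ (ℤ.+ S) (ℤ.- ℤ.+ X e)) (cong (# S +_) (ι-neg (ℤ.+ X e)))))))
          where
          t = V.δ (tail e) (punchIn z v)
          w = V.δ (head e) (punchIn z v)

        ι-fractional : ∀ v → ι (fractionalOutdegree tail head S X (punchIn z v)) ≡
          half * # S * sum (λ e → f e * edge e v) + half * # S * ι (degree v) - sum (λ e → r e * edge e v)
        ι-fractional v = trans
          (ι-sum (λ e → ℤ.+ X e ℤ.* V.δ (tail e) (punchIn z v) ℤ.+ (ℤ.+ S ℤ.- ℤ.+ X e) ℤ.* V.δ (head e) (punchIn z v)))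
          (trans (sum-cong-≗ (λ e → ι-share e v)) (trans (collect (λ e → e))
            (cong (λ q → half * # S * sum (λ e → f e * edge e v) + half * # S * q - sum (λ e → r e * edge e v))
              (sym (trans (ι-sum (λ e → V.δ (tail e) (punchIn z v) ℤ.+ V.δ (head e) (punchIn z v)))
                (sum-cong-≗ λ e → ι-+ (V.δ (tail e) (punchIn z v)) (V.δ (head e) (punchIn z v))))))))
          where
          term : ∀ e → # (X e) * ta e v + (# S - # (X e)) * hd e v ≡
            half * # S * (f e * edge e v) + half * # S * (ta e v + hd e v) - r e * edge e v
          term e = begin
            # (X e) * ta e v + (# S - # (X e)) * hd e v
              ≡⟨ cong (λ S → # (X e) * ta e v + (S - # (X e)) * hd e v) (*-identityˡ (# S)) ⟨
            # (X e) * ta e v + (1ℚ * # S - # (X e)) * hd e v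
              ≡⟨ cong (λ o → # (X e) * ta e v + (o * # S - # (X e)) * hd e v) half+half≡1 ⟨
            # (X e) * ta e v + ((half + half) * # S - # (X e)) * hd e v
              ≡⟨ lem (# (X e)) (# S) half (f e) (ta e v) (hd e v) ⟩
            half * # S * (f e * (ta e v - hd e v)) + half * # S * (ta e v + hd e v) - r e * (ta e v - hd e v)
              ≡⟨ cong (λ w → half * # S * (f e * w) + half * # S * (ta e v + hd e v) - r e * w) (edge-split e v) ⟨
            half * # S * (f e * edge e v) + half * # S * (ta e v + hd e v) - r e * edge e v ∎
            where
            open ≡-Reasoning
            lem : ∀ X S h f t w → X * t + ((h + h) * S - X) * w ≡
              h * S * (f * (t - w)) + h * S * (t + w) - (S * (h * (1ℚ + f)) - X) * (t - w)
            lem = solve-∀ ℚ-ring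
          collect : ∀ {n} (g : Fin n → Fin m) →
            sum (λ i → # (X (g i)) * ta (g i) v + (# S - # (X (g i))) * hd (g i) v) ≡
            half * # S * sum (λ i → f (g i) * edge (g i) v) + half * # S * sum (λ i → ta (g i) v + hd (g i) v)
              - sum (λ i → r (g i) * edge (g i) v)
          collect {zero}  g = sym (lem half (# S))
            where
            lem : ∀ h S → h * S * 0ℚ + h * S * 0ℚ - 0ℚ ≡ 0ℚ
            lem = solve-∀ ℚ-ring
          collect {suc n} g = trans (cong₂ _+_ (term (g zero)) (collect (g ∘ suc)))
            (lem (half * # S) (f (g zero) * edge (g zero) v) (ta (g zero) v + hd (g zero) v) (r (g zero) * edge (g zero) v) _ _ _)
            where
            lem : ∀ h a b c p q s → (h * a + h * b - c) + (h * p + h * q - s) ≡ h * (a + p) + h * (b + q) - (c + s)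
            lem = solve-∀ ℚ-ring

        R : Fin d → ℚ
        R v = sum (λ e → r e * edge e v)

        -- Without leakage and rounding the shares would meet the target exactly. The two error
        -- terms are the rounding remainders `R` and half the leakage, on the scale of S.
        ι-deviation : ∀ v → ι (deviation v) ≡ - (R v + half * # S * leak v)
        ι-deviation v = begin
          ι (deviation v)
            ≡⟨ trans (ι-+ F (ℤ.- (ℤ.+ S ℤ.* target v))) (cong (ι F +_) (trans (ι-neg _)
                 (cong -_ (trans (ι-* (ℤ.+ S) (target v)) (cong (# S *_) (ι-* (ℤ.+ k) (T v))))))) ⟩
          ι F - # S * (κ * ι (T v))
            ≡⟨ cong (_- # S * (κ * ι (T v))) (ι-fractional v) ⟩
          half * # S * Φ + half * # S * ι (degree v) - R v - # S * (κ * ι (T v))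
            ≡⟨ lem₁ half (# S) Φ (leak v) (ι (degree v)) (R v) κ (ι (T v)) ⟩
          half * # S * (leak v + Φ) + half * # S * (ι (degree v) - leak v) - R v - 1ℚ * # S * (κ * ι (T v))
            ≡⟨ cong₂ (λ p o → half * # S * p + half * # S * (ι (degree v) - leak v) - R v - o * # S * (κ * ι (T v)))
                     (trans (sym (divergence v)) b≡) (sym half+half≡1) ⟩
          half * # S * (- ι (degree v) + (κ + κ) * ι (T v)) + half * # S * (ι (degree v) - leak v) - R v - (half + half) * # S * (κ * ι (T v))
            ≡⟨ lem₂ half (# S) (leak v) (ι (degree v)) (R v) κ (ι (T v)) ⟩
          - (R v + half * # S * leak v) ∎
          where
          open ≡-Reasoning
          F = fractionalOutdegree tail head S X (punchIn z v)
          Φ = sum (λ e → f e * edge e v)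
          b≡ : b v ≡ - ι (degree v) + (κ + κ) * ι (T v)
          b≡ = trans (ι-+ (ℤ.- degree v) _) (cong₂ _+_ (ι-neg (degree v))
            (trans (ι-* (ℤ.+ (k ℕ.+ k)) (T v)) (cong (_* ι (T v)) (#-+ k k))))
          lem₁ : ∀ h S Φ l D R κ T → h * S * Φ + h * S * D - R - S * (κ * T) ≡
            h * S * (l + Φ) + h * S * (D - l) - R - 1ℚ * S * (κ * T)
          lem₁ = solve-∀ ℚ-ring
          lem₂ : ∀ h S l D R κ T → h * S * (- D + (κ + κ) * T) + h * S * (D - l) - R - (h + h) * S * (κ * T) ≡
            - (R + h * S * l)
          lem₂ = solve-∀ ℚ-ring

        edge≤1 : ∀ e v → edge e v ≤ 1ℚ × - edge e v ≤ 1ℚ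
        edge≤1 e v = by (edgeVector e v) (V.∣δ-δ∣≤1 (tail e) (head e) (punchIn z v))
          where
          by : ∀ i → ℤ.∣ i ∣ ℕ.≤ 1 → ι i ≤ 1ℚ × - ι i ≤ 1ℚ
          by i le = subst (ι i ≤_) ι-1 (ι-mono-≤ (upper i le)) ,
                    subst₂ _≤_ (ι-neg i) ι-1 (ι-mono-≤ (upper (ℤ.- i) (subst (ℕ._≤ 1) (sym (ℤₚ.∣-i∣≡∣i∣ i)) le)))
            where
            upper : ∀ i → ℤ.∣ i ∣ ℕ.≤ 1 → i ℤ.≤ ℤ.+ 1
            upper (ℤ.+ n)    le = ℤ.+≤+ le
            upper ℤ.-[1+ n ] le = ℤ.-≤+

        R≤m : ∀ v → R v ≤ # m × - R v ≤ # m
        R≤m v = subst (R v ≤_) m≡ (sum-mono (λ e → r e * edge e v) (λ _ → 1ℚ) λ e → times (0≤r e) (r≤1 e) (proj₁ (edge≤1 e v))) ,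
                subst₂ _≤_ negated m≡ (sum-mono (λ e → r e * - edge e v) (λ _ → 1ℚ) λ e → times (0≤r e) (r≤1 e) (proj₂ (edge≤1 e v)))
          where
          m≡ : sum {m} (λ _ → 1ℚ) ≡ # m
          m≡ = trans (sum-const m 1ℚ) (*-identityʳ (# m))
          times : ∀ {p q} → 0ℚ ≤ p → p ≤ 1ℚ → q ≤ 1ℚ → p * q ≤ 1ℚ
          times {p} {q} 0≤p p≤1 q≤1 = ≤-trans (*-monoˡ-≤-nonNeg p {{nonNegative 0≤p}} q≤1) (≤-trans (≤-reflexive (*-identityʳ p)) p≤1)
          negated : sum (λ e → r e * - edge e v) ≡ - R v
          negated = trans (sum-cong-≗ λ e → lem (r e) (edge e v)) (trans (sum-linear 1ℚ (λ _ → 0ℚ) (λ e → r e * edge e v))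
            (trans (cong (_- 1ℚ * R v) (trans (sum-const m 0ℚ) (*-zeroʳ (# m)))) (lem₂ (R v))))
            where
            lem : ∀ r e → r * - e ≡ 0ℚ - 1ℚ * (r * e)
            lem = solve-∀ ℚ-ring
            lem₂ : ∀ R → 0ℚ - 1ℚ * R ≡ - R
            lem₂ = solve-∀ ℚ-ring

        bound : ℚ
        bound = # m + half * # S * ν

        0≤hS : 0ℚ ≤ half * # S
        0≤hS = 0≤* (<⇒≤ 0<half) (0≤# S)

        deviation-bound : ∀ v → ι (ℤ.+ ℤ.∣ deviation v ∣) ≤ bound
        deviation-bound v = ∣∣-bound (deviation v)
          (subst (_≤ bound) (trans (lem (R v) (half * # S) (leak v)) (sym (ι-deviation v)))
            (+-mono-≤ (proj₂ (R≤m v)) (*-monoˡ-≤-nonNeg (half * # S) {{nonNegative 0≤hS}} (-leak≤ν v))))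
          (subst (_≤ bound) (trans (lem₂ (R v) (half * # S * leak v)) (cong -_ (sym (ι-deviation v))))
            (+-mono-≤ (proj₁ (R≤m v)) (*-monoˡ-≤-nonNeg (half * # S) {{nonNegative 0≤hS}} (leak≤ν v))))
          where
          lem : ∀ R h l → - R + h * - l ≡ - (R + h * l)
          lem = solve-∀ ℚ-ring
          lem₂ : ∀ R l → R + l ≡ - - (R + l)
          lem₂ = solve-∀ ℚ-ring

        total-deviation : ℤΣ.sum (λ v → ℤ.+ ℤ.∣ deviation v ∣) ℤ.< ℤ.+ S
        total-deviation = ι-cancel-< (≤-<-trans
          (≤-trans (≤-reflexive (ι-sum (λ v → ℤ.+ ℤ.∣ deviation v ∣)))
            (≤-trans (sum-mono (λ v → ι (ℤ.+ ℤ.∣ deviation v ∣)) (λ _ → bound) deviation-bound) (≤-reflexive (sum-const d bound))))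
          (≤-<-trans d*bound≤ strict))
          where
          d*bound≤ : # d * bound ≤ # d * # m + half * # S
          d*bound≤ = subst₂ _≤_ (lem (# d) (# m) (half * # S) ν) (cong (# d * # m +_) (*-identityʳ (half * # S)))
            (+-monoʳ-≤ (# d * # m) (*-monoˡ-≤-nonNeg (half * # S) {{nonNegative 0≤hS}} νd≤1))
            where
            lem : ∀ d m h ν → d * m + h * (ν * d) ≡ d * (m + h * ν)
            lem = solve-∀ ℚ-ring
          S≡ : # S ≡ 1ℚ + (# d * # m + # d * # m)
          S≡ = trans (#-suc (d ℕ.* m ℕ.+ d ℕ.* m)) (cong (1ℚ +_) (trans (#-+ (d ℕ.* m) (d ℕ.* m)) (cong₂ _+_ (#-* d m) (#-* d m))))
          Q = # d * # m
          double : Q + half * # S + half ≡ # S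
          double = begin
            Q + half * # S + half                            ≡⟨ cong (λ q → q + half * # S + half) (sym (*-identityˡ Q)) ⟩
            1ℚ * Q + half * # S + half                       ≡⟨ cong (λ o → o * Q + half * # S + half) (sym half+half≡1) ⟩
            (half + half) * Q + half * # S + half            ≡⟨ lem half Q (# S) ⟩
            half * # S + half * (1ℚ + (Q + Q))               ≡⟨ cong (λ S′ → half * # S + half * S′) S≡ ⟨
            half * # S + half * # S                          ≡⟨ lem₂ half (# S) ⟩
            (half + half) * # S                              ≡⟨ trans (cong (_* # S) half+half≡1) (*-identityˡ (# S)) ⟩
            # S ∎
            where
            open ≡-Reasoning
            lem : ∀ h Q S → (h + h) * Q + h * S + h ≡ h * S + h * (1ℚ + (Q + Q))
            lem = solve-∀ ℚ-ring
            lem₂ : ∀ h S → h * S + h * S ≡ (h + h) * S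
            lem₂ = solve-∀ ℚ-ring
          strict : Q + half * # S < # S
          strict = subst₂ _<_ (+-identityʳ (Q + half * # S)) double (+-monoʳ-< (Q + half * # S) 0<half)

        orientation : ∃ λ o → ∀ v → outdegree tail head o (punchIn z v) ≡ target v
        orientation = round-orientation tail head (punchIn z) S X X≤S target total-deviation

    ModularOrientation : Set
    ModularOrientation = ∃ λ (o : Fin m → Bool) → ∀ v → ∃ λ t → outdegree tail head o (punchIn z v) ≡ ℤ.+ k ℤ.* t

    modular-orientation : ModularOrientation
    modular-orientation = with-weights reweight
      where
      with-demand : ∀ h loaded → ∃ (Feasible h loaded (λ v → ℤ.- degree v)) → ModularOrientation
      with-demand h loaded (T , feas) = proj₁ orientation , λ v → T v , proj₂ orientation v
        where open Rounding h loaded T feas using (orientation)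
      with-weights : ∃ Loaded → ModularOrientation
      with-weights (h , loaded) = with-demand h loaded (feasible h loaded (λ v → ℤ.- degree v))

-- Orientations with outdegrees divisible by k, including the small cases.

module Assembly where
  open import Defs
  open import Data.Integer.Base hiding (suc)
  open import Data.Integer.Properties
  open import Data.Integer.Tactic.RingSolver using (solve-∀)
  open import Algebra.Properties.AbelianGroup +-0-abelianGroup using (∙-cancelˡ; ∙-cancelʳ)
  open import Algebra.Properties.Semiring.Sum +-*-semiring
    using (sum; sum-cong-≗; ∑-distrib-+; ∑-comm; sum-remove)
  open import Algebra.Properties.CommutativeMonoid.Sum ℕₚ.+-0-commutativeMonoid
    using () renaming (sum to sumℕ)
  open Balancing
  open Forests using (Dense; sumˡ-allFin)
  open Density using (trees-dense; edge-connected-dense)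
  open Electrical using (module Orientation)

  Even : ℤ → Set
  Even x = ∃ λ t → x ≡ + 2 * t

  even-+ : ∀ {x y} → Even x → Even y → Even (x + y)
  even-+ (s , refl) (t , refl) = s + t , sym (*-distribˡ-+ (+ 2) s t)

  even-neg : ∀ {x} → Even x → Even (- x)
  even-neg (s , refl) = - s , neg-distribʳ-* (+ 2) s

  even-or-odd : ∀ x → Even x ⊎ Even (x - 1ℤ)
  even-or-odd (+ n) = natural n
    where
    back : ∀ x → 1ℤ + x - 1ℤ ≡ x
    back = solve-∀
    forth : ∀ t → 1ℤ + (+ 2 * t + 1ℤ) ≡ + 2 * (1ℤ + t)
    forth = solve-∀
    restore : ∀ x → x ≡ x - 1ℤ + 1ℤ
    restore = solve-∀
    natural : ∀ n → Even (+ n) ⊎ Even (+ n - 1ℤ)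
    natural zero = inj₁ (0ℤ , refl)
    natural (suc n) with natural n
    ... | inj₁ (t , eq) = inj₂ (t , trans (back (+ n)) eq)
    ... | inj₂ (t , eq) = inj₁ (1ℤ + t , trans (cong (_+_ 1ℤ) (trans (restore (+ n)) (cong (_+ 1ℤ) eq))) (forth t))
  even-or-odd -[1+ n ] with even-or-odd (+ suc n)
  ... | inj₁ e = inj₁ (even-neg e)
  ... | inj₂ (t , eq) = inj₂ (- t - 1ℤ , trans (flip (+ suc n)) (trans (cong (λ x → - x - + 2) eq) (lem t)))
    where
    flip : ∀ x → - x - 1ℤ ≡ - (x - 1ℤ) - + 2
    flip = solve-∀
    lem : ∀ t → - (+ 2 * t) - + 2 ≡ + 2 * (- t - 1ℤ)
    lem = solve-∀

  module _ (G : Graph) where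

    private
      u w : Fin (m G) → Fin (n G)
      u e = proj₁ (ends G e)
      w e = proj₂ (ends G e)

      out : (Fin (m G) → Bool) → Fin (n G) → ℤ
      out = outdegree u w

      flip : (Fin (m G) → Bool) → Fin (m G) → Fin (m G) → Bool
      flip o e f = if does (f Fin.≟ e) then not (o f) else o f

      flip-out : ∀ o e v → out (flip o e) v ≡ out o v - sgn (o e) (V.δ (u e) v - V.δ (w e) v)
      flip-out o e v = ∙-cancelʳ (term o e) _ _ (trans
        (sum-change (term (flip o e)) (term o) e λ f f≢e →
          cong (λ b → if (if b then not (o f) else o f) then V.δ (u f) v else V.δ (w f) v) (dec-false (f Fin.≟ e) f≢e))
        (trans (cong (λ b → out o v + (if (if b then not (o e) else o e) then V.δ (u e) v else V.δ (w e) v)) (dec-true (e Fin.≟ e) refl))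
               (by (o e))))
        where
        term : (Fin (m G) → Bool) → Fin (m G) → ℤ
        term o f = if o f then V.δ (u f) v else V.δ (w f) v
        lem : ∀ x a b → x + b ≡ x - (a - b) + a
        lem = solve-∀
        lem₂ : ∀ x a b → x + a ≡ x - - (a - b) + b
        lem₂ = solve-∀
        by : ∀ b → out o v + (if not b then V.δ (u e) v else V.δ (w e) v) ≡
             out o v - sgn b (V.δ (u e) v - V.δ (w e) v) + (if b then V.δ (u e) v else V.δ (w e) v)
        by true  = lem (out o v) (V.δ (u e) v) (V.δ (w e) v)
        by false = lem₂ (out o v) (V.δ (u e) v) (V.δ (w e) v)

      even-sgn : ∀ b x → Even (sgn b x + x)
      even-sgn true  x = x , lem x
        where
        lem : ∀ x → x + x ≡ + 2 * x
        lem = solve-∀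
      even-sgn false x = 0ℤ , +-inverseˡ x

      even-sgn- : ∀ b x → Even (sgn b x - x)
      even-sgn- true  x = 0ℤ , +-inverseʳ x
      even-sgn- false x = - x , lem x
        where
        lem : ∀ x → - x - x ≡ + 2 * - x
        lem = solve-∀

      -- Modulo 2 the direction in which an edge is flipped is irrelevant, so a walk that repeats
      -- edges is as good as a path: the contributions of its inner vertices cancel.
      reverse-path : ∀ {x y} → Reach G (allEdges G) x y → ∀ o →
        ∃ λ o′ → ∀ v → Even (out o′ v - out o v - (V.δ x v - V.δ y v))
      reverse-path {x} here o = o , λ v → 0ℤ , lem (out o v) (V.δ x v)
        where
        lem : ∀ a d → a - a - (d - d) ≡ 0ℤ
        lem = solve-∀
      reverse-path {y = y} (fwd e _ refl r) o with reverse-path r (flip o e)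
      ... | o′ , even = o′ , λ v → subst Even
        (trans (cong (λ x → (out o′ v - x - (V.δ (w e) v - V.δ y v))
                          + - (sgn (o e) (V.δ (u e) v - V.δ (w e) v) + (V.δ (u e) v - V.δ (w e) v))) (flip-out o e v))
               (lem (out o′ v) (out o v) (V.δ (u e) v) (V.δ (w e) v) (V.δ y v) (sgn (o e) (V.δ (u e) v - V.δ (w e) v))))
        (even-+ (even v) (even-neg (even-sgn (o e) (V.δ (u e) v - V.δ (w e) v))))
        where
        lem : ∀ a b u w y s → (a - (b - s) - (w - y)) + - (s + (u - w)) ≡ a - b - (u - y)
        lem = solve-∀
      reverse-path {y = y} (bwd e _ refl r) o with reverse-path r (flip o e)
      ... | o′ , even = o′ , λ v → subst Even
        (trans (cong (λ x → (out o′ v - x - (V.δ (u e) v - V.δ y v))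
                          + - (sgn (o e) (V.δ (u e) v - V.δ (w e) v) - (V.δ (u e) v - V.δ (w e) v))) (flip-out o e v))
               (lem (out o′ v) (out o v) (V.δ (u e) v) (V.δ (w e) v) (V.δ y v) (sgn (o e) (V.δ (u e) v - V.δ (w e) v))))
        (even-+ (even v) (even-neg (even-sgn- (o e) (V.δ (u e) v - V.δ (w e) v))))
        where
        lem : ∀ a b u w y s → (a - (b - s) - (u - y)) + - (s - (u - w)) ≡ a - b - (w - y)
        lem = solve-∀

    -- Flipping a walk to `z` changes parities only at its first vertex and at `z`, so vertices
    -- already treated stay even.
    even-orientation : Connected G (allEdges G) → ∀ z → ∃ λ o → ∀ v → v ≢ z → Even (out o v)
    even-orientation conn z with go (allFin (n G))
      where
      go : ∀ vs → ∃ λ o → ∀ v → v ∈ vs → v ≢ z → Even (out o v)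
      go []       = (λ _ → true) , λ _ ()
      go (x ∷ vs) with go vs
      ... | o , even = by (x Fin.≟ z) (even-or-odd (out o x))
        where
        by : Dec (x ≡ z) → Even (out o x) ⊎ Even (out o x - 1ℤ) → ∃ λ o → ∀ v → v ∈ x ∷ vs → v ≢ z → Even (out o v)
        by (yes refl) _ = o , λ { v (here refl) v≢z → ⊥-elim (v≢z refl) ; v (there v∈) v≢z → even v v∈ v≢z }
        by (no _) (inj₁ ev) = o , λ { v (here refl) _ → ev ; v (there v∈) v≢z → even v v∈ v≢z }
        by (no x≢z) (inj₂ odd) with reverse-path (conn x z) o
        ... | o′ , change = o′ , λ v v∈ v≢z → fixed v v∈ v≢z (x Fin.≟ v)
          where
          restore : ∀ a b d → a - b - (d - 0ℤ) + (b - d) + (d + d) ≡ a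
          restore = solve-∀
          double : ∀ d → d + d ≡ + 2 * d
          double = solve-∀
          off-z : ∀ v → v ≢ z → V.δ z v ≡ 0ℤ
          off-z v v≢z = V.δ-off (v≢z ∘ sym)
          settle : ∀ v → v ≢ z → Even (out o v - V.δ x v) → Even (out o′ v)
          settle v v≢z ev = subst Even
            (trans (cong (λ c → out o′ v - out o v - (V.δ x v - c) + (out o v - V.δ x v) + (V.δ x v + V.δ x v)) (off-z v v≢z))
                   (restore (out o′ v) (out o v) (V.δ x v)))
            (even-+ (even-+ (change v) ev) (V.δ x v , double (V.δ x v)))
          fixed : ∀ v → v ∈ x ∷ vs → v ≢ z → Dec (x ≡ v) → Even (out o′ v)
          fixed v _ v≢z (yes refl) = settle v v≢z (subst (λ d → Even (out o x - d)) (sym (V.δ-diag x)) odd)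
          fixed v (here refl) v≢z (no x≢v) = ⊥-elim (x≢v refl)
          fixed v (there v∈) v≢z (no x≢v) = settle v v≢z
            (subst (λ d → Even (out o v - d)) (sym (V.δ-off x≢v)) (subst Even (sym (+-identityʳ _)) (even v v∈ v≢z)))
    ... | o , even = o , λ v v≢z → even v (∈-allFin v) v≢z

    -- The case k = 2 is separate because two disjoint spanning trees guarantee only 2 (q - 1)
    -- crossing edges, one fewer than density demands. Connectedness suffices there.
    modulo-orientation : ∀ z k → 1 ℕ.≤ k → EdgeConnected (3 ℕ.* k ℕ.∸ 3) G ⊎ TreeConnected (2 ℕ.* k ℕ.∸ 2) G →
      ∃ λ o → ∀ v → v ≢ z → ∃ λ t → out o v ≡ + k * t
    modulo-orientation z 1 _ _ = (λ _ → true) , λ v _ → out (λ _ → true) v , sym (*-identityˡ _)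
    modulo-orientation z 2 _ hyp = even-orientation (connected hyp) z
      where
      size-∅ : size G (λ _ → false) ℕ.< 3
      size-∅ = ℕ.s≤s (ℕₚ.≤-trans (ℕₚ.≤-reflexive (zeros (allFin (m G)))) ℕ.z≤n)
        where
        zeros : ∀ es → sumˡ (map (λ (_ : Fin (m G)) → 0) es) ≡ 0
        zeros []       = refl
        zeros (_ ∷ es) = zeros es
      widen : ∀ {S x y} → Reach G S x y → Reach G (allEdges G) x y
      widen here          = here
      widen (fwd e _ p r) = fwd e refl p (widen r)
      widen (bwd e _ p r) = bwd e refl p (widen r)
      connected : EdgeConnected 3 G ⊎ TreeConnected 2 G → Connected G (allEdges G)
      connected (inj₁ conn)       x y = conn (λ _ → false) size-∅ x y
      connected (inj₂ (_ , tree)) x y = widen (proj₁ (tree zero) x y)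
    modulo-orientation z (suc (suc (suc j))) _ hyp = dense-case G z (dense hyp)
      where
      dense : EdgeConnected (3 ℕ.* (3 ℕ.+ j) ℕ.∸ 3) G ⊎ TreeConnected (2 ℕ.* (3 ℕ.+ j) ℕ.∸ 2) G → Dense (ends G) (3 ℕ.+ j)
      dense (inj₁ conn)  = edge-connected-dense G j conn
      dense (inj₂ trees) = trees-dense G j trees
      dense-case : ∀ G z → Dense (ends G) (3 ℕ.+ j) →
        ∃ λ o → ∀ v → v ≢ z → ∃ λ t → outdegree (proj₁ ∘ ends G) (proj₂ ∘ ends G) o v ≡ + (3 ℕ.+ j) * t
      dense-case record { n = suc d ; ends = ends } z dense = extend modular-orientation
        where
        open Orientation (suc (suc j)) z ends dense
        extend : ModularOrientation → ∃ λ o → ∀ v → v ≢ z → ∃ λ t → outdegree (proj₁ ∘ ends) (proj₂ ∘ ends) o v ≡ + (3 ℕ.+ j) * t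
        extend (o , divisible) = o , λ v v≢z → subst
          (λ v → ∃ λ t → outdegree (proj₁ ∘ ends) (proj₂ ∘ ends) o v ≡ + (3 ℕ.+ j) * t)
          (Fin.punchIn-punchOut (v≢z ∘ sym)) (divisible (punchOut (v≢z ∘ sym)))

  -- Shares of the colours and the resulting decomposition.

  +-sum : ∀ {n} (f : Fin n → ℕ) → + sumℕ f ≡ sum (λ i → + f i)
  +-sum {zero}  f = refl
  +-sum {suc n} f = cong (_+_ (+ f zero)) (+-sum (f ∘ suc))

  ∣sum∣≤ : ∀ {n} B (f : Fin n → ℤ) → (∀ i → ∣ f i ∣ ℕ.≤ B) → ∣ sum f ∣ ℕ.≤ n ℕ.* B
  ∣sum∣≤ {zero}  B f le = ℕ.z≤n
  ∣sum∣≤ {suc n} B f le = ℕₚ.≤-trans (∣i+j∣≤∣i∣+∣j∣ (f zero) _) (ℕₚ.+-mono-≤ (le zero) (∣sum∣≤ B (f ∘ suc) (le ∘ suc)))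

  -- The difference is the sum of x i - x j over all j ≠ i. It has one term fewer than there are
  -- colours, which makes the final inequalities strict.
  share-deviation : ∀ {k} (x : Fin (suc k) → ℤ) B → (∀ i j → ∣ x i - x j ∣ ℕ.≤ B) →
                    ∀ i → ∣ + suc k * x i - sum x ∣ ℕ.≤ k ℕ.* B
  share-deviation {k} x B close i = subst (λ y → ∣ y ∣ ℕ.≤ k ℕ.* B) (sym total)
    (∣sum∣≤ B (λ j → x i - x (punchIn i j)) λ j → close i (punchIn i j))
    where
    open ≡-Reasoning
    total : + suc k * x i - sum x ≡ sum (λ j → x i - x (punchIn i j))
    total = begin
      + suc k * x i - sum x                                ≡⟨ cong (_- sum x) (sum-const (suc k) (x i)) ⟨
      sum {suc k} (λ _ → x i) - sum x                      ≡⟨ sum-- {suc k} (λ _ → x i) x ⟨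
      sum (λ j → x i - x j)                                ≡⟨ sum-remove {i = i} (λ j → x i - x j) ⟩
      x i - x i + sum (λ j → x i - x (punchIn i j))        ≡⟨ cong (_+ sum (λ j → x i - x (punchIn i j))) (+-inverseʳ (x i)) ⟩
      0ℤ + sum (λ j → x i - x (punchIn i j))               ≡⟨ +-identityˡ _ ⟩
      sum (λ j → x i - x (punchIn i j)) ∎

  -- By `share-deviation` the multiple `suc k` (x i - t) has absolute value at most k, so it is 0.
  divisible-share : ∀ {k} (x : Fin (suc k) → ℤ) t → sum x ≡ + suc k * t → (∀ i j → ∣ x i - x j ∣ ℕ.≤ 1) → ∀ i → x i ≡ t
  divisible-share {k} x t total close i = i-j≡0⇒i≡j (x i) t (∣i∣≡0⇒i≡0 (vanish ∣ x i - t ∣ (ℕₚ.≤-trans (ℕₚ.≤-reflexive eq)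
      (ℕₚ.≤-trans (share-deviation x 1 close i) (ℕₚ.≤-reflexive (ℕₚ.*-identityʳ k))))))
    where
    lem : ∀ k x t → k * (x - t) ≡ k * x - k * t
    lem = solve-∀
    eq : suc k ℕ.* ∣ x i - t ∣ ≡ ∣ + suc k * x i - sum x ∣
    eq = trans (sym (abs-* (+ suc k) (x i - t))) (cong ∣_∣ (trans (lem (+ suc k) (x i) t) (cong (λ y → + suc k * x i - y) (sym total))))
    vanish : ∀ a → suc k ℕ.* a ℕ.≤ k → a ≡ 0
    vanish zero    _  = refl
    vanish (suc a) le = ⊥-elim (ℕₚ.<⇒≱ (ℕₚ.≤-trans (ℕₚ.m≤m*n (suc k) (suc a)) le) ℕₚ.≤-refl)

  module Decomposition (G : Graph) (z : Fin (n G)) (k′ : ℕ) (o : Fin (m G) → Bool)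
    (divisible : ∀ v → v ≢ z → ∃ λ t → outdegree (proj₁ ∘ ends G) (proj₂ ∘ ends G) o v ≡ + suc k′ * t) where

    private
      k = suc k′

      tail head : Fin (m G) → Fin (n G)
      tail e = if o e then proj₁ (ends G e) else proj₂ (ends G e)
      head e = if o e then proj₂ (ends G e) else proj₁ (ends G e)

    colouring : ∃ λ (χ : Fin (m G) → Fin k) → ∀ i j v →
      ∣ degreeIn tail head tail (λ e → does (χ e Fin.≟ i)) v - degreeIn tail head tail (λ e → does (χ e Fin.≟ j)) v ∣ ℕ.≤ 1 ×
      ∣ degreeIn tail head head (λ e → does (χ e Fin.≟ i)) v - degreeIn tail head head (λ e → does (χ e Fin.≟ j)) v ∣ ℕ.≤ 1
    colouring = equitable-colouring tail head k′

    χ : Fin (m G) → Fin k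
    χ = proj₁ colouring

    private
      out into : Fin k → Fin (n G) → ℤ
      out  i v = degreeIn tail head tail (λ e → does (χ e Fin.≟ i)) v
      into i v = degreeIn tail head head (λ e → does (χ e Fin.≟ i)) v

      out-close : ∀ v i j → ∣ out i v - out j v ∣ ℕ.≤ 1
      out-close v i j = proj₁ (proj₂ colouring i j v)

      into-close : ∀ v i j → ∣ into i v - into j v ∣ ℕ.≤ 1
      into-close v i j = proj₂ (proj₂ colouring i j v)

      sum-colours : ∀ {n} (i : Fin n) (x : ℤ) → sum (λ j → if does (i Fin.≟ j) then x else 0ℤ) ≡ x
      sum-colours {suc n} zero    x = trans (cong (_+_ x) (sum-zero {n} (λ _ → 0ℤ) λ _ → refl)) (+-identityʳ x)
      sum-colours {suc n} (suc i) x = trans (+-identityˡ _) (sum-colours i x)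

      out-total : ∀ v → sum (λ i → out i v) ≡ outdegree (proj₁ ∘ ends G) (proj₂ ∘ ends G) o v
      out-total v = trans (∑-comm (λ i e → if does (χ e Fin.≟ i) then V.δ (tail e) v else 0ℤ))
        (sum-cong-≗ λ e → trans (sum-colours (χ e) (V.δ (tail e) v)) (by e (o e)))
        where
        by : ∀ e b → V.δ (if b then proj₁ (ends G e) else proj₂ (ends G e)) v ≡
                     (if b then V.δ (proj₁ (ends G e)) v else V.δ (proj₂ (ends G e)) v)
        by e true  = refl
        by e false = refl

      out-exact : ∀ v → v ≢ z → ∀ i j → out i v - out j v ≡ 0ℤ
      out-exact v v≢z i j with divisible v v≢z
      ... | t , eq = trans (cong₂ _-_ (share i) (share j)) (+-inverseʳ t)
        where
        share : ∀ i → out i v ≡ t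
        share = divisible-share (λ i → out i v) t (trans (out-total v) eq) (out-close v)

      deg-split : ∀ i v → + deg G (factor G χ i) v ≡ out i v + into i v
      deg-split i v = trans (cong +_ (sumˡ-allFin (λ e → if factor G χ i e then incid G e v else 0)))
        (trans (+-sum (λ e → if factor G χ i e then incid G e v else 0))
        (trans (sum-cong-≗ λ e → trans (cong (λ b → + (if b then incid G e v else 0)) (isYes≗does (χ e Fin.≟ i))) (by e (does (χ e Fin.≟ i)) (o e)))
               (∑-distrib-+ (λ e → if does (χ e Fin.≟ i) then V.δ (tail e) v else 0ℤ) (λ e → if does (χ e Fin.≟ i) then V.δ (head e) v else 0ℤ))))
        where
        count : ∀ (u : Fin (n G)) → + (if ⌊ u Fin.≟ v ⌋ then 1 else 0) ≡ V.δ u v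
        count u rewrite isYes≗does (u Fin.≟ v) with does (u Fin.≟ v)
        ... | true  = refl
        ... | false = refl
        by : ∀ e b c → + (if b then incid G e v else 0) ≡
          (if b then V.δ (if c then proj₁ (ends G e) else proj₂ (ends G e)) v else 0ℤ) +
          (if b then V.δ (if c then proj₂ (ends G e) else proj₁ (ends G e)) v else 0ℤ)
        by e false c     = refl
        by e true  true  = cong₂ _+_ (count (proj₁ (ends G e))) (count (proj₂ (ends G e)))
        by e true  false = trans (cong₂ _+_ (count (proj₁ (ends G e))) (count (proj₂ (ends G e)))) (+-comm (V.δ (proj₁ (ends G e)) v) _)

      factors-total : ∀ (x : Fin (m G) → ℕ) →
        sum (λ i → + sumˡ (map (λ e → if factor G χ i e then x e else 0) (allFin (m G)))) ≡ + sumˡ (map x (allFin (m G)))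
      factors-total x = begin
        sum (λ i → + sumˡ (map (λ e → if factor G χ i e then x e else 0) (allFin (m G))))
          ≡⟨ sum-cong-≗ (λ i → trans (cong +_ (sumˡ-allFin (λ e → if factor G χ i e then x e else 0)))
               (+-sum (λ e → if factor G χ i e then x e else 0))) ⟩
        sum (λ i → sum (λ e → + (if factor G χ i e then x e else 0)))
          ≡⟨ ∑-comm (λ i e → + (if factor G χ i e then x e else 0)) ⟩
        sum (λ e → sum (λ i → + (if factor G χ i e then x e else 0)))
          ≡⟨ sum-cong-≗ (λ e → trans (sum-cong-≗ λ i → pull e i) (sum-colours (χ e) (+ x e))) ⟩
        sum (λ e → + x e)
          ≡⟨ trans (cong +_ (sumˡ-allFin x)) (+-sum x) ⟨
        + sumˡ (map x (allFin (m G))) ∎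
        where
        open ≡-Reasoning
        pull : ∀ e i → + (if factor G χ i e then x e else 0) ≡ (if does (χ e Fin.≟ i) then + x e else 0ℤ)
        pull e i rewrite isYes≗does (χ e Fin.≟ i) with does (χ e Fin.≟ i)
        ... | true  = refl
        ... | false = refl

      size-split : ∀ i → + size G (factor G χ i) ≡ sum (out i)
      size-split i = begin
        + size G (factor G χ i)
          ≡⟨ trans (cong +_ (sumˡ-allFin (λ e → if factor G χ i e then 1 else 0))) (+-sum (λ e → if factor G χ i e then 1 else 0)) ⟩
        sum (λ e → + (if factor G χ i e then 1 else 0))
          ≡⟨ sum-cong-≗ (λ e → by e) ⟩
        sum (λ e → sum (λ v → if does (χ e Fin.≟ i) then V.δ (tail e) v else 0ℤ))
          ≡⟨ ∑-comm (λ e v → if does (χ e Fin.≟ i) then V.δ (tail e) v else 0ℤ) ⟩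
        sum (out i) ∎
        where
        open ≡-Reasoning
        by : ∀ e → + (if factor G χ i e then 1 else 0) ≡ sum (λ v → if does (χ e Fin.≟ i) then V.δ (tail e) v else 0ℤ)
        by e rewrite isYes≗does (χ e Fin.≟ i) with does (χ e Fin.≟ i)
        ... | true  = sym (sum-colours (tail e) 1ℤ)
        ... | false = sym (sum-zero {n G} (λ _ → 0ℤ) λ _ → refl)

      ⊖-form : ∀ a b c → ∣ (a ℕ.* b) ⊖ c ∣ ≡ ∣ + a * + b - + c ∣
      ⊖-form a b c = cong ∣_∣ (trans (sym (m-n≡m⊖n (a ℕ.* b) c)) (cong (_- + c) (pos-* a b)))

      spread : ∀ (x : Fin k → ℕ) c B → sum (λ i → + x i) ≡ + c → (∀ i j → ∣ + x i - + x j ∣ ℕ.≤ B) →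
               ∀ i → ∣ (k ℕ.* x i) ⊖ c ∣ ℕ.≤ k′ ℕ.* B
      spread x c B total close i = subst (ℕ._≤ k′ ℕ.* B)
        (trans (cong (λ s → ∣ + k * + x i - s ∣) total) (sym (⊖-form k (x i) c)))
        (share-deviation (λ i → + x i) B close i)

      -- Counting each edge at its tail makes the size of a factor the sum of its outdegrees. These
      -- agree for all colours away from `z`, so two sizes differ only by the difference of the
      -- outdegrees at `z`.
      size-close : ∀ i j → ∣ + size G (factor G χ i) - + size G (factor G χ j) ∣ ℕ.≤ 1
      size-close i j = subst (λ y → ∣ y ∣ ℕ.≤ 1)
        (sym (trans (cong₂ _-_ (size-split i) (size-split j)) (trans (sym (sum-- (out i) (out j))) 
          (only-z (λ v → out i v - out j v) z (λ v v≢z → out-exact v v≢z i j)))))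
        (out-close z i j)
        where
        only-z : ∀ {n} (f : Fin n → ℤ) z → (∀ v → v ≢ z → f v ≡ 0ℤ) → sum f ≡ f z
        only-z {suc n} f z off = trans (sum-remove {i = z} f)
          (trans (cong (_+_ (f z)) (sum-zero (removeAt f z) λ v → off (punchIn z v) (Fin.punchInᵢ≢i z v))) (+-identityʳ (f z)))

      deg-difference : ∀ i j v → + deg G (factor G χ i) v - + deg G (factor G χ j) v ≡
                                 (out i v - out j v) + (into i v - into j v)
      deg-difference i j v = trans (cong₂ _-_ (deg-split i v) (deg-split j v)) (lem (out i v) (into i v) (out j v) (into j v))
        where
        lem : ∀ a b c d → (a + b) - (c + d) ≡ (a - c) + (b - d)
        lem = solve-∀

      deg-close₂ : ∀ v i j → ∣ + deg G (factor G χ i) v - + deg G (factor G χ j) v ∣ ℕ.≤ 2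
      deg-close₂ v i j = ℕₚ.≤-trans (ℕₚ.≤-reflexive (cong ∣_∣ (deg-difference i j v)))
        (ℕₚ.≤-trans (∣i+j∣≤∣i∣+∣j∣ (out i v - out j v) (into i v - into j v)) (ℕₚ.+-mono-≤ (out-close v i j) (into-close v i j)))

      deg-close₁ : ∀ v → v ≢ z → ∀ i j → ∣ + deg G (factor G χ i) v - + deg G (factor G χ j) v ∣ ℕ.≤ 1
      deg-close₁ v v≢z i j = ℕₚ.≤-trans (ℕₚ.≤-reflexive (cong ∣_∣ (trans (deg-difference i j v)
        (trans (cong (_+ (into i v - into j v)) (out-exact v v≢z i j)) (+-identityˡ (into i v - into j v)))))) (into-close v i j)

    size-share : ∀ i → ∣ (k ℕ.* size G (factor G χ i)) ⊖ size G (allEdges G) ∣ ℕ.< k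
    size-share i = ℕ.s≤s (ℕₚ.≤-trans
      (spread (λ i → size G (factor G χ i)) (size G (allEdges G)) 1 (factors-total (λ _ → 1)) size-close i)
      (ℕₚ.≤-reflexive (ℕₚ.*-identityʳ k′)))

    degree-share-z : ∀ i → ∣ (k ℕ.* deg G (factor G χ i) z) ⊖ deg G (allEdges G) z ∣ ℕ.< k ℕ.* 2
    degree-share-z i = ℕ.s≤s (ℕₚ.m≤n⇒m≤1+n
      (spread (λ i → deg G (factor G χ i) z) (deg G (allEdges G) z) 2 (factors-total (λ e → incid G e z)) (deg-close₂ z) i))

    degree-share : ∀ i v → v ≢ z → ∣ (k ℕ.* deg G (factor G χ i) v) ⊖ deg G (allEdges G) v ∣ ℕ.< k
    degree-share i v v≢z = ℕ.s≤s (ℕₚ.≤-trans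
      (spread (λ i → deg G (factor G χ i) v) (deg G (allEdges G) v) 1 (factors-total (λ e → incid G e v)) (deg-close₁ v v≢z) i)
      (ℕₚ.≤-reflexive (ℕₚ.*-identityʳ k′)))

    degree-close-z : ∀ i j → ∣ deg G (factor G χ i) z ⊖ deg G (factor G χ j) z ∣ ℕ.≤ 2
    degree-close-z i j = subst (λ y → ∣ y ∣ ℕ.≤ 2) (m-n≡m⊖n (deg G (factor G χ i) z) (deg G (factor G χ j) z)) (deg-close₂ z i j)

open import Defs
open import Data.Nat using (ℕ; _*_; _∸_; _≤_; _<_)
open import Data.Integer using (∣_∣; _⊖_)
open import Data.Product using (Σ)

theorem3p2 : (G : Graph) (z : Fin (n G)) (k : ℕ) → 1 ≤ k →
    EdgeConnected (3 * k ∸ 3) G ⊎ TreeConnected (2 * k ∸ 2) G →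
    Σ (Fin (m G) → Fin k) λ c →
    (∀ i → ∣ (k * size G (factor G c i)) ⊖ size G (allEdges G) ∣ < k) ×
    (∀ i → ∣ (k * deg G (factor G c i) z) ⊖ deg G (allEdges G) z ∣ < k * 2) ×
    (∀ i v → v ≢ z → ∣ (k * deg G (factor G c i) v) ⊖ deg G (allEdges G) v ∣ < k) ×
    (∀ i j → ∣ deg G (factor G c i) z ⊖ deg G (factor G c j) z ∣ ≤ 2)
theorem3p2 G z (suc k′) 1≤k hyp = χ , size-share , degree-share-z , degree-share , degree-close-z
  where
  oriented = Assembly.modulo-orientation G z (suc k′) 1≤k hyp
  open Assembly.Decomposition G z k′ (proj₁ oriented) (proj₂ oriented)
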